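{- For $n\in\mathbb N=\{0,1,2,\ldots\}$ define the polynomial $$R_n(x)=\sum_{k=0}^n\binom nk\binom{n+k}k\frac{x^k}{2k-1}\in\mathbb Z[x],\qquad R_n=R_n(1).$$ (i) Let $p\equiv1\pmod 4$ be a prime, and write $p=x^2+y^2$ with integers $x\equiv1\pmod 4$ and $y\equiv0\pmod 2$. Then $$R_{(p-1)/2}-p\equiv\sum_{k=0}^{p-1}\frac{\binom{2k}k^2}{(2k-1)(-16)^k}\equiv-2\left(\frac 2p\right)x\pmod{p^2},$$ $$R_{(p-1)/2}(-2)+2p\left(\frac 2p\right)\equiv\sum_{k=0}^{p-1}\frac{\binom{2k}k^2}{(2k-1)8^k}\equiv\left(\frac2p\right)\frac p{2x}\pmod{p^2},$$ and $$R_{(p-1)/2}\left(-\frac12\right)+\frac p2\left(\frac 2p\right)\equiv\sum_{k=0}^{p-1}\frac{\binom{2k}k^2}{(2k-1)32^k}\equiv\frac p{4x}-x\pmod{p^2}.$$ (ii) Let $p\equiv3\pmod 4$ be a prime. Then $$R_{(p-1)/2}\equiv \sum_{k=0}^{p-1}\frac{\binom{2k}k^2}{(2k-1)(-16)^k}\equiv-\frac12\left(\frac 2p\right)\binom{(p+1)/2}{(p+1)/4}\pmod p,$$ $$R_{(p-1)/2}(-2)\equiv \sum_{k=0}^{p-1}\frac{\binom{2k}k^2}{(2k-1)8^k}\equiv-\frac12\left(\frac 2p\right)\binom{(p+1)/2}{(p+1)/4}\pmod p,$$ and $$R_{(p-1)/2}\left(-\frac12\right)+\frac p2\left(\frac2p\right)\equiv\sum_{k=0}^{p-1}\frac{\binom{2k}k^2}{(2k-1)32^k}\equiv-\frac{p+1}{2^p+2}\binom{(p+1)/2}{(p+1)/4}\pmod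 {p^2}.$$
   Context: $\left(\frac{\cdot}{p}\right)$ denotes the Legendre symbol. Congruences between rational numbers whose denominators are prime to $p$ are understood in the ring of $p$-integral rationals (i.e. $a\equiv b\pmod{p^m}$ means $(a-b)/p^m$ has denominator prime to $p$). Note $(2k-1)\mid\binom{2k}k$ for all $k\in\mathbb N$, so $R_n(x)$ has integer coefficients. -}

module Defs where

open import Data.Nat as ℕ using (ℕ; zero; suc)
open import Data.Nat.DivMod using (_%_)
open import Data.Nat.Combinatorics using (_C_)
open import Data.Integer as ℤ using (ℤ; +_; -[1+_])
open import Data.Rational using (ℚ; _/_; 0ℚ; 1ℚ; _+_; _*_; _-_; -_; _÷_; ≢-nonZero)
open import Data.Rational.Properties using (_≟_)
open import Data.Bool using (Bool; true; false; if_then_else_)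
open import Data.List using (upTo)
open import Data.Bool.ListAction using (any)
open import Data.Product using (∃; _×_)
open import Relation.Binary.PropositionalEquality using (_≡_)
open import Relation.Nullary using (¬_; yes; no)
open import Data.Nat.Divisibility using (_∣_)

ℤtoℚ : ℤ → ℚ
ℤtoℚ z = z / 1

ℕtoℚ : ℕ → ℚ
ℕtoℚ n = + n / 1

_^ℚ_ : ℚ → ℕ → ℚ
q ^ℚ zero  = 1ℚ
q ^ℚ suc k = q * (q ^ℚ k)

-- total division on ℚ (a ÷ b, and 0 when b = 0); only used with nonzero divisors
divℚ : ℚ → ℚ → ℚ
divℚ a b with b ≟ 0ℚ
... | yes _  = 0ℚ
... | no b≢0 = _÷_ a b {{≢-nonZero b≢0}}

inv2k-1 : ℕ → ℚ
inv2k-1 zero    = - 1ℚ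
inv2k-1 (suc j) = + 1 / suc (j ℕ.+ j)

sumTo : ℕ → (ℕ → ℚ) → ℚ
sumTo zero    f = f 0
sumTo (suc n) f = sumTo n f + f (suc n)

R : ℕ → ℚ → ℚ
R n x = sumTo n (λ k → ℕtoℚ ((n C k) ℕ.* ((n ℕ.+ k) C k)) * (x ^ℚ k) * inv2k-1 k)

S : ℕ → ℚ → ℚ
S p c = sumTo (p ℕ.∸ 1)
  (λ k → divℚ (ℕtoℚ (((2 ℕ.* k) C k) ℕ.* ((2 ℕ.* k) C k)) * inv2k-1 k) (c ^ℚ k))

legendre : ℕ → ℕ → ℤ
legendre a zero = + 0
legendre a (suc q) =
  if (a % suc q) ℕ.≡ᵇ 0 then + 0
  else if any (λ t → ((t ℕ.* t) % suc q) ℕ.≡ᵇ (a % suc q)) (upTo (suc q)) then + 1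
  else -[1+ 0 ]

-- a ≡ b (mod p^m) in the ring of p-integral rationals:
-- (a - b) / p^m = c / d with c ∈ ℤ, d ∈ ℕ and p ∤ d
CongQ : ℕ → ℕ → ℚ → ℚ → Set
CongQ p m a b = ∃ λ (c : ℤ) → ∃ λ (d : ℕ) →
  (¬ (p ∣ d)) × ((a - b) * ℕtoℚ d ≡ ℕtoℚ (p ℕ.^ m) * ℤtoℚ c)

{-# OPTIONS --safe #-}
-- Modulo p² the terms of S are those of R, apart from the one whose denominator 2k - 1 is p, so everything
-- reduces to V(x) = Σ C(n,k) C(n+k,k) xᵏ / (2k-1) with n = (p-1)/2, which is a combination of the Legendre
-- polynomials Pₙ and Pₙ₋₁ at 1 + 2x.  At x = -1/2 these are central binomial coefficients.  For p = 4w + 1,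
-- Pₙ(3) is found by pairing k with n - k, which turns the terms of order p into alternating convolutions, and
-- V(1) by averaging two Kummer series at -1 that are conjugate under p ↦ -p, so that the terms of order p
-- cancel.  The outcome is in terms of C(2w,w) and p / C(2w,w).  The sum of these two quantities is also the
-- Jacobsthal sum Σ φ(t³-t): since φ(v) ≡ (3vⁿ - v³ⁿ)/2 modulo p², that sum is a combination of power sums of
-- the numbers tᵖ, which are orthogonal modulo p².  The same formula for t³ - gt with g a nonresidue gives
-- p ≡ h₁² + h_g² modulo p² for the half sums, hence equality by size; so h₁ = ±x, with the sign read off
-- modulo 4.  For p ≡ 3 modulo 4 only the first of the two Kummer series is needed, modulo p.
module Submission where

open import Data.Nat as ℕ using (ℕ; zero; suc; _!; _≤_; _<_; _∸_; z≤n; s≤s)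
import Data.Nat.Properties as ℕP
import Data.Nat.Divisibility as ℕD
open import Data.Nat.Primality using (Prime; euclidsLemma; prime⇒nonTrivial)
open import Data.Nat.Combinatorics using (_C_; nCk+nC[k+1]≡[n+1]C[k+1])
open import Data.Integer as ℤ using (ℤ; +_; -[1+_])
import Data.Integer.Properties as ℤP
open import Data.Integer.Tactic.RingSolver using (solve; solve-∀)
open import Data.List using ([]; _∷_)
open import Data.Product using (_×_; _,_; proj₁; proj₂; ∃)
open import Data.Sum using (_⊎_; inj₁; inj₂; [_,_]′)
open import Data.Empty using (⊥; ⊥-elim)
open import Function using (_∘_)
open import Relation.Nullary using (¬_; yes; no; Dec)
open import Relation.Binary.PropositionalEquality using (_≡_; _≢_; refl; sym; trans; cong; cong₂; subst; subst₂; module ≡-Reasoning)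
open import Data.Integer.DivMod using (_%ℕ_; _/ℕ_; n%ℕd<d; a≡a%ℕn+[a/ℕn]*n)
import Data.Integer.Divisibility.Signed as ℤS
open import Data.Fin using (Fin; toℕ; fromℕ<)
import Data.Fin.Properties as FinP
open import Data.Fin.Permutation using (Permutation′; permutation)
open import Relation.Nullary.Decidable using (map′; ¬?; decidable-stable)
import Algebra.Properties.CommutativeMonoid.Sum ℤP.+-0-commutativeMonoid as FinSum
open import Data.Nat.Tactic.RingSolver using () renaming (solve-∀ to ℕ-solve-∀)
open import Relation.Binary.Definitions using (tri<; tri≈; tri>)
open import Data.Bool using (Bool; true; false; T; if_then_else_)
open import Data.Bool.ListAction using (any)
open import Data.List using (upTo)
open import Data.List.Membership.Propositional using (find; lose)
open import Data.List.Membership.Propositional.Properties using (∈-upTo⁺)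
open import Data.List.Relation.Unary.Any.Properties using (any⁺; any⁻)
open import Data.Nat.DivMod using (m<n⇒m%n≡m; m≡m%n+[m/n]*n; m*n/n≡m)
open import Data.Unit using (tt)
open import Defs
open import Data.Rational as ℚ using (ℚ; 0ℚ; 1ℚ; ≢-nonZero)
import Data.Rational.Properties as ℚP
open import Data.Rational.Unnormalised using (mkℚᵘ; *≡*; _≃_)
import Data.Rational.Unnormalised.Properties as ℚᵘP
open import Data.Rational.Solver using (module +-*-Solver)
import Data.Integer.Divisibility as ℤD

-- Since (n - k)(n + k + 1) = (p² - (2k+1)²)/4 for 2n + 1 = p, the product C(n,k) C(n+k,k) involves
-- p only through p². Hence S and R agree to the order p² and not merely p, and p ↦ -p, that is n ↦
-- -n - 1, fixes these coefficients, which is what the conjugation of the Kummer series relies on.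
-- The obstacle is the link between x and C(2w,w) modulo p²: it is usually drawn from Jacobi sums in
-- ℤ[i] and carries the Fermat quotient of 2. Here everything stays in ℤ; the Fermat quotient is
-- hidden in r = t² - 1 with t = 2^n and is absorbed into D = P_n(3), in terms of which the half sum
-- is -(D + p/D)/2. For a sign L ≡ t modulo p the square (t - L)² vanishes modulo p², so t² + 1 ≡
-- 2tL; this relation takes D to P_n(0), and it is the origin of the denominator 2^p + 2 = 2(t² + 1)
-- in part (ii).

module Integers where

  open import Data.Integer using (_+_; _*_; _-_; -_; _^_)

  -- Congruences as linear combinations

  infix 4 _≈_[_]
  infixr 5 _⟫_

  record _≈_[_] (a b M : ℤ) : Set where
    constructor by
    field
      quo : ℤ
      eqn : a - b ≡ quo * M

  -- Goals are closed as linear combinations of hypotheses; the last argument is a ring identity.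
  elc1 : ∀ {a b x y : ℤ} c → a ≡ b → x - y ≡ c * (a - b) → x ≡ y
  elc1 {a} {x = x} {y} c refl e = ℤP.i-j≡0⇒i≡j x y (trans e (ident c a))
    where
    ident : ∀ c a → c * (a - a) ≡ + 0
    ident = solve-∀

  elc2 : ∀ {a b a' b' x y : ℤ} c c' → a ≡ b → a' ≡ b' →
    x - y ≡ c * (a - b) + c' * (a' - b') → x ≡ y
  elc2 {a} {a' = a'} {x = x} {y} c c' refl refl e = ℤP.i-j≡0⇒i≡j x y (trans e (ident c a c' a'))
    where
    ident : ∀ c a c' a' → c * (a - a) + c' * (a' - a') ≡ + 0
    ident = solve-∀

  elc3 : ∀ {a b a' b' a'' b'' x y : ℤ} c c' c'' → a ≡ b → a' ≡ b' → a'' ≡ b'' →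
    x - y ≡ c * (a - b) + c' * (a' - b') + c'' * (a'' - b'') → x ≡ y
  elc3 {a} {a' = a'} {a'' = a''} {x = x} {y} c c' c'' refl refl refl e =
    ℤP.i-j≡0⇒i≡j x y (trans e (ident c a c' a' c'' a''))
    where
    ident : ∀ c a c' a' c'' a'' → c * (a - a) + c' * (a' - a') + c'' * (a'' - a'') ≡ + 0
    ident = solve-∀

  lc1 : ∀ {M a b x y : ℤ} c → a ≈ b [ M ] → x - y ≡ c * (a - b) → x ≈ y [ M ]
  lc1 {M} {a} {b} {x} {y} c (by q e) f = by (c * q) (trans f (trans (cong (c *_) e) (sym (ℤP.*-assoc c q M))))

  lc2 : ∀ {M a b a' b' x y : ℤ} c c' → a ≈ b [ M ] → a' ≈ b' [ M ] →
    x - y ≡ c * (a - b) + c' * (a' - b') → x ≈ y [ M ]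
  lc2 {M} c c' (by q e) (by q' e') f =
    by (c * q + c' * q') (trans f (trans (cong₂ (λ u v → c * u + c' * v) e e') (ident c q c' q' M)))
    where
    ident : ∀ c q c' q' M → c * (q * M) + c' * (q' * M) ≡ (c * q + c' * q') * M
    ident = solve-∀

  lc3 : ∀ {M a b a' b' a'' b'' x y : ℤ} c c' c'' → a ≈ b [ M ] → a' ≈ b' [ M ] → a'' ≈ b'' [ M ] →
    x - y ≡ c * (a - b) + c' * (a' - b') + c'' * (a'' - b'') → x ≈ y [ M ]
  lc3 {M} c c' c'' (by q e) (by q' e') (by q'' e'') f =
    by (c * q + c' * q' + c'' * q'') (trans f (trans (cong₂ _+_ (cong₂ (λ u v → c * u + c' * v) e e') (cong (c'' *_) e''))
      (ident c q c' q' c'' q'' M)))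
    where
    ident : ∀ c q c' q' c'' q'' M → c * (q * M) + c' * (q' * M) + c'' * (q'' * M) ≡ (c * q + c' * q' + c'' * q'') * M
    ident = solve-∀

  lc4 : ∀ {M a b a' b' a'' b'' a‴ b‴ x y : ℤ} c c' c'' c‴ →
    a ≈ b [ M ] → a' ≈ b' [ M ] → a'' ≈ b'' [ M ] → a‴ ≈ b‴ [ M ] →
    x - y ≡ c * (a - b) + c' * (a' - b') + c'' * (a'' - b'') + c‴ * (a‴ - b‴) → x ≈ y [ M ]
  lc4 {M} c c' c'' c‴ (by q e) (by q' e') (by q'' e'') (by q‴ e‴) f =
    by (c * q + c' * q' + c'' * q'' + c‴ * q‴)
      (trans f (trans (cong₂ _+_ (cong₂ _+_ (cong₂ (λ u v → c * u + c' * v) e e') (cong (c'' *_) e'')) (cong (c‴ *_) e‴))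
      (ident c q c' q' c'' q'' c‴ q‴ M)))
    where
    ident : ∀ c q c' q' c'' q'' c‴ q‴ M →
      c * (q * M) + c' * (q' * M) + c'' * (q'' * M) + c‴ * (q‴ * M) ≡ (c * q + c' * q' + c'' * q'' + c‴ * q‴) * M
    ident = solve-∀

  ≡⇒≈ : ∀ {a b M} → a ≡ b → a ≈ b [ M ]
  ≡⇒≈ {a} {M = M} refl = by (+ 0) (trans (ℤP.+-inverseʳ a) (sym (ℤP.*-zeroˡ M)))

  ≈-refl : ∀ {a M} → a ≈ a [ M ]
  ≈-refl = ≡⇒≈ refl

  ≈-sym : ∀ {a b M} → a ≈ b [ M ] → b ≈ a [ M ]
  ≈-sym {a} {b} h = lc1 (- + 1) h (solve (a ∷ b ∷ []))

  _⟫_ : ∀ {a b c M} → a ≈ b [ M ] → b ≈ c [ M ] → a ≈ c [ M ]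
  _⟫_ {a} {b} {c} h k = lc2 (+ 1) (+ 1) h k (solve (a ∷ b ∷ c ∷ []))

  ≈-+ : ∀ {a b c d M} → a ≈ b [ M ] → c ≈ d [ M ] → a + c ≈ b + d [ M ]
  ≈-+ {a} {b} {c} {d} h k = lc2 (+ 1) (+ 1) h k (solve (a ∷ b ∷ c ∷ d ∷ []))

  ≈-* : ∀ {a b c d M} → a ≈ b [ M ] → c ≈ d [ M ] → a * c ≈ b * d [ M ]
  ≈-* {a} {b} {c} {d} h k = lc2 c b h k (solve (a ∷ b ∷ c ∷ d ∷ []))

  ≈-*ˡ : ∀ {a b M} c → a ≈ b [ M ] → c * a ≈ c * b [ M ]
  ≈-*ˡ c = ≈-* (≈-refl {c})

  ≈-neg : ∀ {a b M} → a ≈ b [ M ] → - a ≈ - b [ M ]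
  ≈-neg {a} {b} h = lc1 (- + 1) h (solve (a ∷ b ∷ []))

  ≈-^ : ∀ {a b M} k → a ≈ b [ M ] → a ^ k ≈ b ^ k [ M ]
  ≈-^ zero    h = ≈-refl
  ≈-^ (suc k) h = ≈-* h (≈-^ k h)

  difference≈0 : ∀ {a b M} → a ≈ b [ M ] → a - b ≈ + 0 [ M ]
  difference≈0 {a} {b} (by q e) = by q (trans (ℤP.+-identityʳ (a - b)) e)

  modulus≈0 : ∀ {M} c → c * M ≈ + 0 [ M ]
  modulus≈0 {M} c = by c (ℤP.+-identityʳ (c * M))

  weaken : ∀ {a b M} N → a ≈ b [ N * M ] → a ≈ b [ M ]
  weaken {M = M} N (by q e) = by (q * N) (trans e (sym (ℤP.*-assoc q N M)))

  scale : ∀ {a b M} N → a ≈ b [ M ] → N * a ≈ N * b [ N * M ]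
  scale {a} {b} {M} N (by q e) = by q (trans (ident N a b) (trans (cong (N *_) e) (ident' N q M)))
    where
    ident : ∀ N a b → N * a - N * b ≡ N * (a - b)
    ident = solve-∀
    ident' : ∀ N q M → N * (q * M) ≡ q * (N * M)
    ident' = solve-∀

  -- Finite sums

  ∑ : ℕ → (ℕ → ℤ) → ℤ
  ∑ zero    f = + 0
  ∑ (suc N) f = ∑ N f + f N

  ∑-≈ : ∀ N {f g M} → (∀ k → k < N → f k ≈ g k [ M ]) → ∑ N f ≈ ∑ N g [ M ]
  ∑-≈ zero    h = ≈-refl
  ∑-≈ (suc N) h = ≈-+ (∑-≈ N (λ k k<N → h k (ℕP.m≤n⇒m≤1+n k<N))) (h N ℕP.≤-refl)

  ∑-cong : ∀ N {f g} → (∀ k → k < N → f k ≡ g k) → ∑ N f ≡ ∑ N g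
  ∑-cong zero    h = refl
  ∑-cong (suc N) h = cong₂ _+_ (∑-cong N (λ k k<N → h k (ℕP.m≤n⇒m≤1+n k<N))) (h N ℕP.≤-refl)

  ∑-+ : ∀ N f g → ∑ N (λ k → f k + g k) ≡ ∑ N f + ∑ N g
  ∑-+ zero    f g = refl
  ∑-+ (suc N) f g rewrite ∑-+ N f g = ident (∑ N f) (∑ N g) (f N) (g N)
    where
    ident : ∀ a b c d → a + b + (c + d) ≡ a + c + (b + d)
    ident = solve-∀

  ∑-*ˡ : ∀ N c f → ∑ N (λ k → c * f k) ≡ c * ∑ N f
  ∑-*ˡ zero    c f = sym (ℤP.*-zeroʳ c)
  ∑-*ˡ (suc N) c f rewrite ∑-*ˡ N c f = sym (ℤP.*-distribˡ-+ c (∑ N f) (f N))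

  ∑-0 : ∀ N → ∑ N (λ _ → + 0) ≡ + 0
  ∑-0 zero    = refl
  ∑-0 (suc N) = cong (_+ + 0) (∑-0 N)

  ∑-1 : ∀ N → ∑ N (λ _ → + 1) ≡ + N
  ∑-1 zero    = refl
  ∑-1 (suc N) = trans (cong (_+ + 1) (∑-1 N)) (ℤP.+-comm (+ N) (+ 1))

  ∑-first : ∀ N f → ∑ (suc N) f ≡ f 0 + ∑ N (f ∘ suc)
  ∑-first zero    f = trans (ℤP.+-identityˡ (f 0)) (sym (ℤP.+-identityʳ (f 0)))
  ∑-first (suc N) f = trans (cong (_+ f (suc N)) (∑-first N f)) (ℤP.+-assoc (f 0) (∑ N (f ∘ suc)) (f (suc N)))

  ∑-split : ∀ M N f → ∑ (M ℕ.+ N) f ≡ ∑ M f + ∑ N (λ k → f (M ℕ.+ k))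
  ∑-split M zero    f rewrite ℕP.+-identityʳ M = sym (ℤP.+-identityʳ (∑ M f))
  ∑-split M (suc N) f rewrite ℕP.+-suc M N | ∑-split M N f =
    ℤP.+-assoc (∑ M f) (∑ N (λ k → f (M ℕ.+ k))) (f (M ℕ.+ N))

  ∑-rev : ∀ N f → ∑ (suc N) f ≡ ∑ (suc N) (λ k → f (N ∸ k))
  ∑-rev zero    f = refl
  ∑-rev (suc N) f = begin
    ∑ (suc N) f + f (suc N)                       ≡⟨ ℤP.+-comm (∑ (suc N) f) (f (suc N)) ⟩
    f (suc N) + ∑ (suc N) f                       ≡⟨ cong (λ z → f (suc N) + z) (∑-rev N f) ⟩
    f (suc N) + ∑ (suc N) (λ k → f (N ∸ k))     ≡⟨ ∑-first (suc N) (λ k → f (suc N ∸ k)) ⟨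
    ∑ (suc (suc N)) (λ k → f (suc N ∸ k))       ∎
    where open ≡-Reasoning

  ∑-antisymmetric : ∀ N f → (∀ k → k ≤ N → f (N ∸ k) ≡ - f k) → ∑ (suc N) f ≡ + 0
  ∑-antisymmetric N f h = ℤP.*-cancelˡ-≡ (+ 2) (∑ (suc N) f) (+ 0) (elc1 (+ 1) negated (ident (∑ (suc N) f)))
    where
    negated : ∑ (suc N) f ≡ - + 1 * ∑ (suc N) f
    negated = trans (∑-rev N f) (trans (∑-cong (suc N) (λ k k≤N → trans (h k (ℕP.≤-pred k≤N)) (sym (ℤP.-1*i≡-i (f k))))) (∑-*ˡ (suc N) (- + 1) f))
    ident : ∀ s → + 2 * s - + 2 * + 0 ≡ + 1 * (s - - + 1 * s)
    ident = solve-∀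

  ∑-swap : ∀ M N (f : ℕ → ℕ → ℤ) → ∑ M (λ i → ∑ N (f i)) ≡ ∑ N (λ j → ∑ M (λ i → f i j))
  ∑-swap zero    N f = sym (∑-0 N)
  ∑-swap (suc M) N f rewrite ∑-swap M N f = sym (∑-+ N (λ j → ∑ M (λ i → f i j)) (f M))

  ∑-single : ∀ N a {f : ℕ → ℤ} {M} → a < N → (∀ k → k < N → k ≢ a → f k ≈ + 0 [ M ]) → ∑ N f ≈ f a [ M ]
  ∑-single (suc N) a {f} {M} a<N h with a ℕ.≟ N
  ... | yes refl = lc1 (+ 1) z (ident (∑ N f) (f a))
    where
    z : ∑ N f ≈ + 0 [ M ]
    z = ∑-≈ N (λ k k<N → h k (ℕP.m≤n⇒m≤1+n k<N) (ℕP.<⇒≢ k<N)) ⟫ ≡⇒≈ (∑-0 N)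
    ident : ∀ s u → s + u - u ≡ + 1 * (s - + 0)
    ident = solve-∀
  ... | no a≢N = lc2 (+ 1) (+ 1) (∑-single N a (ℕP.≤∧≢⇒< (ℕP.≤-pred a<N) a≢N) (λ k k<N → h k (ℕP.m≤n⇒m≤1+n k<N)))
                   (h N ℕP.≤-refl (a≢N ∘ sym)) (ident (∑ N f) (f N) (f a))
    where
    ident : ∀ s u v → s + u - v ≡ + 1 * (s - v) + + 1 * (u - + 0)
    ident = solve-∀

  -- Binomial coefficients

  bin : ℕ → ℕ → ℤ
  bin _       zero    = + 1
  bin zero    (suc _) = + 0
  bin (suc n) (suc k) = bin n k + bin n (suc k)

  bin≡C : ∀ n k → bin n k ≡ + (n C k)
  bin≡C zero    zero    = refl
  bin≡C (suc n) zero    = cong +_ (sym (nC0≡1 (suc n)))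
    where
    nC0≡1 : ∀ n → n C 0 ≡ 1
    nC0≡1 zero    = refl
    nC0≡1 (suc n) = refl
  bin≡C zero    (suc k) = refl
  bin≡C (suc n) (suc k) = trans (cong₂ _+_ (bin≡C n k) (bin≡C n (suc k))) (cong +_ (nCk+nC[k+1]≡[n+1]C[k+1] n k))

  bin-absorb : ∀ n k → + suc k * bin (suc n) (suc k) ≡ + suc n * bin n k
  bin-absorb zero    zero    = refl
  bin-absorb zero    (suc k) = ℤP.*-zeroʳ (+ suc (suc k))
  bin-absorb (suc n) zero    = elc1 (+ 1) (bin-absorb n zero) (ident (bin (suc n) 1) (+ n))
    where
    ident : ∀ b n → + 1 * (+ 1 + b) - (+ 1 + (+ 1 + n)) * + 1 ≡ + 1 * (+ 1 * b - (+ 1 + n) * + 1)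
    ident = solve-∀
  bin-absorb (suc n) (suc k) =
    elc2 (+ 1) (+ 1) (bin-absorb n k) (bin-absorb n (suc k)) (ident (bin n k) (bin n (suc k)) (bin (suc n) (suc (suc k))) (+ n) (+ k))
    where
    ident : ∀ b₀ b₁ B n k →
      (+ 1 + (+ 1 + k)) * (b₀ + b₁ + B) - (+ 1 + (+ 1 + n)) * (b₀ + b₁)
        ≡ + 1 * ((+ 1 + k) * (b₀ + b₁) - (+ 1 + n) * b₀) + + 1 * ((+ 1 + (+ 1 + k)) * B - (+ 1 + n) * b₁)
    ident = solve-∀

  bin-upper : ∀ n k → + suc k * bin n (suc k) ≡ (+ n - + k) * bin n k
  bin-upper n k = elc1 (+ 1) (bin-absorb n k) (ident (bin n k) (bin n (suc k)) (+ n) (+ k))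
    where
    ident : ∀ b₀ b₁ n k → (+ 1 + k) * b₁ - (n - k) * b₀ ≡ + 1 * ((+ 1 + k) * (b₀ + b₁) - (+ 1 + n) * b₀)
    ident = solve-∀

  bin-lower : ∀ n k → (+ suc n - + k) * bin (suc n) k ≡ + suc n * bin n k
  bin-lower n zero    = cong (_* + 1) (ℤP.+-identityʳ (+ suc n))
  bin-lower n (suc k) = elc1 (- + 1) (bin-upper n k) (ident (bin n k) (bin n (suc k)) (+ n) (+ k))
    where
    ident : ∀ b₀ b₁ n k → (+ 1 + n - (+ 1 + k)) * (b₀ + b₁) - (+ 1 + n) * b₁ ≡ (- + 1) * ((+ 1 + k) * b₁ - (n - k) * b₀)
    ident = solve-∀

  bin-zero : ∀ n k → n < k → bin n k ≡ + 0
  bin-zero zero    (suc k) _         = refl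
  bin-zero (suc n) (suc k) (s≤s n<k) = cong₂ _+_ (bin-zero n k n<k) (bin-zero n (suc k) (ℕP.m≤n⇒m≤1+n n<k))

  bin-diag : ∀ n → bin n n ≡ + 1
  bin-diag zero    = refl
  bin-diag (suc n) = cong₂ _+_ (bin-diag n) (bin-zero n (suc n) ℕP.≤-refl)

  bin-! : ∀ k m → bin (k ℕ.+ m) k * (+ (k !) * + (m !)) ≡ + ((k ℕ.+ m) !)
  bin-! zero    m = solve-∀′ (+ (m !))
    where
    solve-∀′ : ∀ a → + 1 * (+ 1 * a) ≡ a
    solve-∀′ = solve-∀
  bin-! (suc k) m = begin
    bin (suc (k ℕ.+ m)) (suc k) * (+ (suc k !) * + (m !))
      ≡⟨ cong (λ z → bin (suc (k ℕ.+ m)) (suc k) * (z * + (m !))) (ℤP.pos-* (suc k) (k !)) ⟩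
    bin (suc (k ℕ.+ m)) (suc k) * (+ suc k * + (k !) * + (m !))
      ≡⟨ elc2 (+ (k !) * + (m !)) (+ suc (k ℕ.+ m)) (bin-absorb (k ℕ.+ m) k) (bin-! k m)
           (ident (bin (suc (k ℕ.+ m)) (suc k)) (bin (k ℕ.+ m) k) (+ suc k) (+ suc (k ℕ.+ m)) (+ (k !)) (+ (m !)) (+ ((k ℕ.+ m) !))) ⟩
    + suc (k ℕ.+ m) * + ((k ℕ.+ m) !)
      ≡⟨ ℤP.pos-* (suc (k ℕ.+ m)) ((k ℕ.+ m) !) ⟨
    + (suc (k ℕ.+ m) !) ∎
    where
    open ≡-Reasoning
    ident : ∀ B b k n x y z → B * (k * x * y) - n * z ≡ x * y * (k * B - n * b) + n * (b * (x * y) - z)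
    ident = solve-∀

  binomial : ∀ x y N → (x + y) ^ N ≡ ∑ (suc N) (λ k → bin N k * (x ^ k * y ^ (N ∸ k)))
  binomial x y zero    = refl
  binomial x y (suc N) = begin
    (x + y) * (x + y) ^ N
      ≡⟨ cong ((x + y) *_) (binomial x y N) ⟩
    (x + y) * ∑ (suc N) f
      ≡⟨ ℤP.*-distribʳ-+ (∑ (suc N) f) x y ⟩
    x * ∑ (suc N) f + y * ∑ (suc N) f
      ≡⟨ cong₂ _+_ (sym (∑-*ˡ (suc N) x f)) shifted ⟩
    ∑ (suc N) (λ k → x * f k) + (y ^ suc N + ∑ (suc N) g)
      ≡⟨ ident (∑ (suc N) (λ k → x * f k)) (y ^ suc N) (∑ (suc N) g) ⟩
    + 1 * (+ 1 * y ^ suc N) + (∑ (suc N) (λ k → x * f k) + ∑ (suc N) g)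
      ≡⟨ cong (λ z → + 1 * (+ 1 * y ^ suc N) + z) (trans (sym (∑-+ (suc N) (λ k → x * f k) g)) (∑-cong (suc N) (λ k _ → pascal k))) ⟩
    + 1 * (+ 1 * y ^ suc N) + ∑ (suc N) (h ∘ suc)
      ≡⟨ ∑-first (suc N) h ⟨
    ∑ (suc (suc N)) h ∎
    where
    open ≡-Reasoning
    f g h : ℕ → ℤ
    f k = bin N k * (x ^ k * y ^ (N ∸ k))
    g k = bin N (suc k) * (x ^ suc k * y ^ (N ∸ k))
    h k = bin (suc N) k * (x ^ k * y ^ (suc N ∸ k))
    f' : ℕ → ℤ
    f' k = bin N k * (x ^ k * y ^ (suc N ∸ k))
    ident : ∀ a b c → a + (b + c) ≡ + 1 * (+ 1 * b) + (a + c)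
    ident = solve-∀
    pascal : ∀ k → x * f k + g k ≡ h (suc k)
    pascal k = ident' x (bin N k) (bin N (suc k)) (x ^ k) (y ^ (N ∸ k))
      where
      ident' : ∀ x b b' X Y → x * (b * (X * Y)) + b' * (x * X * Y) ≡ (b + b') * (x * X * Y)
      ident' = solve-∀
    shifted : y * ∑ (suc N) f ≡ y ^ suc N + ∑ (suc N) g
    shifted = begin
      y * ∑ (suc N) f              ≡⟨ sym (∑-*ˡ (suc N) y f) ⟩
      ∑ (suc N) (λ k → y * f k)    ≡⟨ ∑-cong (suc N) (λ k k<N → yf k (ℕP.≤-pred k<N)) ⟩
      ∑ (suc N) f'                 ≡⟨ ℤP.+-identityʳ (∑ (suc N) f') ⟨
      ∑ (suc N) f' + + 0           ≡⟨ cong (λ z → ∑ (suc N) f' + z) (sym last) ⟩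
      ∑ (suc (suc N)) f'           ≡⟨ ∑-first (suc N) f' ⟩
      f' 0 + ∑ (suc N) g           ≡⟨ cong (_+ ∑ (suc N) g) (trans (ℤP.*-identityˡ (+ 1 * y ^ suc N)) (ℤP.*-identityˡ (y ^ suc N))) ⟩
      y ^ suc N + ∑ (suc N) g      ∎
      where
      last : f' (suc N) ≡ + 0
      last = trans (cong (_* (x ^ suc N * y ^ (N ∸ N))) (bin-zero N (suc N) ℕP.≤-refl)) (ℤP.*-zeroˡ (x ^ suc N * y ^ (N ∸ N)))
      yf : ∀ k → k ≤ N → y * f k ≡ f' k
      yf k k≤N = trans (ident' y (bin N k) (x ^ k) (y ^ (N ∸ k)))
        (cong (λ z → bin N k * (x ^ k * y ^ z)) (sym (ℕP.+-∸-assoc 1 k≤N)))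
        where
        ident' : ∀ y b X Y → y * (b * (X * Y)) ≡ b * (X * (y * Y))
        ident' = solve-∀

  -- Signs and alternating power sums

  sgn : ℕ → ℤ
  sgn k = (- + 1) ^ k

  -- Up to the sign (-1)^n, the number of surjections from an m-set onto an n-set; hence 0 for m < n
  -- and n! for m = n.
  surj : ℕ → ℕ → ℤ
  surj n m = ∑ (suc n) (λ k → sgn k * bin n k * (+ k) ^ m)

  -- One factor k is absorbed by k C(n+1,k) = (n+1)(C(n+1,k) - C(n,k)), a rewriting of `bin-lower`.
  surj-suc : ∀ n m → surj (suc n) (suc m) ≡ + suc n * (surj (suc n) m - surj n m)
  surj-suc n m = begin
    surj (suc n) (suc m)
      ≡⟨ ∑-cong (suc (suc n)) (λ k _ → elc1 (- (sgn k * (+ k) ^ m)) (bin-lower n k)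
           (ident (sgn k) (bin (suc n) k) (bin n k) (+ k) ((+ k) ^ m) (+ suc n))) ⟩
    ∑ (suc (suc n)) (λ k → + suc n * (f k + - + 1 * g k))
      ≡⟨ ∑-*ˡ (suc (suc n)) (+ suc n) (λ k → f k + - + 1 * g k) ⟩
    + suc n * ∑ (suc (suc n)) (λ k → f k + - + 1 * g k)
      ≡⟨ cong (+ suc n *_) (trans (∑-+ (suc (suc n)) f (λ k → - + 1 * g k)) (cong (λ z → surj (suc n) m + z) (∑-*ˡ (suc (suc n)) (- + 1) g))) ⟩
    + suc n * (surj (suc n) m + - + 1 * (surj n m + g (suc n)))
      ≡⟨ cong (λ z → + suc n * (surj (suc n) m + - + 1 * (surj n m + z))) last ⟩
    + suc n * (surj (suc n) m + - + 1 * (surj n m + + 0))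
      ≡⟨ ident' (+ suc n) (surj (suc n) m) (surj n m) ⟩
    + suc n * (surj (suc n) m - surj n m) ∎
    where
    open ≡-Reasoning
    f g : ℕ → ℤ
    f k = sgn k * bin (suc n) k * (+ k) ^ m
    g k = sgn k * bin n k * (+ k) ^ m
    ident : ∀ s B b k x N → s * B * (k * x) - N * (s * B * x + - + 1 * (s * b * x)) ≡ - (s * x) * ((N - k) * B - N * b)
    ident = solve-∀
    ident' : ∀ N a b → N * (a + - + 1 * (b + + 0)) ≡ N * (a - b)
    ident' = solve-∀
    last : g (suc n) ≡ + 0
    last = trans (cong (λ z → sgn (suc n) * z * (+ suc n) ^ m) (bin-zero n (suc n) ℕP.≤-refl))
      (trans (cong (_* (+ suc n) ^ m) (ℤP.*-zeroʳ (sgn (suc n)))) (ℤP.*-zeroˡ ((+ suc n) ^ m)))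

  alternating-sum : ∀ n → ∑ (suc (suc n)) (λ k → sgn k * bin (suc n) k) ≡ + 0
  alternating-sum n = trans (∑-cong (suc (suc n)) (λ k _ → lemma k)) (sym (binomial (- + 1) (+ 1) (suc n)))
    where
    lemma : ∀ k → sgn k * bin (suc n) k ≡ bin (suc n) k * (sgn k * (+ 1) ^ (suc n ∸ k))
    lemma k = trans (ℤP.*-comm (sgn k) (bin (suc n) k))
      (cong (bin (suc n) k *_) (trans (sym (ℤP.*-identityʳ (sgn k))) (cong (sgn k *_) (sym (ℤP.^-zeroˡ (suc n ∸ k))))))

  surj-< : ∀ m n → m < n → surj n m ≡ + 0
  surj-< zero    (suc n) _         = trans (∑-cong (suc (suc n)) (λ k _ → ℤP.*-identityʳ (sgn k * bin (suc n) k))) (alternating-sum n)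
  surj-< (suc m) (suc n) (s≤s m<n) = trans (surj-suc n m)
    (trans (cong₂ (λ u v → + suc n * (u - v)) (surj-< m (suc n) (ℕP.m≤n⇒m≤1+n m<n)) (surj-< m n m<n)) (ℤP.*-zeroʳ (+ suc n)))

  surj-diag : ∀ n → surj n n ≡ sgn n * + (n !)
  surj-diag zero    = refl
  surj-diag (suc n) = begin
    surj (suc n) (suc n)                      ≡⟨ surj-suc n n ⟩
    + suc n * (surj (suc n) n - surj n n)     ≡⟨ cong₂ (λ u v → + suc n * (u - v)) (surj-< n (suc n) ℕP.≤-refl) (surj-diag n) ⟩
    + suc n * (+ 0 - sgn n * + (n !))         ≡⟨ ident (+ suc n) (sgn n) (+ (n !)) ⟩
    - + 1 * sgn n * (+ suc n * + (n !))       ≡⟨ cong (λ z → - + 1 * sgn n * z) (ℤP.pos-* (suc n) (n !)) ⟨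
    - + 1 * sgn n * + (suc n !)               ∎
    where
    open ≡-Reasoning
    ident : ∀ N s f → N * (+ 0 - s * f) ≡ - + 1 * s * (N * f)
    ident = solve-∀

  ^-*-distrib : ∀ a b k → (a * b) ^ k ≡ a ^ k * b ^ k
  ^-*-distrib a b zero    = refl
  ^-*-distrib a b (suc k) = trans (cong (a * b *_) (^-*-distrib a b k)) (ident a b (a ^ k) (b ^ k))
    where
    ident : ∀ a b x y → a * b * (x * y) ≡ a * x * (b * y)
    ident = solve-∀

  ^-comm : ∀ a k m → (a ^ k) ^ m ≡ (a ^ m) ^ k
  ^-comm a k m = trans (ℤP.^-*-assoc a k m) (trans (cong (a ^_) (ℕP.*-comm k m)) (sym (ℤP.^-*-assoc a m k)))

  sgn-+ : ∀ k → sgn (k ℕ.+ k) ≡ + 1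
  sgn-+ zero    = refl
  sgn-+ (suc k) = trans (cong (λ z → - + 1 * sgn z) (ℕP.+-suc k k)) (trans (ident (sgn (k ℕ.+ k))) (sgn-+ k))
    where
    ident : ∀ s → - + 1 * (- + 1 * s) ≡ s
    ident = solve-∀

  sgn² : ∀ k → sgn k * sgn k ≡ + 1
  sgn² k = trans (sym (ℤP.^-distribˡ-+-* (- + 1) k k)) (sgn-+ k)

  IsSign : ℤ → Set
  IsSign e = e ≡ + 1 ⊎ e ≡ - + 1

  sign² : ∀ {e} → IsSign e → e * e ≡ + 1
  sign² (inj₁ refl) = refl
  sign² (inj₂ refl) = refl

  sign-* : ∀ {e f} → IsSign e → IsSign f → IsSign (e * f)
  sign-* (inj₁ refl) (inj₁ refl) = inj₁ refl
  sign-* (inj₁ refl) (inj₂ refl) = inj₂ refl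
  sign-* (inj₂ refl) (inj₁ refl) = inj₂ refl
  sign-* (inj₂ refl) (inj₂ refl) = inj₁ refl

  sgn-sign : ∀ k → IsSign (sgn k)
  sgn-sign zero    = inj₁ refl
  sgn-sign (suc k) = sign-* (inj₂ refl) (sgn-sign k)

  sgn-∸ : ∀ {n k} → k ≤ n → sgn (n ∸ k) ≡ sgn n * sgn k
  sgn-∸ {n} {k} k≤n = elc2 (- sgn k) (- sgn (n ∸ k)) (trans (cong sgn (sym (ℕP.m∸n+n≡m k≤n))) (ℤP.^-distribˡ-+-* (- + 1) (n ∸ k) k)) (sgn² k)
    (ident (sgn (n ∸ k)) (sgn n) (sgn k))
    where
    ident : ∀ d s x → d - s * x ≡ - x * (s - d * x) + - d * (x * x - + 1)
    ident = solve-∀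

  ∑-Fin : ∀ N f → ∑ N f ≡ FinSum.sum {N} (f ∘ toℕ)
  ∑-Fin zero    f = refl
  ∑-Fin (suc N) f = trans (∑-first N f) (cong (λ z → f 0 + z) (∑-Fin N (f ∘ suc)))

  -- Shifted Legendre polynomials

  cancel-suc : ∀ {a b} k → + suc k * a ≡ + suc k * b → a ≡ b
  cancel-suc {a} {b} k = ℤP.*-cancelˡ-≡ (+ suc k) a b

  cancel-suc² : ∀ {a b} k → + suc k * + suc k * a ≡ + suc k * + suc k * b → a ≡ b
  cancel-suc² {a} {b} k e = cancel-suc k (cancel-suc k (trans (sym (ℤP.*-assoc (+ suc k) (+ suc k) a)) (trans e (ℤP.*-assoc (+ suc k) (+ suc k) b))))

  -- The coefficients of the shifted Legendre polynomial P_n(1 + 2x).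
  coef : ℕ → ℕ → ℤ
  coef n k = bin n k * bin (n ℕ.+ k) k

  coef-up : ∀ n k → + suc k * + suc k * coef n (suc k) ≡ (+ n - + k) * (+ 1 + (+ n + + k)) * coef n k
  coef-up n k = trans (cong (λ z → + suc k * + suc k * (bin n (suc k) * bin z (suc k))) (ℕP.+-suc n k))
    (elc2 (+ suc k * bin (suc (n ℕ.+ k)) (suc k)) ((+ n - + k) * bin n k) (bin-upper n k) (bin-absorb (n ℕ.+ k) k)
      (ident (bin n (suc k)) (bin (suc (n ℕ.+ k)) (suc k)) (bin n k) (bin (n ℕ.+ k) k) (+ n) (+ k)))
    where
    ident : ∀ B₁ B₂ b₁ b₂ n k → (+ 1 + k) * (+ 1 + k) * (B₁ * B₂) - (n - k) * (+ 1 + (n + k)) * (b₁ * b₂)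
      ≡ (+ 1 + k) * B₂ * ((+ 1 + k) * B₁ - (n - k) * b₁) + (n - k) * b₁ * ((+ 1 + k) * B₂ - (+ 1 + (n + k)) * b₂)
    ident = solve-∀

  coef-diag : ∀ n k → + suc k * + suc k * coef (suc n) (suc k) ≡ (+ 2 + (+ n + + k)) * (+ 1 + (+ n + + k)) * coef n k
  coef-diag n k = trans (cong (λ z → + suc k * + suc k * (bin (suc n) (suc k) * bin (suc z) (suc k))) (ℕP.+-suc n k))
    (elc3 (+ suc k * bin (suc (suc (n ℕ.+ k))) (suc k)) (+ suc n * bin n k) ((+ 2 + (+ n + + k)) * bin n k)
      (bin-absorb n k) (bin-absorb (suc (n ℕ.+ k)) k) (bin-lower (n ℕ.+ k) k)
      (ident (bin (suc n) (suc k)) (bin (suc (suc (n ℕ.+ k))) (suc k)) (bin (suc (n ℕ.+ k)) k) (bin n k) (bin (n ℕ.+ k) k) (+ n) (+ k)))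
    where
    ident : ∀ B₁ B₂ B₃ b₁ b₂ n k → (+ 1 + k) * (+ 1 + k) * (B₁ * B₂) - (+ 2 + (n + k)) * (+ 1 + (n + k)) * (b₁ * b₂)
      ≡ (+ 1 + k) * B₂ * ((+ 1 + k) * B₁ - (+ 1 + n) * b₁) + (+ 1 + n) * b₁ * ((+ 1 + k) * B₂ - (+ 1 + (+ 1 + (n + k))) * B₃)
        + (+ 2 + (n + k)) * b₁ * ((+ 1 + (n + k) - k) * B₃ - (+ 1 + (n + k)) * b₂)
    ident = solve-∀

  coef-lower : ∀ n k → + suc k * + suc k * coef n (suc k) ≡ (+ n - + k) * (+ suc n - + k) * coef (suc n) k
  coef-lower n k = trans (cong (λ z → + suc k * + suc k * (bin n (suc k) * bin z (suc k))) (ℕP.+-suc n k))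
    (elc3 (+ suc k * bin (suc (n ℕ.+ k)) (suc k)) ((+ n - + k) * bin n k) (- ((+ n - + k) * bin (suc (n ℕ.+ k)) k))
      (bin-upper n k) (bin-upper (suc (n ℕ.+ k)) k) (bin-lower n k)
      (ident (bin n (suc k)) (bin (suc (n ℕ.+ k)) (suc k)) (bin (suc (n ℕ.+ k)) k) (bin n k) (bin (suc n) k) (+ n) (+ k)))
    where
    ident : ∀ B₁ B₂ B₃ b₁ b₂ n k → (+ 1 + k) * (+ 1 + k) * (B₁ * B₂) - (n - k) * (+ 1 + n - k) * (b₂ * B₃)
      ≡ (+ 1 + k) * B₂ * ((+ 1 + k) * B₁ - (n - k) * b₁) + (n - k) * b₁ * ((+ 1 + k) * B₂ - (+ 1 + (n + k) - k) * B₃)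
        + - ((n - k) * B₃) * ((+ 1 + n - k) * b₂ - (+ 1 + n) * b₁)
    ident = solve-∀

  coef-zero : ∀ n k → n < k → coef n k ≡ + 0
  coef-zero n k n<k = trans (cong (_* bin (n ℕ.+ k) k) (bin-zero n k n<k)) (ℤP.*-zeroˡ (bin (n ℕ.+ k) k))

  -- Bonnet's recurrence (n+2) P_(n+2) = (2n+3) u P_(n+1) - (n+1) P_n at u = 1 + 2x, read off at
  -- x^(k+1). After multiplication by (k+1)² every coefficient in it is a multiple of
  -- `coef (suc n) k`.
  coef-rec : ∀ n k → (+ 2 + + n) * coef (suc (suc n)) (suc k)
    ≡ (+ 3 + + 2 * + n) * (coef (suc n) (suc k) + + 2 * coef (suc n) k) - + suc n * coef n (suc k)
  coef-rec n k = cancel-suc² k (elc3 (+ 2 + + n) (- (+ 3 + + 2 * + n)) (+ suc n) (coef-diag (suc n) k) (coef-up (suc n) k) (coef-lower n k)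
    (ident (coef (suc (suc n)) (suc k)) (coef (suc n) (suc k)) (coef n (suc k)) (coef (suc n) k) (+ n) (+ k)))
    where
    ident : ∀ c₂ c₁ c₀ X n k →
      (+ 1 + k) * (+ 1 + k) * ((+ 2 + n) * c₂) - (+ 1 + k) * (+ 1 + k) * ((+ 3 + + 2 * n) * (c₁ + + 2 * X) - (+ 1 + n) * c₀)
      ≡ (+ 2 + n) * ((+ 1 + k) * (+ 1 + k) * c₂ - (+ 2 + (+ 1 + n + k)) * (+ 1 + (+ 1 + n + k)) * X)
        + - (+ 3 + + 2 * n) * ((+ 1 + k) * (+ 1 + k) * c₁ - (+ 1 + n - k) * (+ 1 + (+ 1 + n + k)) * X)
        + (+ 1 + n) * ((+ 1 + k) * (+ 1 + k) * c₀ - (n - k) * (+ 1 + n - k) * X)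
    ident = solve-∀

  Leg : ℕ → ℤ → ℤ
  Leg n x = ∑ (suc n) (λ k → coef n k * x ^ k)

  Leg-stable : ∀ n x d → ∑ (suc n ℕ.+ d) (λ k → coef n k * x ^ k) ≡ Leg n x
  Leg-stable n x d = trans (∑-split (suc n) d (λ k → coef n k * x ^ k))
    (trans (cong (λ z → Leg n x + z) (trans (∑-cong d (λ k _ → tail k)) (∑-0 d))) (ℤP.+-identityʳ (Leg n x)))
    where
    tail : ∀ k → coef n (suc n ℕ.+ k) * x ^ (suc n ℕ.+ k) ≡ + 0
    tail k = trans (cong (_* x ^ (suc n ℕ.+ k)) (coef-zero n (suc n ℕ.+ k) (ℕP.m≤m+n (suc n) k))) (ℤP.*-zeroˡ (x ^ (suc n ℕ.+ k)))

  Leg-rec : ∀ n x → (+ 2 + + n) * Leg (suc (suc n)) x ≡ (+ 3 + + 2 * + n) * (+ 1 + + 2 * x) * Leg (suc n) x - + suc n * Leg n x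
  Leg-rec n x = elc3 {a = s (suc n) (suc (suc (suc n)))} {b = Leg (suc n) x} {a' = s n (suc (suc (suc n)))} {b' = Leg n x}
      (+ 3 + + 2 * + n) (- + suc n) (+ 1) (stable (suc n) 1) (stable n 2) (partial (suc (suc n)))
      (ident (Leg (suc (suc n)) x) (s (suc n) (suc (suc (suc n)))) (Leg (suc n) x) (s n (suc (suc (suc n)))) (Leg n x) (+ n) x)
    where
    s : ℕ → ℕ → ℤ
    s j N = ∑ N (λ k → coef j k * x ^ k)
    stable : ∀ j d → s j (d ℕ.+ suc j) ≡ Leg j x
    stable j d = trans (cong (s j) (ℕP.+-comm d (suc j))) (Leg-stable j x d)
    -- A common cut-off for the three degrees turns the recurrence into an induction on the cut-off;
    -- the factor x lowers the cut-off of one sum by one.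
    partial : ∀ N → (+ 2 + + n) * s (suc (suc n)) (suc N) ≡ (+ 3 + + 2 * + n) * (s (suc n) (suc N) + + 2 * x * s (suc n) N) - + suc n * s n (suc N)
    partial zero = ident₀ (+ n) x
      where
      ident₀ : ∀ n x → (+ 2 + n) * + 1 ≡ (+ 3 + + 2 * n) * (+ 1 + + 2 * x * + 0) - (+ 1 + n) * + 1
      ident₀ = solve-∀
    partial (suc N) = elc2 (+ 1) (x ^ suc N) (partial N) (coef-rec n N)
      (ident₁ (s (suc (suc n)) (suc N)) (s (suc n) (suc N)) (s (suc n) N) (s n (suc N))
         (coef (suc (suc n)) (suc N)) (coef (suc n) (suc N)) (coef (suc n) N) (coef n (suc N)) x (x ^ N) (+ n))
      where
      ident₁ : ∀ S₂ S₁ S₁' S₀ c₂ c₁ c₁' c₀ x X n →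
        (+ 2 + n) * (S₂ + c₂ * (x * X)) - ((+ 3 + + 2 * n) * (S₁ + c₁ * (x * X) + + 2 * x * (S₁' + c₁' * X)) - (+ 1 + n) * (S₀ + c₀ * (x * X)))
        ≡ + 1 * ((+ 2 + n) * S₂ - ((+ 3 + + 2 * n) * (S₁ + + 2 * x * S₁') - (+ 1 + n) * S₀))
          + x * X * ((+ 2 + n) * c₂ - ((+ 3 + + 2 * n) * (c₁ + + 2 * c₁') - (+ 1 + n) * c₀))
      ident₁ = solve-∀
    ident : ∀ L₂ S₁ L₁ S₀ L₀ n x → (+ 2 + n) * L₂ - ((+ 3 + + 2 * n) * (+ 1 + + 2 * x) * L₁ - (+ 1 + n) * L₀)
      ≡ (+ 3 + + 2 * n) * (S₁ - L₁) + - (+ 1 + n) * (S₀ - L₀) + + 1 * ((+ 2 + n) * L₂ - ((+ 3 + + 2 * n) * (S₁ + + 2 * x * L₁) - (+ 1 + n) * S₀))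
    ident = solve-∀

  Leg-1 : ∀ x → Leg 1 x ≡ + 1 + + 2 * x
  Leg-1 x = cong (λ z → + 1 + + 2 * z) (ℤP.*-identityʳ x)

  -- P_n has the parity of n, and x ↦ -1 - x is u ↦ -u for u = 1 + 2x.
  Leg-reflect : ∀ n x → Leg n (- + 1 - x) ≡ sgn n * Leg n x
  Leg-reflect n x = proj₁ (both n)
    where
    y : ℤ
    y = - + 1 - x
    both : ∀ n → (Leg n y ≡ sgn n * Leg n x) × (Leg (suc n) y ≡ sgn (suc n) * Leg (suc n) x)
    both zero    = refl , trans (Leg-1 y) (trans (ident x) (cong (λ z → - + 1 * + 1 * z) (sym (Leg-1 x))))
      where
      ident : ∀ x → + 1 + + 2 * (- + 1 - x) ≡ - + 1 * + 1 * (+ 1 + + 2 * x)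
      ident = solve-∀
    both (suc n) with both n
    ... | h₀ , h₁ = h₁ , cancel-suc (suc n) (trans (Leg-rec n y)
        (elc3 (- sgn n) ((+ 3 + + 2 * + n) * (+ 1 + + 2 * y)) (- (+ 1 + + n)) (Leg-rec n x) h₁ h₀
          (ident (Leg n y) (Leg (suc n) y) (Leg n x) (Leg (suc n) x) (Leg (suc (suc n)) x) (sgn n) (+ n) x)))
      where
      ident : ∀ y₀ y₁ x₀ x₁ x₂ s n x →
        (+ 3 + + 2 * n) * (+ 1 + + 2 * (- + 1 - x)) * y₁ - (+ 1 + n) * y₀ - (+ 2 + n) * (- + 1 * (- + 1 * s) * x₂)
        ≡ - s * ((+ 2 + n) * x₂ - ((+ 3 + + 2 * n) * (+ 1 + + 2 * x) * x₁ - (+ 1 + n) * x₀))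
          + (+ 3 + + 2 * n) * (+ 1 + + 2 * (- + 1 - x)) * (y₁ - - + 1 * s * x₁) + - (+ 1 + n) * (y₀ - s * x₀)
      ident = solve-∀

  central : ℕ → ℤ
  central k = bin (k ℕ.+ k) k

  central-suc : ∀ k → + suc k * central (suc k) ≡ + 2 * (+ 1 + (+ k + + k)) * central k
  central-suc k = cancel-suc k (trans (cong (λ z → + suc k * (+ suc k * bin (suc z) (suc k))) (ℕP.+-suc k k))
    (elc2 (+ suc k) (+ 2 * + suc k) (bin-absorb (suc (k ℕ.+ k)) k) (bin-lower (k ℕ.+ k) k)
      (ident (bin (suc (suc (k ℕ.+ k))) (suc k)) (bin (suc (k ℕ.+ k)) k) (central k) (+ k))))
    where
    ident : ∀ B b c k → (+ 1 + k) * ((+ 1 + k) * B) - (+ 1 + k) * (+ 2 * (+ 1 + (k + k)) * c)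
      ≡ (+ 1 + k) * ((+ 1 + k) * B - (+ 1 + (+ 1 + (k + k))) * b) + + 2 * (+ 1 + k) * ((+ 1 + (k + k) - k) * b - (+ 1 + (k + k)) * c)
    ident = solve-∀

  -- Alternating convolutions through generating functions

  conv : (ℕ → ℤ) → (ℕ → ℤ) → ℕ → ℤ
  conv f g N = ∑ (suc N) (λ k → f k * g (N ∸ k))

  shift : (ℕ → ℤ) → ℕ → ℤ
  shift f zero    = + 0
  shift f (suc k) = f k

  conv-cong : ∀ {f f' g g'} → (∀ k → f k ≡ f' k) → (∀ k → g k ≡ g' k) → ∀ N → conv f g N ≡ conv f' g' N
  conv-cong e e' N = ∑-cong (suc N) (λ k _ → cong₂ _*_ (e k) (e' (N ∸ k)))

  conv-+ˡ : ∀ f f' g ε N → conv (λ k → f k + ε * f' k) g N ≡ conv f g N + ε * conv f' g N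
  conv-+ˡ f f' g ε N = trans (∑-cong (suc N) (λ k _ → ident (f k) (f' k) (g (N ∸ k)) ε))
    (trans (∑-+ (suc N) (λ k → f k * g (N ∸ k)) (λ k → ε * (f' k * g (N ∸ k))))
      (cong (λ z → conv f g N + z) (∑-*ˡ (suc N) ε (λ k → f' k * g (N ∸ k)))))
    where
    ident : ∀ a b c ε → (a + ε * b) * c ≡ a * c + ε * (b * c)
    ident = solve-∀

  conv-+ʳ : ∀ f g g' ε N → conv f (λ k → g k + ε * g' k) N ≡ conv f g N + ε * conv f g' N
  conv-+ʳ f g g' ε N = trans (∑-cong (suc N) (λ k _ → ident (g (N ∸ k)) (g' (N ∸ k)) (f k) ε))
    (trans (∑-+ (suc N) (λ k → f k * g (N ∸ k)) (λ k → ε * (f k * g' (N ∸ k))))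
      (cong (λ z → conv f g N + z) (∑-*ˡ (suc N) ε (λ k → f k * g' (N ∸ k)))))
    where
    ident : ∀ a b c ε → c * (a + ε * b) ≡ c * a + ε * (c * b)
    ident = solve-∀

  conv-shiftˡ : ∀ f g N → conv (shift f) g (suc N) ≡ conv f g N
  conv-shiftˡ f g N = trans (∑-first (suc N) (λ k → shift f k * g (suc N ∸ k)))
    (trans (cong (_+ conv f g N) (ℤP.*-zeroˡ (g (suc N)))) (ℤP.+-identityˡ (conv f g N)))

  conv-shiftʳ : ∀ f g N → conv f (shift g) (suc N) ≡ conv f g N
  conv-shiftʳ f g N = trans (cong₂ _+_ (∑-cong (suc N) (λ k k<N → cong (λ z → f k * shift g z) (ℕP.+-∸-assoc 1 (ℕP.≤-pred k<N)))) last)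
      (ℤP.+-identityʳ (conv f g N))
    where
    last : f (suc N) * shift g (N ∸ N) ≡ + 0
    last = trans (cong (λ z → f (suc N) * shift g z) (ℕP.n∸n≡0 N)) (ℤP.*-zeroʳ (f (suc N)))

  -- Multiplication of generating functions by (1 + εX)(1 - εX) = 1 - X².
  conv-1-X² : ∀ f g ε → ε * ε ≡ + 1 → ∀ N →
    conv (λ k → f k + ε * shift f k) (λ k → g k + (- ε) * shift g k) (suc (suc N)) ≡ conv f g (suc (suc N)) - conv f g N
  conv-1-X² f g ε ε² N = begin
    conv f' g' (suc (suc N))
      ≡⟨ conv-+ˡ f (shift f) g' ε (suc (suc N)) ⟩
    conv f g' (suc (suc N)) + ε * conv (shift f) g' (suc (suc N))
      ≡⟨ cong₂ (λ u v → u + ε * v) (conv-+ʳ f g (shift g) (- ε) (suc (suc N)))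
           (trans (conv-shiftˡ f g' (suc N)) (conv-+ʳ f g (shift g) (- ε) (suc N))) ⟩
    conv f g (suc (suc N)) + (- ε) * conv f (shift g) (suc (suc N)) + ε * (conv f g (suc N) + (- ε) * conv f (shift g) (suc N))
      ≡⟨ cong₂ (λ u v → conv f g (suc (suc N)) + (- ε) * u + ε * (conv f g (suc N) + (- ε) * v)) (conv-shiftʳ f g (suc N)) (conv-shiftʳ f g N) ⟩
    conv f g (suc (suc N)) + (- ε) * conv f g (suc N) + ε * (conv f g (suc N) + (- ε) * conv f g N)
      ≡⟨ elc1 (- conv f g N) ε² (ident (conv f g (suc (suc N))) (conv f g (suc N)) (conv f g N) ε) ⟩
    conv f g (suc (suc N)) - conv f g N ∎
    where
    open ≡-Reasoning
    f' g' : ℕ → ℤ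
    f' k = f k + ε * shift f k
    g' k = g k + (- ε) * shift g k
    ident : ∀ a b c ε → a + - ε * b + ε * (b + - ε * c) - (a - c) ≡ - c * (ε * ε - + 1)
    ident = solve-∀

  -- The coefficient of X^(2w) in (1 - X)^a (1 + X)^a = (1 - X²)^a.
  bin-alternating : ∀ a w → conv (λ k → sgn k * bin a k) (bin a) (w ℕ.+ w) ≡ sgn w * bin a w
  bin-alternating a zero = refl
  bin-alternating zero (suc w) = trans (∑-cong (suc (suc w ℕ.+ suc w)) (λ k _ → vanish k)) (trans (∑-0 (suc (suc w ℕ.+ suc w))) (sym (ℤP.*-zeroʳ (sgn (suc w)))))
    where
    vanish : ∀ k → sgn k * bin 0 k * bin 0 (suc w ℕ.+ suc w ∸ k) ≡ + 0
    vanish zero    = refl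
    vanish (suc k) = trans (cong (_* bin 0 (w ℕ.+ suc w ∸ k)) (ℤP.*-zeroʳ (sgn (suc k)))) (ℤP.*-zeroˡ (bin 0 (w ℕ.+ suc w ∸ k)))
  bin-alternating (suc a) (suc w) = begin
    conv (λ k → sgn k * bin (suc a) k) (bin (suc a)) (suc w ℕ.+ suc w)
      ≡⟨ cong (conv (λ k → sgn k * bin (suc a) k) (bin (suc a))) (cong suc (ℕP.+-suc w w)) ⟩
    conv (λ k → sgn k * bin (suc a) k) (bin (suc a)) (suc (suc (w ℕ.+ w)))
      ≡⟨ conv-cong pascal₁ pascal₂ (suc (suc (w ℕ.+ w))) ⟩
    conv (λ k → f k + - + 1 * shift f k) (λ k → bin a k + (- - + 1) * shift (bin a) k) (suc (suc (w ℕ.+ w)))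
      ≡⟨ conv-1-X² f (bin a) (- + 1) refl (w ℕ.+ w) ⟩
    conv f (bin a) (suc (suc (w ℕ.+ w))) - conv f (bin a) (w ℕ.+ w)
      ≡⟨ cong₂ _-_ (trans (cong (conv f (bin a)) (sym (cong suc (ℕP.+-suc w w)))) (bin-alternating a (suc w))) (bin-alternating a w) ⟩
    sgn (suc w) * bin a (suc w) - sgn w * bin a w
      ≡⟨ ident (sgn w) (bin a (suc w)) (bin a w) ⟩
    sgn (suc w) * bin (suc a) (suc w) ∎
    where
    open ≡-Reasoning
    f : ℕ → ℤ
    f k = sgn k * bin a k
    pascal₁ : ∀ k → sgn k * bin (suc a) k ≡ f k + - + 1 * shift f k
    pascal₁ zero    = refl
    pascal₁ (suc k) = ident (sgn k) (bin a k) (bin a (suc k))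
      where
      ident : ∀ s x y → - + 1 * s * (x + y) ≡ - + 1 * s * y + - + 1 * (s * x)
      ident = solve-∀
    pascal₂ : ∀ k → bin (suc a) k ≡ bin a k + (- - + 1) * shift (bin a) k
    pascal₂ zero    = refl
    pascal₂ (suc k) = ident (bin a k) (bin a (suc k))
      where
      ident : ∀ x y → x + y ≡ y + (- - + 1) * x
      ident = solve-∀
    ident : ∀ s x y → - + 1 * s * x - s * y ≡ - + 1 * s * (y + x)
    ident = solve-∀

  -- The coefficient of X^k in (1 - X)^-(b+1).
  multiset : ℕ → ℕ → ℤ
  multiset b k = bin (b ℕ.+ k) b

  multiset-pascal : ∀ b k → multiset b k ≡ multiset (suc b) k + - + 1 * shift (multiset (suc b)) k
  multiset-pascal b zero    = trans (bin-diag' b) (cong (_+ + 0) (sym (bin-diag' (suc b))))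
    where
    bin-diag' : ∀ b → bin (b ℕ.+ 0) b ≡ + 1
    bin-diag' b = trans (cong (λ z → bin z b) (ℕP.+-identityʳ b)) (bin-diag b)
  multiset-pascal b (suc k) = trans (ident (bin (b ℕ.+ suc k) b) (bin (b ℕ.+ suc k) (suc b)))
      (cong (λ z → bin (b ℕ.+ suc k) b + bin (b ℕ.+ suc k) (suc b) + - + 1 * bin z (suc b)) (ℕP.+-suc b k))
    where
    ident : ∀ x y → x ≡ x + y + - + 1 * y
    ident = solve-∀

  -- The coefficient of X^(2w) in (1 + X)^-(b+1) (1 - X)^-(b+1) = (1 - X²)^-(b+1). Multiplication by
  -- 1 - X² lowers b but brings in the coefficient two places earlier, hence the induction on both b
  -- and w.
  multiset-alternating : ∀ b w → conv (λ k → sgn k * multiset b k) (multiset b) (w ℕ.+ w) ≡ multiset b w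
  multiset-alternating zero w = trans (∑-cong (suc (w ℕ.+ w)) (λ k _ → trans (ℤP.*-identityʳ (sgn k * + 1)) (ℤP.*-identityʳ (sgn k)))) (∑-sgn w)
    where
    ∑-sgn : ∀ w → ∑ (suc (w ℕ.+ w)) sgn ≡ + 1
    ∑-sgn zero    = refl
    ∑-sgn (suc w) = trans (cong (λ z → ∑ (suc (suc z)) sgn) (ℕP.+-suc w w))
      (elc1 (+ 1) (∑-sgn w) (ident (∑ (suc (w ℕ.+ w)) sgn) (sgn (w ℕ.+ w))))
      where
      ident : ∀ s e → s + - + 1 * e + - + 1 * (- + 1 * e) - + 1 ≡ + 1 * (s - + 1)
      ident = solve-∀
  multiset-alternating (suc b) zero = trans (ident (multiset (suc b) 0)) (trans (cong (λ z → z * z) one) (sym one))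
    where
    ident : ∀ x → + 0 + + 1 * x * x ≡ x * x
    ident = solve-∀
    one : multiset (suc b) 0 ≡ + 1
    one = trans (cong (λ z → bin (suc z) (suc b)) (ℕP.+-identityʳ b)) (bin-diag (suc b))
  multiset-alternating (suc b) (suc w) = begin
    conv f g (suc w ℕ.+ suc w)
      ≡⟨ cong (conv f g) (cong suc (ℕP.+-suc w w)) ⟩
    conv f g (suc (suc (w ℕ.+ w)))
      ≡⟨ ident (conv f g (suc (suc (w ℕ.+ w)))) (conv f g (w ℕ.+ w)) ⟩
    conv f g (suc (suc (w ℕ.+ w))) - conv f g (w ℕ.+ w) + conv f g (w ℕ.+ w)
      ≡⟨ cong₂ _+_ (sym (conv-1-X² f g (+ 1) refl (w ℕ.+ w))) (multiset-alternating (suc b) w) ⟩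
    conv (λ k → f k + + 1 * shift f k) (λ k → g k + (- + 1) * shift g k) (suc (suc (w ℕ.+ w))) + multiset (suc b) w
      ≡⟨ cong (_+ multiset (suc b) w) (conv-cong (λ k → sym (pascal k)) (λ k → sym (multiset-pascal b k)) (suc (suc (w ℕ.+ w)))) ⟩
    conv (λ k → sgn k * multiset b k) (multiset b) (suc (suc (w ℕ.+ w))) + multiset (suc b) w
      ≡⟨ cong (_+ multiset (suc b) w) (trans (cong (conv (λ k → sgn k * multiset b k) (multiset b)) (sym (cong suc (ℕP.+-suc w w)))) (multiset-alternating b (suc w))) ⟩
    multiset b (suc w) + multiset (suc b) w
      ≡⟨ cong (λ z → multiset b (suc w) + bin z (suc b)) (sym (ℕP.+-suc b w)) ⟩
    multiset (suc b) (suc w) ∎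
    where
    open ≡-Reasoning
    f g : ℕ → ℤ
    f k = sgn k * multiset (suc b) k
    g = multiset (suc b)
    ident : ∀ x y → x ≡ x - y + y
    ident = solve-∀
    pascal : ∀ k → sgn k * multiset b k ≡ f k + + 1 * shift f k
    pascal zero    = trans (cong (+ 1 *_) (multiset-pascal b 0)) (ident' (multiset (suc b) 0))
      where
      ident' : ∀ x → + 1 * (x + - + 1 * + 0) ≡ + 1 * x + + 1 * + 0
      ident' = solve-∀
    pascal (suc k) = trans (cong (sgn (suc k) *_) (multiset-pascal b (suc k))) (ident' (sgn k) (multiset (suc b) (suc k)) (multiset (suc b) k))
      where
      ident' : ∀ s x y → - + 1 * s * (x + - + 1 * y) ≡ - + 1 * s * x + + 1 * (s * y)
      ident' = solve-∀

  -- Multinomial identities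

  fac-NonZero : ∀ k → ℤ.NonZero (+ (k !))
  fac-NonZero k = k ℕP.!≢0

  bin-sym : ∀ k j → bin (k ℕ.+ j) k ≡ bin (k ℕ.+ j) j
  bin-sym k j = ℤP.*-cancelʳ-≡ (bin (k ℕ.+ j) k) (bin (k ℕ.+ j) j) (+ (k !) * + (j !)) {{ℤP.i*j≢0 (+ (k !)) (+ (j !)) {{fac-NonZero k}} {{fac-NonZero j}}}}
    (trans (bin-! k j) (sym (trans (cong₂ _*_ (cong (λ z → bin z j) (ℕP.+-comm k j)) (ℤP.*-comm (+ (k !)) (+ (j !))))
      (trans (bin-! j k) (cong (λ z → + (z !)) (ℕP.+-comm j k))))))

  multinomial : ∀ a b c → bin (a ℕ.+ (b ℕ.+ c)) a * bin (b ℕ.+ c) b * (+ (a !) * (+ (b !) * + (c !))) ≡ + ((a ℕ.+ (b ℕ.+ c)) !)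
  multinomial a b c = elc2 (bin (a ℕ.+ (b ℕ.+ c)) a * + (a !)) (+ 1) (bin-! b c) (bin-! a (b ℕ.+ c))
    (ident (bin (a ℕ.+ (b ℕ.+ c)) a) (bin (b ℕ.+ c) b) (+ (a !)) (+ (b !)) (+ (c !)) (+ ((b ℕ.+ c) !)) (+ ((a ℕ.+ (b ℕ.+ c)) !)))
    where
    ident : ∀ x y A B Γ F G → x * y * (A * (B * Γ)) - G ≡ x * A * (y * (B * Γ) - F) + + 1 * (x * (A * F) - G)
    ident = solve-∀

  bin-swap : ∀ a b c → bin (a ℕ.+ (b ℕ.+ c)) a * bin (b ℕ.+ c) b ≡ bin (b ℕ.+ (a ℕ.+ c)) b * bin (a ℕ.+ c) a
  bin-swap a b c = ℤP.*-cancelʳ-≡ (bin (a ℕ.+ (b ℕ.+ c)) a * bin (b ℕ.+ c) b) (bin (b ℕ.+ (a ℕ.+ c)) b * bin (a ℕ.+ c) a) (A * (B * Γ)) {{nz}}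
    (trans (multinomial a b c) (trans (cong (λ z → + (z !)) assoc) (trans (sym (multinomial b a c)) (cong (bin (b ℕ.+ (a ℕ.+ c)) b * bin (a ℕ.+ c) a *_) (ident A B Γ)))))
    where
    A B Γ : ℤ
    A = + (a !)
    B = + (b !)
    Γ = + (c !)
    nz : ℤ.NonZero (A * (B * Γ))
    nz = ℤP.i*j≢0 A (B * Γ) {{fac-NonZero a}} {{ℤP.i*j≢0 B Γ {{fac-NonZero b}} {{fac-NonZero c}}}}
    assoc : a ℕ.+ (b ℕ.+ c) ≡ b ℕ.+ (a ℕ.+ c)
    assoc = trans (sym (ℕP.+-assoc a b c)) (trans (cong (ℕ._+ c) (ℕP.+-comm a b)) (ℕP.+-assoc b a c))
    ident : ∀ A B Γ → B * (A * Γ) ≡ A * (B * Γ)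
    ident = solve-∀

  -- Both sides are (2n)! / (k! j! n!).
  bin-chain : ∀ n k j → n ≡ k ℕ.+ j → bin (n ℕ.+ j) n * bin (n ℕ.+ n) k ≡ bin n k * bin (n ℕ.+ n) n
  bin-chain n k j e = begin
    bin (n ℕ.+ j) n * bin (n ℕ.+ n) k           ≡⟨ ℤP.*-comm (bin (n ℕ.+ j) n) (bin (n ℕ.+ n) k) ⟩
    bin (n ℕ.+ n) k * bin (n ℕ.+ j) n           ≡⟨ cong (λ z → bin z k * bin (n ℕ.+ j) n) n+n ⟩
    bin (k ℕ.+ (n ℕ.+ j)) k * bin (n ℕ.+ j) n   ≡⟨ bin-swap k n j ⟩
    bin (n ℕ.+ (k ℕ.+ j)) n * bin (k ℕ.+ j) k   ≡⟨ cong (λ z → bin (n ℕ.+ z) n * bin z k) (sym e) ⟩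
    bin (n ℕ.+ n) n * bin n k                   ≡⟨ ℤP.*-comm (bin (n ℕ.+ n) n) (bin n k) ⟩
    bin n k * bin (n ℕ.+ n) n                   ∎
    where
    open ≡-Reasoning
    n+n : n ℕ.+ n ≡ k ℕ.+ (n ℕ.+ j)
    n+n = trans (cong (n ℕ.+_) e) (trans (sym (ℕP.+-assoc n k j)) (trans (cong (ℕ._+ j) (ℕP.+-comm n k)) (ℕP.+-assoc k n j)))

  square-abs : ∀ a → a * a ≡ + (ℤ.∣ a ∣ ℕ.* ℤ.∣ a ∣)
  square-abs (+ k)      = sym (ℤP.pos-* k k)
  square-abs (-[1+ k ]) = refl

  ≈0⇒∣ₘ : ∀ {a M} → a ≈ + 0 [ + M ] → M ℕD.∣ ℤ.∣ a ∣
  ≈0⇒∣ₘ {a} {M} (by k e) = ℤS.∣⇒∣ᵤ {+ M} {a} (ℤS.divides k (trans (sym (ℤP.+-identityʳ a)) e))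

  ∣ₘ⇒≈0 : ∀ {a M} → M ℕD.∣ ℤ.∣ a ∣ → a ≈ + 0 [ + M ]
  ∣ₘ⇒≈0 {a} {M} d = from (ℤS.∣ᵤ⇒∣ {+ M} {a} d)
    where
    from : (+ M) ℤS.∣ a → a ≈ + 0 [ + M ]
    from (ℤS.divides k e) = by k (trans (ℤP.+-identityʳ a) e)

  ≉0 : ∀ {k M} → suc k < M → ¬ (+ suc k ≈ + 0 [ + M ])
  ≉0 k<M h = ℕD.>⇒∤ k<M (≈0⇒∣ₘ h)

  square≡0 : ∀ a → a * a ≡ + 0 → a ≡ + 0
  square≡0 a h = [ (λ z → z) , (λ z → z) ]′ (ℤP.i*j≡0⇒i≡0∨j≡0 a h)

  -- Differences and Kummer's sum

  ∑-pascal : ∀ k (g : ℕ → ℤ) → ∑ (suc (suc k)) (λ j → bin (suc k) j * g j) ≡ ∑ (suc k) (λ j → bin k j * (g j + g (suc j)))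
  ∑-pascal k g = begin
    ∑ (suc (suc k)) (λ j → bin (suc k) j * g j)
      ≡⟨ ∑-first (suc k) (λ j → bin (suc k) j * g j) ⟩
    + 1 * g 0 + ∑ (suc k) (λ j → (bin k j + bin k (suc j)) * g (suc j))
      ≡⟨ cong (λ z → + 1 * g 0 + z) (trans (∑-cong (suc k) (λ j _ → ℤP.*-distribʳ-+ (g (suc j)) (bin k j) (bin k (suc j))))
           (∑-+ (suc k) (λ j → bin k j * g (suc j)) (λ j → bin k (suc j) * g (suc j)))) ⟩
    + 1 * g 0 + (∑ (suc k) (λ j → bin k j * g (suc j)) + ∑ (suc k) (λ j → bin k (suc j) * g (suc j)))
      ≡⟨ ident (+ 1 * g 0) (∑ (suc k) (λ j → bin k j * g (suc j))) (∑ (suc k) (λ j → bin k (suc j) * g (suc j))) ⟩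
    + 1 * g 0 + ∑ (suc k) (λ j → bin k (suc j) * g (suc j)) + ∑ (suc k) (λ j → bin k j * g (suc j))
      ≡⟨ cong (_+ ∑ (suc k) (λ j → bin k j * g (suc j))) (sym (∑-first (suc k) (λ j → bin k j * g j))) ⟩
    ∑ (suc (suc k)) (λ j → bin k j * g j) + ∑ (suc k) (λ j → bin k j * g (suc j))
      ≡⟨ cong (_+ ∑ (suc k) (λ j → bin k j * g (suc j))) (trans (cong (λ z → ∑ (suc k) (λ j → bin k j * g j) + z)
           (trans (cong (_* g (suc k)) (bin-zero k (suc k) ℕP.≤-refl)) (ℤP.*-zeroˡ (g (suc k))))) (ℤP.+-identityʳ (∑ (suc k) (λ j → bin k j * g j)))) ⟩
    ∑ (suc k) (λ j → bin k j * g j) + ∑ (suc k) (λ j → bin k j * g (suc j))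
      ≡⟨ ∑-+ (suc k) (λ j → bin k j * g j) (λ j → bin k j * g (suc j)) ⟨
    ∑ (suc k) (λ j → bin k j * g j + bin k j * g (suc j))
      ≡⟨ ∑-cong (suc k) (λ j _ → sym (ℤP.*-distribˡ-+ (bin k j) (g j) (g (suc j)))) ⟩
    ∑ (suc k) (λ j → bin k j * (g j + g (suc j))) ∎
    where
    open ≡-Reasoning
    ident : ∀ a b c → a + (b + c) ≡ a + c + b
    ident = solve-∀

  -- The sum of (-1)^i C(k,i) f(x+i); for f(x) = 1/x this is the beta integral of t^(x-1) (1-t)^k
  -- over [0,1].
  differences : (ℕ → ℤ) → ℕ → ℕ → ℤ
  differences f zero    x = f x
  differences f (suc k) x = differences f k x - differences f k (suc x)

  kummer : (ℕ → ℤ) → ℕ → ℕ → ℤ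
  kummer f k x = ∑ (suc k) (λ j → bin k j * differences f k (x ℕ.+ j))

  -- This is ∫ t^(x-1) (1-t²)^k dt for f(x) = 1/x, expanded as t^(x-1) (1-t)^k (1+t)^k.
  kummer-suc : ∀ f k x → kummer f (suc k) x ≡ kummer f k x - kummer f k (suc (suc x))
  kummer-suc f k x = begin
    ∑ (suc (suc k)) (λ j → bin (suc k) j * g j)
      ≡⟨ ∑-pascal k g ⟩
    ∑ (suc k) (λ j → bin k j * (g j + g (suc j)))
      ≡⟨ ∑-cong (suc k) (λ j _ → trans (cong (λ z → bin k j * (d (x ℕ.+ j) - d (suc (x ℕ.+ j)) + (d z - d (suc z)))) (ℕP.+-suc x j))
           (ident (bin k j) (d (x ℕ.+ j)) (d (suc (x ℕ.+ j))) (d (suc (suc (x ℕ.+ j)))))) ⟩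
    ∑ (suc k) (λ j → bin k j * d (x ℕ.+ j) + - + 1 * (bin k j * d (suc (suc x) ℕ.+ j)))
      ≡⟨ ∑-+ (suc k) (λ j → bin k j * d (x ℕ.+ j)) (λ j → - + 1 * (bin k j * d (suc (suc x) ℕ.+ j))) ⟩
    kummer f k x + ∑ (suc k) (λ j → - + 1 * (bin k j * d (suc (suc x) ℕ.+ j)))
      ≡⟨ cong (λ z → kummer f k x + z) (trans (∑-*ˡ (suc k) (- + 1) (λ j → bin k j * d (suc (suc x) ℕ.+ j))) (ℤP.-1*i≡-i (kummer f k (suc (suc x))))) ⟩
    kummer f k x - kummer f k (suc (suc x)) ∎
    where
    open ≡-Reasoning
    d g : ℕ → ℤ
    d = differences f k
    g j = differences f (suc k) (x ℕ.+ j)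
    ident : ∀ b x y z → b * (x - y + (y - z)) ≡ b * x + - + 1 * (b * z)
    ident = solve-∀

  -- Integers inside the rationals

  ℤtoℚᵘ : ∀ a → ℚ.toℚᵘ (ℤtoℚ a) ≃ mkℚᵘ a 0
  ℤtoℚᵘ a = ℚP.toℚᵘ-fromℚᵘ (mkℚᵘ a 0)

  ℤtoℚ-+ : ∀ a b → ℤtoℚ (a + b) ≡ ℤtoℚ a ℚ.+ ℤtoℚ b
  ℤtoℚ-+ a b = ℚP.toℚᵘ-injective (ℚᵘP.≃-trans (ℤtoℚᵘ (a + b))
    (ℚᵘP.≃-trans (*≡* (ident a b)) (ℚᵘP.≃-sym (ℚᵘP.≃-trans (ℚP.toℚᵘ-homo-+ (ℤtoℚ a) (ℤtoℚ b)) (ℚᵘP.+-cong (ℤtoℚᵘ a) (ℤtoℚᵘ b))))))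
    where
    ident : ∀ a b → (a + b) * + 1 ≡ (a * + 1 + b * + 1) * + 1
    ident = solve-∀

  ℤtoℚ-* : ∀ a b → ℤtoℚ (a * b) ≡ ℤtoℚ a ℚ.* ℤtoℚ b
  ℤtoℚ-* a b = ℚP.toℚᵘ-injective (ℚᵘP.≃-trans (ℤtoℚᵘ (a * b))
    (ℚᵘP.≃-trans (*≡* refl) (ℚᵘP.≃-sym (ℚᵘP.≃-trans (ℚP.toℚᵘ-homo-* (ℤtoℚ a) (ℤtoℚ b)) (ℚᵘP.*-cong (ℤtoℚᵘ a) (ℤtoℚᵘ b))))))

  ℤtoℚ-neg : ∀ a → ℤtoℚ (- a) ≡ ℚ.- ℤtoℚ a
  ℤtoℚ-neg a = ℚP.toℚᵘ-injective (ℚᵘP.≃-trans (ℤtoℚᵘ (- a)) (ℚᵘP.≃-sym (ℚᵘP.≃-trans (ℚP.toℚᵘ-homo‿- (ℤtoℚ a)) (ℚᵘP.-‿cong (ℤtoℚᵘ a)))))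

  ℤtoℚ-injective : ∀ a b → ℤtoℚ a ≡ ℤtoℚ b → a ≡ b
  ℤtoℚ-injective a b e = extract (ℚᵘP.≃-trans (ℚᵘP.≃-sym (ℤtoℚᵘ a)) (ℚᵘP.≃-trans (ℚᵘP.≃-reflexive (cong ℚ.toℚᵘ e)) (ℤtoℚᵘ b)))
    where
    extract : mkℚᵘ a 0 ≃ mkℚᵘ b 0 → a ≡ b
    extract (*≡* f) = trans (sym (ℤP.*-identityʳ a)) (trans f (ℤP.*-identityʳ b))

  recip-suc : ∀ k → (+ 1 ℚ./ suc k) ℚ.* ℤtoℚ (+ suc k) ≡ 1ℚ
  recip-suc k = ℚP.toℚᵘ-injective (ℚᵘP.≃-trans (ℚP.toℚᵘ-homo-* (+ 1 ℚ./ suc k) (ℤtoℚ (+ suc k)))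
    (ℚᵘP.≃-trans (ℚᵘP.*-cong (ℚP.toℚᵘ-fromℚᵘ (mkℚᵘ (+ 1) k)) (ℤtoℚᵘ (+ suc k))) (*≡* (ident (+ suc k)))))
    where
    ident : ∀ k → + 1 * k * + 1 ≡ + 1 * (k * + 1)
    ident = solve-∀

  divℚ-spec : ∀ a {b} → b ≢ 0ℚ → ∃ λ q → q ℚ.* b ≡ 1ℚ × divℚ a b ≡ a ℚ.* q
  divℚ-spec a {b} b≢0 with b ℚP.≟ 0ℚ
  ... | yes b≡0 = ⊥-elim (b≢0 b≡0)
  ... | no ne   = (ℚ.1/ b) {{≢-nonZero ne}} , ℚP.*-inverseˡ b {{≢-nonZero ne}} , refl

open Integers

-- Arithmetic modulo p and modulo p²

module PrimeModulus (q : ℕ) (pr : Prime (suc q)) where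

  open import Data.Integer using (_+_; _*_; _-_; -_; _^_)

  infix 4 _≈?_

  p : ℕ
  p = suc q

  P P² : ℤ
  P = + p
  P² = P * P

  Unit : ℤ → Set
  Unit a = ¬ (a ≈ + 0 [ P ])

  ∣⇒≈0 : ∀ {a} → p ℕD.∣ ℤ.∣ a ∣ → a ≈ + 0 [ P ]
  ∣⇒≈0 {a} d with ℤS.∣ᵤ⇒∣ {P} {a} d
  ... | ℤS.divides k eq = by k (trans (ℤP.+-identityʳ a) eq)

  ≈0⇒∣ : ∀ {a} → a ≈ + 0 [ P ] → p ℕD.∣ ℤ.∣ a ∣
  ≈0⇒∣ {a} (by k eq) = ℤS.∣⇒∣ᵤ {P} {a} (ℤS.divides k (trans (sym (ℤP.+-identityʳ a)) eq))

  _≈?_ : ∀ a b → Dec (a ≈ b [ P ])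
  a ≈? b = map′ (λ d → lc1 (+ 1) (∣⇒≈0 {a - b} d) (ident a b)) (λ h → ≈0⇒∣ (difference≈0 h)) (p ℕD.∣? ℤ.∣ a - b ∣)
    where
    ident : ∀ a b → a - b ≡ + 1 * (a - b - + 0)
    ident = solve-∀

  ≈0-* : ∀ a b → a * b ≈ + 0 [ P ] → (a ≈ + 0 [ P ]) ⊎ (b ≈ + 0 [ P ])
  ≈0-* a b h with euclidsLemma ℤ.∣ a ∣ ℤ.∣ b ∣ pr (subst (p ℕD.∣_) (ℤP.abs-* a b) (≈0⇒∣ h))
  ... | inj₁ d = inj₁ (∣⇒≈0 d)
  ... | inj₂ d = inj₂ (∣⇒≈0 d)

  unit-* : ∀ {a b} → Unit a → Unit b → Unit (a * b)
  unit-* {a} {b} u v h = [ u , v ]′ (≈0-* a b h)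

  unit-≈ : ∀ {a b} → a ≈ b [ P ] → Unit a → Unit b
  unit-≈ h u z = u (h ⟫ z)

  unit-*ʳ : ∀ a {b} → Unit (a * b) → Unit b
  unit-*ʳ a u z = u (≈-*ˡ a z ⟫ ≡⇒≈ (ℤP.*-zeroʳ a))

  unit-*ˡ : ∀ {a} b → Unit (a * b) → Unit a
  unit-*ˡ {a} b u z = u (≈-* z (≈-refl {b}) ⟫ ≡⇒≈ (ℤP.*-zeroˡ b))

  unit-pos : ∀ {k} → 0 < k → k < p → Unit (+ k)
  unit-pos {suc k} _ k<p h = ℕD.>⇒∤ k<p (≈0⇒∣ h)

  1<p : 1 < p
  1<p = ℕ.nonTrivial⇒n>1 p {{prime⇒nonTrivial pr}}

  unit-1 : Unit (+ 1)
  unit-1 = unit-pos (s≤s z≤n) 1<p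

  unit-! : ∀ k → k < p → Unit (+ (k !))
  unit-! zero    _     = unit-1
  unit-! (suc k) k+1<p = unit-≈ (≡⇒≈ (sym (ℤP.pos-* (suc k) (k !)))) (unit-* (unit-pos (s≤s z≤n) k+1<p) (unit-! k (ℕP.<-trans ℕP.≤-refl k+1<p)))

  unit-^ : ∀ {a} k → Unit a → Unit (a ^ k)
  unit-^ zero    u = unit-1
  unit-^ (suc k) u = unit-* u (unit-^ k u)

  unit-neg : ∀ {a} → Unit a → Unit (- a)
  unit-neg {a} u z = u (lc1 (- + 1) z (ident a))
    where
    ident : ∀ a → a - + 0 ≡ - + 1 * (- a - + 0)
    ident = solve-∀

  unit-sgn : ∀ k → Unit (sgn k)
  unit-sgn k = unit-^ k (unit-neg unit-1)

  weaken² : ∀ {a b} → a ≈ b [ P² ] → a ≈ b [ P ]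
  weaken² = weaken P

  P≈0 : P ≈ + 0 [ P ]
  P≈0 = by (+ 1) (ident P)
    where
    ident : ∀ a → a - + 0 ≡ + 1 * a
    ident = solve-∀

  ≈0² : ∀ {a b} → a ≈ + 0 [ P ] → b ≈ + 0 [ P ] → a * b ≈ + 0 [ P² ]
  ≈0² {a} {b} (by k e) (by l f) = by (k * l) (trans (cong₂ (λ u v → u * v - + 0) (trans (sym (ℤP.+-identityʳ a)) e) (trans (sym (ℤP.+-identityʳ b)) f)) (ident k l P))
    where
    ident : ∀ k l P → k * P * (l * P) - + 0 ≡ k * l * (P * P)
    ident = solve-∀

  ≈0²-difference : ∀ {a c d} → a ≈ + 0 [ P ] → c ≈ d [ P ] → a * (c - d) ≈ + 0 [ P² ]
  ≈0²-difference {c = c} {d} z h = ≈0² {b = c - d} z (difference≈0 h)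

  p∣bin : ∀ k → 0 < k → k < p → bin p k ≈ + 0 [ P ]
  p∣bin (suc k) _ k<p with ≈0-* (+ suc k) (bin p (suc k)) (by (bin q k) (trans (ℤP.+-identityʳ _) (trans (bin-absorb q k) (ℤP.*-comm P (bin q k)))))
  ... | inj₁ z = ⊥-elim (unit-pos (s≤s z≤n) k<p z)
  ... | inj₂ z = z

  fermat-ℕ : ∀ a → (+ a) ^ p ≈ + a [ P ]
  fermat-ℕ zero    = ≡⇒≈ refl
  fermat-ℕ (suc a) =
    ≡⇒≈ (trans (binomial (+ 1) (+ a) p) (trans (∑-first p f) (cong (_+ ∑ p (f ∘ suc)) (trans (ℤP.*-identityˡ (+ 1 * (+ a) ^ p)) (ℤP.*-identityˡ ((+ a) ^ p))))))
    ⟫ lc3 (+ 1) (+ 1) (+ 1) middle top (fermat-ℕ a) (ident ((+ a) ^ p) (∑ q (f ∘ suc)) (f p) (+ a))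
    where
    f : ℕ → ℤ
    f k = bin p k * ((+ 1) ^ k * (+ a) ^ (p ∸ k))
    middle : ∑ q (f ∘ suc) ≈ + 0 [ P ]
    middle = ∑-≈ q (λ k k<q → ≈-* (p∣bin (suc k) (s≤s z≤n) (s≤s k<q)) (≈-refl {(+ 1) ^ suc k * (+ a) ^ (q ∸ k)})
                              ⟫ ≡⇒≈ (ℤP.*-zeroˡ ((+ 1) ^ suc k * (+ a) ^ (q ∸ k)))) ⟫ ≡⇒≈ (∑-0 q)
    top : f p ≈ + 1 [ P ]
    top = ≡⇒≈ (cong₂ _*_ (bin-diag p) (cong₂ _*_ (ℤP.^-zeroˡ p) (cong ((+ a) ^_) (ℕP.n∸n≡0 p))))
    ident : ∀ A m t a → A + (m + t) - (+ 1 + a) ≡ + 1 * (m - + 0) + + 1 * (t - + 1) + + 1 * (A - a)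
    ident = solve-∀

  residue : ∀ a → + (a %ℕ p) ≈ a [ P ]
  residue a = by (- (a /ℕ p)) (trans (cong (λ z → + (a %ℕ p) - z) (a≡a%ℕn+[a/ℕn]*n a p)) (ident (+ (a %ℕ p)) (a /ℕ p) P))
    where
    ident : ∀ r k P → r - (r + k * P) ≡ - k * P
    ident = solve-∀

  cancel : ∀ {a b} c → Unit c → c * a ≈ c * b [ P ] → a ≈ b [ P ]
  cancel {a} {b} c u h with ≈0-* c (a - b) (lc1 (+ 1) h (ident c a b))
    where
    ident : ∀ c a b → c * (a - b) - + 0 ≡ + 1 * (c * a - c * b)
    ident = solve-∀
  ... | inj₁ z = ⊥-elim (u z)
  ... | inj₂ z = lc1 (+ 1) z (ident a b)
    where
    ident : ∀ a b → a - b ≡ + 1 * (a - b - + 0)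
    ident = solve-∀

  square≈1 : ∀ {a} → a * a ≈ + 1 [ P ] → a ≈ + 1 [ P ] ⊎ a ≈ - + 1 [ P ]
  square≈1 {a} h with ≈0-* (a - + 1) (a + + 1) (lc1 (+ 1) h (ident a))
    where
    ident : ∀ a → (a - + 1) * (a + + 1) - + 0 ≡ + 1 * (a * a - + 1)
    ident = solve-∀
  ... | inj₁ z = inj₁ (lc1 (+ 1) z (ident a))
    where
    ident : ∀ a → a - + 1 ≡ + 1 * (a - + 1 - + 0)
    ident = solve-∀
  ... | inj₂ z = inj₂ (lc1 (+ 1) z (ident a))
    where
    ident : ∀ a → a - - + 1 ≡ + 1 * (a + + 1 - + 0)
    ident = solve-∀

  fermat : ∀ {a} → Unit a → a ^ q ≈ + 1 [ P ]
  fermat {a} u = cancel a u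
    (≈-^ p (≈-sym (residue a)) ⟫ fermat-ℕ (a %ℕ p) ⟫ residue a ⟫ ≡⇒≈ (sym (ℤP.*-identityʳ a)))

  private
    expand : ∀ b k m → (b + k * P) ^ suc m ≈ b ^ suc m + + suc m * (k * P * b ^ m) [ P² ]
    expand b k zero    = ≡⇒≈ (ident b (k * P))
      where
      ident : ∀ b k → (b + k) * + 1 ≡ b * + 1 + + 1 * (k * + 1)
      ident = solve-∀
    expand b k (suc m) = lc2 (b + k * P) ((+ 1 + + m) * k * k * (b ^ m)) (expand b k m) (modulus≈0 (+ 1)) (ident b k P ((b + k * P) ^ suc m) (b ^ m) (+ m))
      where
      ident : ∀ b k P E B m → (b + k * P) * E - (b * (b * B) + (+ 1 + (+ 1 + m)) * (k * P * (b * B)))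
        ≡ (b + k * P) * (E - (b * B + (+ 1 + m) * (k * P * B))) + (+ 1 + m) * k * k * B * (+ 1 * (P * P) - + 0)
      ident = solve-∀

  -- In (b + kp)^p the linear term carries p · kp and the later ones (kp)². Thus a^p is the
  -- Teichmüller representative of a modulo p²: it depends only on the residue of a modulo p.
  lift : ∀ {a b} → a ≈ b [ P ] → a ^ p ≈ b ^ p [ P² ]
  lift {a} {b} (by k e) = ≡⇒≈ (cong (_^ p) (elc1 {x = a} {y = b + k * P} (+ 1) e (ident a b (k * P)))) ⟫ expand b k q
    ⟫ lc1 (k * b ^ q) (modulus≈0 (+ 1)) (ident' (b ^ p) (b ^ q) k P)
    where
    ident : ∀ a b k → a - (b + k) ≡ + 1 * (a - b - k)
    ident = solve-∀
    ident' : ∀ A B k P → A + P * (k * P * B) - A ≡ k * B * (+ 1 * (P * P) - + 0)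
    ident' = solve-∀

  -- Inversion modulo p² as a power, with exponent p(p-1) - 1. It is total on ℤ, and it is
  -- multiplicative and compatible with congruences because every power is.
  ι : ℤ → ℤ
  ι a = a ^ ℕ.pred (q ℕ.* p)

  ι-inverse : ∀ {a} → Unit a → a * ι a ≈ + 1 [ P² ]
  ι-inverse {a} u = ≡⇒≈ (trans (cong (a ^_) (ℕP.suc-pred (q ℕ.* p) {{ℕP.m*n≢0 q p {{ℕ.>-nonZero (ℕP.≤-pred 1<p)}}}})) (sym (ℤP.^-*-assoc a q p)))
    ⟫ lift (fermat u) ⟫ ≡⇒≈ (ℤP.^-zeroˡ p)

  cancel² : ∀ {a b} c → Unit c → c * a ≈ c * b [ P² ] → a ≈ b [ P² ]
  cancel² {a} {b} c u h = lc3 (ι c) (- a) b h (ι-inverse u) (ι-inverse u) (ident a b c (ι c))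
    where
    ident : ∀ a b c i → a - b ≡ i * (c * a - c * b) + - a * (c * i - + 1) + b * (c * i - + 1)
    ident = solve-∀

  ι-unique : ∀ {a b} → Unit a → a * b ≈ + 1 [ P² ] → ι a ≈ b [ P² ]
  ι-unique {a} u h = cancel² a u (ι-inverse u ⟫ ≈-sym h)

  residue-unique : ∀ {i j} → i < p → j < p → + i ≈ + j [ P ] → i ≡ j
  residue-unique {i} {j} i<p j<p h = ℤP.+-injective (ℤP.i-j≡0⇒i≡j (+ i) (+ j) (ℤP.∣i∣≡0⇒i≡0 (small ℤ.∣ + i - + j ∣ bound (≈0⇒∣ (difference≈0 h)))))
    where
    bound : ℤ.∣ + i - + j ∣ < p
    bound = ℕP.≤-<-trans (subst (λ z → ℤ.∣ z ∣ ≤ i ℕ.⊔ j) (sym (ℤP.m-n≡m⊖n i j)) (ℤP.∣m⊝n∣≤m⊔n i j)) (ℕP.⊔-lub i<p j<p)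
    small : ∀ k → k < p → p ℕD.∣ k → k ≡ 0
    small zero    _   _ = refl
    small (suc k) k<p d = ⊥-elim (ℕD.>⇒∤ k<p d)

  reduce : ℤ → Fin p
  reduce a = fromℕ< (n%ℕd<d a p)

  toℕ-reduce : ∀ a → + toℕ (reduce a) ≈ a [ P ]
  toℕ-reduce a = ≡⇒≈ (cong +_ (FinP.toℕ-fromℕ< (n%ℕd<d a p))) ⟫ residue a

  reduce-unique : ∀ {a} i → a ≈ + toℕ i [ P ] → reduce a ≡ i
  reduce-unique {a} i h = FinP.toℕ-injective (residue-unique (FinP.toℕ<n (reduce a)) (FinP.toℕ<n i) (toℕ-reduce a ⟫ h))

  -- Multiplication by `g` permutes the residues, with inverse multiplication by `ι g`. The values
  -- are compared modulo p² although the permutation is known only modulo p; functions of a^p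
  -- satisfy the hypothesis by `lift`.
  ∑-permute : ∀ (F : ℤ → ℤ) → (∀ {a b} → a ≈ b [ P ] → F a ≈ F b [ P² ]) → ∀ {g} → Unit g →
    ∑ p (λ k → F (g * + k)) ≈ ∑ p (λ k → F (+ k)) [ P² ]
  ∑-permute F F-resp {g} u =
    ∑-≈ p (λ k _ → F-resp (≈-sym (toℕ-reduce (g * + k))))
    ⟫ ≡⇒≈ (trans (∑-Fin p (λ k → F (+ toℕ (reduce (g * + k)))))
          (trans (sym (FinSum.sum-permute (λ i → F (+ toℕ i)) π)) (sym (∑-Fin p (λ k → F (+ k))))))
    where
    inv : g * ι g ≈ + 1 [ P ]
    inv = weaken² (ι-inverse u)
    π : Permutation′ p
    π = permutation (λ i → reduce (g * + toℕ i)) (λ i → reduce (ι g * + toℕ i))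
      (λ i → reduce-unique i (≈-*ˡ g (toℕ-reduce (ι g * + toℕ i)) ⟫ lc1 (+ toℕ i) inv (ident g (ι g) (+ toℕ i))))
      (λ i → reduce-unique i (≈-*ˡ (ι g) (toℕ-reduce (g * + toℕ i)) ⟫ lc1 (+ toℕ i) inv (ident' g (ι g) (+ toℕ i))))
      where
      ident : ∀ g h i → g * (h * i) - i ≡ i * (g * h - + 1)
      ident = solve-∀
      ident' : ∀ g h i → h * (g * i) - i ≡ i * (g * h - + 1)
      ident' = solve-∀

  sgn*bin≈1 : ∀ k → k < p → sgn k * bin q k ≈ + 1 [ P ]
  sgn*bin≈1 zero    _     = ≡⇒≈ refl
  sgn*bin≈1 (suc k) k+1<p = cancel (+ suc k) (unit-pos (s≤s z≤n) k+1<p)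
    (lc3 (+ suc k) (- sgn k * + 1) (- (sgn k * bin q k)) (sgn*bin≈1 k (ℕP.<-trans ℕP.≤-refl k+1<p)) (≡⇒≈ (bin-upper q k)) P≈0
      (ident (sgn k) (bin q (suc k)) (bin q k) (+ k) (+ q)))
    where
    ident : ∀ s B b k q → (+ 1 + k) * (- + 1 * s * B) - (+ 1 + k) * + 1
      ≡ (+ 1 + k) * (s * b - + 1) + (- s * + 1) * ((+ 1 + k) * B - (q - k) * b) + - (s * b) * (+ 1 + q - + 0)
    ident = solve-∀

  -- The weights (-1)^k C(p-1,k) are 1 modulo p. So the known values of `surj` give both the
  -- vanishing of power sums below p - 1 and, on the diagonal, Wilson's theorem.
  ∑-powers≈surj : ∀ m → ∑ p (λ k → (+ k) ^ m) ≈ surj q m [ P ]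
  ∑-powers≈surj m = ∑-≈ p (λ k k<p → lc1 (- (+ k) ^ m) (sgn*bin≈1 k k<p) (ident ((+ k) ^ m) (sgn k * bin q k)))
    where
    ident : ∀ x e → x - e * x ≡ - x * (e - + 1)
    ident = solve-∀

  ∑-powers≈0 : ∀ m → m < q → ∑ p (λ k → (+ k) ^ m) ≈ + 0 [ P ]
  ∑-powers≈0 m m<q = ∑-powers≈surj m ⟫ ≡⇒≈ (surj-< m q m<q)

  ∑-ones : ∀ (f : ℕ → ℤ) {M} → f 0 ≈ + 0 [ M ] → (∀ k → 0 < k → k < p → f k ≈ + 1 [ M ]) → ∑ p f ≈ + q [ M ]
  ∑-ones f {M} z h = ≡⇒≈ (∑-first q f) ⟫ ≈-+ z (∑-≈ q (λ k k<q → h (suc k) (s≤s z≤n) (s≤s k<q)))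
    ⟫ ≡⇒≈ (trans (ℤP.+-identityˡ _) (∑-1 q))

  q≈-1 : + q ≈ - + 1 [ P ]
  q≈-1 = lc1 (+ 1) P≈0 (ident (+ q))
    where
    ident : ∀ q → q - - + 1 ≡ + 1 * (+ 1 + q - + 0)
    ident = solve-∀

  0^ : ∀ k → 0 < k → (+ 0) ^ k ≡ + 0
  0^ (suc k) _ = refl

  wilson : sgn q * + (q !) ≈ - + 1 [ P ]
  wilson = ≡⇒≈ (sym (surj-diag q)) ⟫ ≈-sym (∑-powers≈surj q)
    ⟫ ∑-ones (λ k → (+ k) ^ q) (≡⇒≈ (0^ q (ℕP.≤-pred 1<p))) (λ k 0<k k<p → fermat (unit-pos 0<k k<p)) ⟫ q≈-1

  -- If every nonzero residue satisfied a^m ≡ 1, the m-th power sum would be p - 1 ≡ -1, but it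
  -- vanishes for m < p - 1. This takes the place of a primitive root.
  non-root : ∀ m → 0 < m → m < q → ∃ λ g → Unit (+ g) × ¬ ((+ g) ^ m ≈ + 1 [ P ])
  non-root m 0<m m<q with ℕP.anyUpTo? (λ k → ¬? ((+ suc k) ^ m ≈? + 1)) q
  ... | yes (k , k<q , h) = suc k , unit-pos (s≤s z≤n) (s≤s k<q) , h
  ... | no none = ⊥-elim (unit-neg unit-1 (≈-sym q≈-1 ⟫ ≈-sym all-ones ⟫ ∑-powers≈0 m m<q))
    where
    one : ∀ k → 0 < k → k < p → (+ k) ^ m ≈ + 1 [ P ]
    one (suc k) _ (s≤s k<q) = decidable-stable ((+ suc k) ^ m ≈? + 1) (λ h → none (k , k<q , h))
    all-ones : ∑ p (λ k → (+ k) ^ m) ≈ + q [ P ]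
    all-ones = ∑-ones (λ k → (+ k) ^ m) (≡⇒≈ (0^ m 0<m)) one

  -- Replacing k by gk permutes the summands and multiplies the sum by ζ^e. By the choice of g, ζ^e
  -- - 1 is a unit, since e ≡ m modulo p - 1.
  ∑-teichmüller≈0 : ∀ m → 0 < m → m < q → ∀ i → ∑ p (λ k → ((+ k) ^ p) ^ (m ℕ.+ q ℕ.* i)) ≈ + 0 [ P² ]
  ∑-teichmüller≈0 m 0<m m<q i with non-root m 0<m m<q
  ... | g , u , h = cancel² (ζ ^ e - + 1) unit-ζ
    (≡⇒≈ (ident (ζ ^ e) (∑ p (λ k → F (+ k))))
     ⟫ lc1 (+ 1) (≈-sym (≡⇒≈ (∑-*ˡ p (ζ ^ e) (λ k → F (+ k)))) ⟫ ∑-≈ p (λ k _ → ≡⇒≈ (sym (F-* (+ k)))) ⟫ ∑-permute F F-resp u)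
         (ident' (ζ ^ e * ∑ p (λ k → F (+ k))) (∑ p (λ k → F (+ k))) (ζ ^ e)))
    where
    ζ : ℤ
    ζ = (+ g) ^ p
    e : ℕ
    e = m ℕ.+ q ℕ.* i
    F : ℤ → ℤ
    F a = (a ^ p) ^ e
    F-resp : ∀ {a b} → a ≈ b [ P ] → F a ≈ F b [ P² ]
    F-resp h = ≈-^ e (lift h)
    F-* : ∀ a → F (+ g * a) ≡ ζ ^ e * F a
    F-* a = trans (cong (_^ e) (^-*-distrib (+ g) a p)) (^-*-distrib ζ (a ^ p) e)
    unit-ζ : Unit (ζ ^ e - + 1)
    unit-ζ z = h (≈-sym (≈-^ e (fermat-ℕ g) ⟫ ≡⇒≈ (ℤP.^-distribˡ-+-* (+ g) m (q ℕ.* i))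
        ⟫ ≈-*ˡ ((+ g) ^ m) (≡⇒≈ (sym (ℤP.^-*-assoc (+ g) q i)) ⟫ ≈-^ i (fermat u) ⟫ ≡⇒≈ (ℤP.^-zeroˡ i)) ⟫ ≡⇒≈ (ℤP.*-identityʳ ((+ g) ^ m)))
        ⟫ lc1 (+ 1) z (ident″ (ζ ^ e)))
      where
      ident″ : ∀ a → a - + 1 ≡ + 1 * (a - + 1 - + 0)
      ident″ = solve-∀
    ident : ∀ z s → (z - + 1) * s ≡ z * s - s
    ident = solve-∀
    ident' : ∀ u s z → u - s - (z - + 1) * + 0 ≡ + 1 * (u - s)
    ident' = solve-∀

  ∑-teichmüller-full : ∀ i → ∑ p (λ k → ((+ k) ^ p) ^ (q ℕ.* suc i)) ≈ + q [ P² ]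
  ∑-teichmüller-full i = ∑-ones (λ k → ((+ k) ^ p) ^ (q ℕ.* suc i))
    (≡⇒≈ (0^ (q ℕ.* suc i) (ℕP.*-mono-≤ (ℕP.≤-pred 1<p) (s≤s {n = i} z≤n))))
    (λ k 0<k k<p → ≡⇒≈ (trans (sym (ℤP.^-*-assoc ((+ k) ^ p) q (suc i))) (cong (_^ suc i) (^-comm (+ k) p q)))
      ⟫ ≈-^ (suc i) (lift (fermat (unit-pos 0<k k<p)) ⟫ ≡⇒≈ (ℤP.^-zeroˡ p)) ⟫ ≡⇒≈ (ℤP.^-zeroˡ (suc i)))

-- The polynomial V modulo p² for p = 2n + 1

module OddPrime (m : ℕ) (pr : Prime (suc (suc m ℕ.+ suc m))) where

  open import Data.Integer using (_+_; _*_; _-_; -_; _^_)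

  n : ℕ
  n = suc m

  open PrimeModulus (n ℕ.+ n) pr public

  n<p : n < p
  n<p = s≤s (ℕP.m≤m+n n n)

  unit-2 : Unit (+ 2)
  unit-2 = unit-pos (s≤s z≤n) (s≤s (s≤s (ℕP.≤-trans (s≤s z≤n) (ℕP.m≤n+m n m))))

  sign-unique : ∀ {e f} → IsSign e → IsSign f → e ≈ f [ P ] → e ≡ f
  sign-unique (inj₁ refl) (inj₁ refl) h = refl
  sign-unique (inj₂ refl) (inj₂ refl) h = refl
  sign-unique (inj₁ refl) (inj₂ refl) h = ⊥-elim (unit-2 (lc1 (+ 1) h refl))
  sign-unique (inj₂ refl) (inj₁ refl) h = ⊥-elim (unit-2 (lc1 (- + 1) h refl))

  unit-≤n : ∀ {k} → 0 < k → k ≤ n → Unit (+ k)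
  unit-≤n 0<k k≤n = unit-pos 0<k (ℕP.≤-<-trans k≤n n<p)

  -- P_k(0): the recurrence loses its middle term, so odd degrees vanish and even degrees give
  -- central binomials. The recurrence divides by the degree, known here to be a unit up to n; the
  -- alternative n = 2v is the case in which the next odd degree would exceed n.
  Leg-half : ∀ x → + 1 + + 2 * x ≈ + 0 [ P² ] → ∀ v → v ℕ.+ v ≤ n →
    ((+ 2) ^ (v ℕ.+ v) * Leg (v ℕ.+ v) x ≈ sgn v * central v [ P² ]) × (Leg (suc (v ℕ.+ v)) x ≈ + 0 [ P² ] ⊎ n ≡ v ℕ.+ v)
  Leg-half x h zero    _   = ≡⇒≈ refl , inj₁ (≡⇒≈ (Leg-1 x) ⟫ h)
  Leg-half x h (suc v) v≤n with Leg-half x h v (ℕP.≤-trans (ℕP.≤-trans (ℕP.n≤1+n (v ℕ.+ v)) (ℕP.n≤1+n (suc (v ℕ.+ v)))) (subst (_≤ n) (cong suc (ℕP.+-suc v v)) v≤n))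
  ... | _  , inj₂ e    = ⊥-elim (ℕP.1+n≰n (ℕP.≤-trans (ℕP.n≤1+n (suc (v ℕ.+ v))) (subst₂ _≤_ (cong suc (ℕP.+-suc v v)) e v≤n)))
  ... | ih , inj₁ odd  = subst (λ z → (+ 2) ^ suc z * Leg (suc z) x ≈ sgn (suc v) * central (suc v) [ P² ]) (sym (ℕP.+-suc v v)) even
      , subst (λ z → (Leg (suc (suc z)) x ≈ + 0 [ P² ]) ⊎ n ≡ suc z) (sym (ℕP.+-suc v v)) next
    where
    v≤n' : suc (suc (v ℕ.+ v)) ≤ n
    v≤n' = subst (_≤ n) (cong suc (ℕP.+-suc v v)) v≤n
    even : (+ 2) ^ suc (suc (v ℕ.+ v)) * Leg (suc (suc (v ℕ.+ v))) x ≈ sgn (suc v) * central (suc v) [ P² ]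
    even = cancel² (+ suc (suc (v ℕ.+ v))) (unit-≤n (s≤s z≤n) v≤n')
      (lc4 (+ 4 * (+ 2) ^ (v ℕ.+ v)) (+ 2 * sgn v) (- + 4 * (+ 1 + (+ v + + v))) (+ 4 * (+ 2) ^ (v ℕ.+ v) * (+ 3 + + 2 * (+ v + + v)) * Leg (suc (v ℕ.+ v)) x)
        (≡⇒≈ (Leg-rec (v ℕ.+ v) x)) (≡⇒≈ (central-suc v)) ih h
        (ident (Leg (suc (suc (v ℕ.+ v))) x) (Leg (suc (v ℕ.+ v)) x) (Leg (v ℕ.+ v) x) (central (suc v)) (central v) ((+ 2) ^ (v ℕ.+ v)) (sgn v) (+ v) x))
      where
      ident : ∀ L₂ L₁ L₀ C c t s v x →
        (+ 2 + (v + v)) * (+ 2 * (+ 2 * t) * L₂) - (+ 2 + (v + v)) * (- + 1 * s * C)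
        ≡ + 4 * t * ((+ 2 + (v + v)) * L₂ - ((+ 3 + + 2 * (v + v)) * (+ 1 + + 2 * x) * L₁ - (+ 1 + (v + v)) * L₀))
          + + 2 * s * ((+ 1 + v) * C - + 2 * (+ 1 + (v + v)) * c)
          + - + 4 * (+ 1 + (v + v)) * (t * L₀ - s * c)
          + + 4 * t * (+ 3 + + 2 * (v + v)) * L₁ * (+ 1 + + 2 * x - + 0)
      ident = solve-∀
    next : (Leg (suc (suc (suc (v ℕ.+ v)))) x ≈ + 0 [ P² ]) ⊎ n ≡ suc (suc (v ℕ.+ v))
    next with n ℕ.≟ suc (suc (v ℕ.+ v))
    ... | yes e = inj₂ e
    ... | no ne = inj₁ (cancel² (+ suc (suc (suc (v ℕ.+ v)))) (unit-≤n (s≤s z≤n) (ℕP.≤∧≢⇒< v≤n' (ne ∘ sym)))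
        (lc3 (+ 1) ((+ 3 + + 2 * (+ 1 + (+ v + + v))) * Leg (suc (suc (v ℕ.+ v))) x) (- (+ 2 + (+ v + + v)))
          (≡⇒≈ (Leg-rec (suc (v ℕ.+ v)) x)) h odd
          (ident (Leg (suc (suc (suc (v ℕ.+ v)))) x) (Leg (suc (suc (v ℕ.+ v))) x) (Leg (suc (v ℕ.+ v)) x) (+ v) x)))
      where
      ident : ∀ L₃ L₂ L₁ v x → (+ 3 + (v + v)) * L₃ - (+ 3 + (v + v)) * + 0
        ≡ + 1 * ((+ 3 + (v + v)) * L₃ - ((+ 3 + + 2 * (+ 1 + (v + v))) * (+ 1 + + 2 * x) * L₂ - (+ 2 + (v + v)) * L₁))
          + (+ 3 + + 2 * (+ 1 + (v + v))) * L₂ * (+ 1 + + 2 * x - + 0) + - (+ 2 + (v + v)) * (L₁ - + 0)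
      ident = solve-∀

  c : ℕ → ℤ
  c = coef n

  -- Both sides start at 1 and have the same ratio of consecutive terms, because 4(n-k)(n+k+1) ≡
  -- -(2k+1)² modulo p².
  central² : ∀ k → k ≤ n → central k * central k ≈ c k * (- + 16) ^ k [ P² ]
  central² zero    _   = ≡⇒≈ refl
  central² (suc k) k<n = cancel² (+ suc k * + suc k) (unit-* u u)
    (lc4 (+ suc k * central (suc k) + + 2 * (+ 1 + (+ k + + k)) * central k) (+ 4 * (+ 1 + (+ k + + k)) * (+ 1 + (+ k + + k)))
         (+ 16 * (- + 16) ^ k) (+ 4 * c k * (- + 16) ^ k)
      (≡⇒≈ (central-suc k)) (central² k (ℕP.<⇒≤ k<n)) (≡⇒≈ (coef-up n k)) (modulus≈0 (+ 1))
      (ident (central (suc k)) (central k) (c (suc k)) (c k) ((- + 16) ^ k) (+ n) (+ k)))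
    where
    u : Unit (+ suc k)
    u = unit-≤n (s≤s z≤n) k<n
    ident : ∀ C b C' b' s n k →
      (+ 1 + k) * (+ 1 + k) * (C * C) - (+ 1 + k) * (+ 1 + k) * (C' * (- + 16 * s))
      ≡ ((+ 1 + k) * C + + 2 * (+ 1 + (k + k)) * b) * ((+ 1 + k) * C - + 2 * (+ 1 + (k + k)) * b)
        + + 4 * (+ 1 + (k + k)) * (+ 1 + (k + k)) * (b * b - b' * s)
        + + 16 * s * ((+ 1 + k) * (+ 1 + k) * C' - (n - k) * (+ 1 + (n + k)) * b')
        + + 4 * b' * s * (+ 1 * ((+ 1 + (n + n)) * (+ 1 + (n + n))) - + 0)
    ident = solve-∀

  t : ℤ
  t = (+ 2) ^ n

  t²≈1 : t * t ≈ + 1 [ P ]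
  t²≈1 = ≡⇒≈ (sym (ℤP.^-distribˡ-+-* (+ 2) n n)) ⟫ fermat unit-2

  unit-t : Unit t
  unit-t = unit-^ n unit-2

  -- Used with a sign L, where it says t² + 1 ≡ 2tL modulo p².
  t-square : ∀ {L} → L ≈ t [ P ] → (t - L) * (t - L) ≈ + 0 [ P² ]
  t-square {L} h = ≈0² {t - L} {t - L} (difference≈0 (≈-sym h)) (difference≈0 (≈-sym h))

  [-16]^ : ∀ k → (- + 16) ^ k ≡ sgn k * ((+ 2) ^ k * (+ 2) ^ k * ((+ 2) ^ k * (+ 2) ^ k))
  [-16]^ zero    = refl
  [-16]^ (suc k) = trans (cong (- + 16 *_) ([-16]^ k)) (ident (sgn k) ((+ 2) ^ k))
    where
    ident : ∀ s t → - + 16 * (s * (t * t * (t * t))) ≡ - + 1 * s * (+ 2 * t * (+ 2 * t) * (+ 2 * t * (+ 2 * t)))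
    ident = solve-∀

  c-n : c n ≡ central n
  c-n = trans (cong (_* central n) (bin-diag n)) (ℤP.*-identityˡ (central n))

  unit-central-n : Unit (central n)
  unit-central-n = unit-*ʳ (sgn n) (unit-≈ (≈-sym (sgn*bin≈1 n n<p)) unit-1)

  -- Morley's congruence to the order p²: at k = n the coefficient in `central²` is `central n`
  -- itself, and one factor cancels.
  central-n : central n ≈ sgn n * (t * t * (t * t)) [ P² ]
  central-n = cancel² (central n) unit-central-n (central² n ℕP.≤-refl
    ⟫ ≡⇒≈ (cong₂ _*_ c-n ([-16]^ n)))

  unit-2k-1 : ∀ k → k ≤ n → Unit (+ k + + k - + 1)
  unit-2k-1 zero    _   = unit-neg unit-1
  unit-2k-1 (suc k) k<n = unit-≈ (≡⇒≈ (ident (+ k))) (unit-pos {suc (k ℕ.+ k)} (s≤s z≤n) (s≤s (ℕP.+-mono-< k<n k<n)))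
    where
    ident : ∀ k → + 1 + (k + k) ≡ + 1 + k + (+ 1 + k) - + 1
    ident = solve-∀

  V : ℤ → ℤ
  V x = ∑ (suc n) (λ k → c k * x ^ k * ι (+ k + + k - + 1))

  -- Modulo p², (k+1)² c(k+1) is -(2k+1)²/4 times c(k), so 2k+1 divides out. The quotient is spread
  -- over coefficients of degrees n and n - 1 in such a way that it sums to Legendre polynomials.
  c/2k-1 : ∀ k → suc k ≤ n → c (suc k) * ι (+ suc k + + suc k - + 1)
    ≈ - c (suc k) - c k - + n * (c (suc k) + + 2 * c k - coef m (suc k)) [ P² ]
  c/2k-1 k k<n = cancel² (+ suc k * + suc k) (unit-* u u) (cancel² d (unit-2k-1 (suc k) k<n)
    (lc4 (+ suc k * + suc k * c (suc k)) (+ 1 + d * (+ 1 + + n)) (- (d * + n)) (+ suc k * + suc k * c k)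
      (ι-inverse (unit-2k-1 (suc k) k<n)) (≡⇒≈ (coef-up n k)) (≡⇒≈ (coef-lower m k)) (modulus≈0 (+ 1))
      (ident (c (suc k)) (c k) (coef m (suc k)) (ι d) (+ m) (+ k))))
    where
    d : ℤ
    d = + suc k + + suc k - + 1
    u : Unit (+ suc k)
    u = unit-≤n (s≤s z≤n) k<n
    ident : ∀ C X L i m k →
      let n = + 1 + m ; K = + 1 + k ; d = K + K - + 1 in
      d * (K * K * (C * i)) - d * (K * K * (- C - X - n * (C + + 2 * X - L)))
      ≡ K * K * C * (d * i - + 1) + (+ 1 + d * (+ 1 + n)) * (K * K * C - (n - k) * (+ 1 + (n + k)) * X)
        + - (d * n) * (K * K * L - (m - k) * (n - k) * X) + K * K * X * (+ 1 * ((+ 1 + (n + n)) * (+ 1 + (n + n))) - + 0)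
    ident = solve-∀

  -- Summation of `c/2k-1` over k < n leaves out c(n) wherever a coefficient is multiplied by x.
  -- Completing these sums to Legendre polynomials costs (1 + 2n) c(n) x^(n+1), and 1 + 2n is p.
  V-formula : ∀ x → V x ≈ - (+ 1 + x) * Leg n x - + n * ((+ 1 + + 2 * x) * Leg n x - Leg m x) + P * c n * x ^ suc n [ P² ]
  V-formula x = lc2 {a = V x} {b = partial n} {a' = s m (suc n)} {b' = Leg m x} (+ 1) (+ n) (sums n ℕP.≤-refl)
      (≡⇒≈ (trans (cong (s m) (ℕP.+-comm 1 n)) (Leg-stable m x 1)))
      (ident (V x) (s n n) (c n) (s m (suc n)) (Leg m x) x (x ^ n) (+ n))
    where
    s : ℕ → ℕ → ℤ
    s j N = ∑ N (λ k → coef j k * x ^ k)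
    partial : ℕ → ℤ
    partial N = - s n (suc N) - x * s n N - + n * (s n (suc N) + + 2 * x * s n N - s m (suc N))
    sums : ∀ N → N ≤ n → ∑ (suc N) (λ k → c k * x ^ k * ι (+ k + + k - + 1)) ≈ partial N [ P² ]
    sums zero    _   = lc1 (+ 1) (ι-unique {b = - + 1} (unit-2k-1 0 z≤n) (≡⇒≈ refl)) (ident₀ x (+ n) (ι (- + 1)))
      where
      ident₀ : ∀ x n i → + 0 + + 1 * i - (- + 1 - x * + 0 - n * (+ 1 + + 2 * x * + 0 - + 1)) ≡ + 1 * (i - - + 1)
      ident₀ = solve-∀
    sums (suc N) N<n = lc2 (+ 1) (x ^ suc N) (sums N (ℕP.<⇒≤ N<n)) (c/2k-1 N N<n)
      (ident₁ (∑ (suc N) (λ k → c k * x ^ k * ι (+ k + + k - + 1))) (s n (suc N)) (s n N) (s m (suc N))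
        (c (suc N)) (c N) (coef m (suc N)) (ι (+ suc N + + suc N - + 1)) x (x ^ N) (+ n))
      where
      ident₁ : ∀ S A B D C b L i x X n → S + C * (x * X) * i
         - (- (A + C * (x * X)) - x * (B + b * X) - n * (A + C * (x * X) + + 2 * x * (B + b * X) - (D + L * (x * X))))
        ≡ + 1 * (S - (- A - x * B - n * (A + + 2 * x * B - D))) + x * X * (C * i - (- C - b - n * (C + + 2 * b - L)))
      ident₁ = solve-∀
    ident : ∀ v S c D L x X n →
      v - (- (+ 1 + x) * (S + c * X) - n * ((+ 1 + + 2 * x) * (S + c * X) - L) + (+ 1 + (n + n)) * c * (x * X))
      ≡ + 1 * (v - (- (S + c * X) - x * S - n * (S + c * X + + 2 * x * S - D))) + n * (D - L)
    ident = solve-∀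

-- Harmonic numbers and C(p-1,k) modulo p²

module Harmonic (m : ℕ) (pr : Prime (suc (suc m ℕ.+ suc m))) where

  open import Data.Integer using (_+_; _*_; _-_; -_; _^_)

  open OddPrime m pr public

  bin-n+k : ∀ k → k ≤ n → bin (n ℕ.+ k) k ≈ sgn k * bin n k [ P ]
  bin-n+k zero    _   = ≡⇒≈ refl
  bin-n+k (suc k) k<n = ≡⇒≈ (cong (λ z → bin z (suc k)) (ℕP.+-suc n k)) ⟫ cancel (+ suc k) (unit-≤n (s≤s z≤n) k<n)
    (lc4 (+ 1) (sgn k) (+ 1 + (+ n + + k)) (sgn k * bin n k)
      (≡⇒≈ (bin-absorb (n ℕ.+ k) k)) (≡⇒≈ (bin-upper n k)) (bin-n+k k (ℕP.<⇒≤ k<n)) P≈0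
      (ident (bin (suc (n ℕ.+ k)) (suc k)) (bin n (suc k)) (bin (n ℕ.+ k) k) (bin n k) (sgn k) (+ n) (+ k)))
    where
    ident : ∀ B B' b b' s n k → (+ 1 + k) * B - (+ 1 + k) * (- + 1 * s * B')
      ≡ + 1 * ((+ 1 + k) * B - (+ 1 + (n + k)) * b) + s * ((+ 1 + k) * B' - (n - k) * b')
        + (+ 1 + (n + k)) * (b - s * b') + s * b' * (+ 1 + (n + n) - + 0)
    ident = solve-∀

  c≈bin² : ∀ k → k ≤ n → c k ≈ sgn k * bin n k * bin n k [ P ]
  c≈bin² k k≤n = lc1 (bin n k) (bin-n+k k k≤n) (ident (bin n k) (bin (n ℕ.+ k) k) (sgn k))
    where
    ident : ∀ b B s → b * B - s * b * b ≡ b * (B - s * b)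
    ident = solve-∀

  H : ℕ → ℤ
  H k = ∑ k (λ i → ι (+ suc i))

  -- (-1)^k C(p-1,k) is the product of 1 - p/i over 1 ≤ i ≤ k.
  sgn*bin≈1-PH : ∀ k → k < p → sgn k * bin (n ℕ.+ n) k ≈ + 1 - P * H k [ P² ]
  sgn*bin≈1-PH zero    _   = ≡⇒≈ (ident P)
    where
    ident : ∀ P → + 1 * + 1 ≡ + 1 - P * + 0
    ident = solve-∀
  sgn*bin≈1-PH (suc k) k+1<p = cancel² (+ suc k) u
    (lc4 (- sgn k) (+ suc k - P) P (H k) (≡⇒≈ (bin-upper (n ℕ.+ n) k)) (sgn*bin≈1-PH k (ℕP.<-trans ℕP.≤-refl k+1<p))
      (ι-inverse u) (modulus≈0 (+ 1))
      (ident (sgn k) (bin (n ℕ.+ n) (suc k)) (bin (n ℕ.+ n) k) (H k) (ι (+ suc k)) (+ n) (+ k)))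
    where
    u : Unit (+ suc k)
    u = unit-pos (s≤s z≤n) k+1<p
    ident : ∀ s B b h i n k → let P = + 1 + (n + n) in
      (+ 1 + k) * (- + 1 * s * B) - (+ 1 + k) * (+ 1 - P * (h + i))
      ≡ - s * ((+ 1 + k) * B - (n + n - k) * b) + (+ 1 + k - P) * (s * b - (+ 1 - P * h))
        + P * ((+ 1 + k) * i - + 1) + h * (+ 1 * (P * P) - + 0)
    ident = solve-∀

  ι-* : ∀ a b → ι (a * b) ≡ ι a * ι b
  ι-* a b = ^-*-distrib a b (ℕ.pred ((n ℕ.+ n) ℕ.* p))

  ι-≈ : ∀ {a b} → a ≈ b [ P ] → ι a ≈ ι b [ P ]
  ι-≈ = ≈-^ (ℕ.pred ((n ℕ.+ n) ℕ.* p))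

  ι-inverse₁ : ∀ {a} → Unit a → a * ι a ≈ + 1 [ P ]
  ι-inverse₁ u = weaken² (ι-inverse u)

-- P_n(3) modulo p² for p = 4w + 1

module QuarterHarmonic (w' : ℕ) (pr : Prime (suc (suc (w' ℕ.+ suc w') ℕ.+ suc (w' ℕ.+ suc w')))) where

  open import Data.Integer using (_+_; _*_; _-_; -_; _^_)

  open Harmonic (w' ℕ.+ suc w') pr public

  w : ℕ
  w = suc w'

  w≤n : w ≤ n
  w≤n = ℕP.m≤m+n w w

  sgn-n : sgn n ≡ + 1
  sgn-n = sgn-+ w

  H-split : ∀ N → H (N ℕ.+ N) ≡ ∑ N (λ i → ι (+ suc (i ℕ.+ i)) + ι (+ suc (suc (i ℕ.+ i))))
  H-split zero    = refl
  H-split (suc N) = trans (cong (λ z → H (suc z)) (ℕP.+-suc N N))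
    (trans (ℤP.+-assoc (H (N ℕ.+ N)) (ι (+ suc (N ℕ.+ N))) (ι (+ suc (suc (N ℕ.+ N)))))
      (cong (_+ (ι (+ suc (N ℕ.+ N)) + ι (+ suc (suc (N ℕ.+ N))))) (H-split N)))

  -- 2i + 1 ≡ -2(2w - i) modulo 4w + 1, which moves the odd denominators up to n into the range from
  -- w + 1 to 2w.
  odd-even : ∀ i → i < w → + 2 * (ι (+ suc (i ℕ.+ i)) + ι (+ suc (suc (i ℕ.+ i)))) ≈ ι (+ suc i) - ι (+ suc (w ℕ.+ (w' ∸ i))) [ P ]
  odd-even i i<w = lc4 (+ 2) (ι (+ suc i)) (+ 2) (- ι (+ suc j)) (≡⇒≈ even) (ι-inverse₁ unit-2) odd (ι-inverse₁ (unit-neg unit-2))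
      (ident (ι (+ suc (i ℕ.+ i))) (ι (+ suc (suc (i ℕ.+ i)))) (ι (+ 2)) (ι (+ suc i)) (ι (- + 2)) (ι (+ suc j)))
    where
    j : ℕ
    j = w ℕ.+ (w' ∸ i)
    even : ι (+ suc (suc (i ℕ.+ i))) ≡ ι (+ 2) * ι (+ suc i)
    even = trans (cong ι (ident (+ i))) (ι-* (+ 2) (+ suc i))
      where
      ident : ∀ i → + 2 + (i + i) ≡ + 2 * (+ 1 + i)
      ident = solve-∀
    odd : ι (+ suc (i ℕ.+ i)) ≈ ι (- + 2) * ι (+ suc j) [ P ]
    odd = ι-≈ {a = + suc (i ℕ.+ i)} {b = - + 2 * + suc j} (lc2 (+ 1) (+ 2) P≈0 (≡⇒≈ (cong +_ (ℕP.m+[n∸m]≡n (ℕP.≤-pred i<w)))) (ident (+ w') (+ i) (+ (w' ∸ i))))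
          ⟫ ≡⇒≈ (ι-* (- + 2) (+ suc j))
      where
      ident : ∀ w i d → + 1 + (i + i) - - + 2 * (+ 1 + (+ 1 + w + d)) ≡ + 1 * (+ 1 + (+ 1 + (w + (+ 1 + w)) + (+ 1 + (w + (+ 1 + w)))) - + 0) + + 2 * (i + d - w)
      ident = solve-∀
    ident : ∀ o e t x f y → + 2 * (o + e) - (x - y) ≡ + 2 * (e - t * x) + x * (+ 2 * t - + 1) + + 2 * (o - f * y) + - y * (- + 2 * f - + 1)
    ident = solve-∀

  -- Splitting H_n by the parity of the denominators gives 2H_n ≡ H_w - (H_n - H_w). These are the
  -- classical values -2Q of H_n and -3Q of H_w, Q the Fermat quotient of 2, with Q eliminated.
  H-ratio : + 2 * H w ≈ + 3 * H n [ P ]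
  H-ratio = lc3 {a = + 2 * H n} {b = H w + - + 1 * ∑ w (λ i → ι (+ suc (w ℕ.+ (w' ∸ i))))} {a' = H n} {b' = H w + ∑ w (λ i → ι (+ suc (w ℕ.+ i)))}
      {a'' = ∑ w (λ i → ι (+ suc (w ℕ.+ i)))} {b'' = ∑ w (λ i → ι (+ suc (w ℕ.+ (w' ∸ i))))}
      (- + 1) (- + 1) (- + 1) paired (≡⇒≈ (∑-split w w (λ i → ι (+ suc i)))) (≡⇒≈ (∑-rev w' (λ i → ι (+ suc (w ℕ.+ i)))))
      (ident (H w) (H n) (∑ w (λ i → ι (+ suc (w ℕ.+ i)))) (∑ w (λ i → ι (+ suc (w ℕ.+ (w' ∸ i))))))
    where
    paired : + 2 * H n ≈ H w + - + 1 * ∑ w (λ i → ι (+ suc (w ℕ.+ (w' ∸ i)))) [ P ]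
    paired = ≡⇒≈ (trans (cong (+ 2 *_) (H-split w)) (sym (∑-*ˡ w (+ 2) (λ i → ι (+ suc (i ℕ.+ i)) + ι (+ suc (suc (i ℕ.+ i)))))))
      ⟫ ∑-≈ w (λ i i<w → odd-even i i<w ⟫ ≡⇒≈ (ident' (ι (+ suc i)) (ι (+ suc (w ℕ.+ (w' ∸ i))))))
      ⟫ ≡⇒≈ (trans (∑-+ w (λ i → ι (+ suc i)) (λ i → - + 1 * ι (+ suc (w ℕ.+ (w' ∸ i)))))
          (cong (λ z → H w + z) (∑-*ˡ w (- + 1) (λ i → ι (+ suc (w ℕ.+ (w' ∸ i)))))))
      where
      ident' : ∀ a b → a - b ≡ a + - + 1 * b
      ident' = solve-∀
    ident : ∀ a b d r → + 2 * a - + 3 * b ≡ - + 1 * (+ 2 * b - (a + - + 1 * r)) + - + 1 * (b - (a + d)) + - + 1 * (d - r)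
    ident = solve-∀

  t⁴ : central n ≈ t * t * (t * t) [ P² ]
  t⁴ = central-n ⟫ ≡⇒≈ (trans (cong (_* (t * t * (t * t))) sgn-n) (ℤP.*-identityˡ (t * t * (t * t))))

  -- t² = 2^(p-1) differs from 1 by a multiple of p, so the square of the difference vanishes.
  r : ℤ
  r = t * t - + 1

  r≈0 : r ≈ + 0 [ P ]
  r≈0 = difference≈0 t²≈1

  r²≈0 : r * r ≈ + 0 [ P² ]
  r²≈0 = ≈0² r≈0 r≈0

  -- 1 - p H_n ≡ t⁴ ≡ 1 + 2r, and by `H-ratio` the correction at w is 3/2 times the one at n.
  e-w : sgn w * bin (n ℕ.+ n) w ≈ + 1 + + 3 * r [ P² ]
  e-w = cancel² (+ 2) unit-2 (lc4 (+ 2) (- + 1) (- + 3) (+ 3)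
      (sgn*bin≈1-PH w (ℕP.≤-<-trans w≤n n<p))
      (scale P H-ratio)
      (sgn*bin≈1-PH n n<p) (≡⇒≈ (cong (_* central n) sgn-n) ⟫ ≡⇒≈ (ℤP.*-identityˡ (central n)) ⟫ t⁴)
      (ident (sgn w * bin (n ℕ.+ n) w) (sgn n * central n) (H w) (H n) t P)
    ⟫ lc1 (+ 3) r²≈0 (ident' t))
    where
    ident : ∀ e E hw hn t P → + 2 * e - (+ 3 * (t * t * (t * t)) - + 1)
      ≡ + 2 * (e - (+ 1 - P * hw)) + - + 1 * (P * (+ 2 * hw) - P * (+ 3 * hn)) + - + 3 * (E - (+ 1 - P * hn)) + + 3 * (E - t * t * (t * t))
    ident = solve-∀
    ident' : ∀ t → + 3 * (t * t * (t * t)) - + 1 - + 2 * (+ 1 + + 3 * (t * t - + 1)) ≡ + 3 * ((t * t - + 1) * (t * t - + 1) - + 0)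
    ident' = solve-∀

  U : ℤ
  U = sgn w * central w

  multiset-w : multiset n w * (+ 1 + + 3 * r) ≈ U * (+ 1 + + 2 * r) [ P² ]
  multiset-w = lc4 (- multiset n w) (sgn w) U U e-w (≡⇒≈ (bin-chain n w w refl)) t⁴ r²≈0
      (ident (multiset n w) (bin (n ℕ.+ n) w) (central w) (central n) (sgn w) t)
    where
    ident : ∀ X b B Z s t → let r = t * t - + 1 ; U = s * B in
      X * (+ 1 + + 3 * r) - U * (+ 1 + + 2 * r) ≡ - X * (s * b - (+ 1 + + 3 * r)) + s * (X * b - B * Z) + U * (Z - t * t * (t * t)) + U * (r * r - + 0)
    ident = solve-∀

  D : ℤ
  D = ∑ (suc n) c

  -- The product of the two multiset coefficients is c k up to a first-order term in p, opposite to the one in c (n ∸ k).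
  pointwise : ∀ k → k ≤ n → central n * (c k + c (n ∸ k))
    ≈ central n * central n * (sgn k * bin n k * bin n (n ∸ k)) + sgn k * multiset n k * multiset n (n ∸ k) [ P² ]
  pointwise k k≤n = cancel² b₄ (unit-*ʳ (sgn k) (unit-≈ (≈-sym e≈1) unit-1))
     (≡⇒≈ (cong₂ (λ u v → b₄ * (Z * (u + v))) (cong (B *_) (sym (bin-sym n k))) (cong₂ _*_ (sym B-sym) (sym (bin-sym n j))))
      ⟫ lc3 (Z * B - sgn k * Y) (Z * B * sgn k) (Z * B * (- (b₄ * Y) + B * Z * (sgn k * b₄ - + 1)))
          (≡⇒≈ (bin-chain n k j (sym k+j))) product (≡⇒≈ (sgn² k)) (ident B Z X Y b₄ (sgn k))
      ⟫ ≡⇒≈ (cong (λ z → b₄ * (Z * Z * (sgn k * B * z) + sgn k * Y * X)) B-sym))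
    where
    j : ℕ
    j = n ∸ k
    k+j : k ℕ.+ j ≡ n
    k+j = ℕP.m+[n∸m]≡n k≤n
    B Z X Y b₄ : ℤ
    B = bin n k
    Z = central n
    X = multiset n j
    Y = multiset n k
    b₄ = bin (n ℕ.+ n) k
    B-sym : B ≡ bin n j
    B-sym = subst (λ z → bin z k ≡ bin z j) k+j (bin-sym k j)
    e≈1 : sgn k * b₄ ≈ + 1 [ P ]
    e≈1 = sgn*bin≈1 k (ℕP.≤-<-trans k≤n n<p)
    product : (sgn k * b₄ - + 1) * (Y - sgn k * B * Z) ≈ + 0 [ P² ]
    product = ≈0² {a = sgn k * b₄ - + 1} {b = Y - sgn k * B * Z} (difference≈0 e≈1)
      (lc4 (+ 1) (+ 1) (- (sgn k * B)) (- (sgn k * B) * (t * t + + 1)) (≡⇒≈ (bin-sym n k)) (bin-n+k k k≤n) (weaken² t⁴) t²≈1 (ident₂ Y (bin (n ℕ.+ k) k) (sgn k) B Z t))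
      where
      ident₂ : ∀ Y Y' s B Z t → Y - s * B * Z - + 0 ≡ + 1 * (Y - Y') + + 1 * (Y' - s * B) + - (s * B) * (Z - t * t * (t * t)) + - (s * B) * (t * t + + 1) * (t * t - + 1)
      ident₂ = solve-∀
    ident : ∀ B Z X Y b s → b * (Z * (B * Y + B * X)) - b * (Z * Z * (s * B * B) + s * Y * X)
      ≡ (Z * B - s * Y) * (X * b - B * Z) + Z * B * s * ((s * b - + 1) * (Y - s * B * Z) - + 0) + Z * B * (- (b * Y) + B * Z * (s * b - + 1)) * (s * s - + 1)
    ident = solve-∀

  -- Reversing the sum pairs k with n - k. The summands then form the coefficients of X^n, n = 2w,
  -- in (1 - X²)^n and in (1 - X²)^-(n+1).
  D-sum : central n * (+ 2 * D) ≈ central n * central n * U + multiset n w [ P² ]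
  D-sum = ≡⇒≈ (begin
      Z * (+ 2 * D)                                        ≡⟨ ident Z D ⟩
      Z * (D + D)                                          ≡⟨ cong (λ z → Z * (D + z)) (∑-rev n c) ⟩
      Z * (D + ∑ (suc n) (λ k → c (n ∸ k)))              ≡⟨ cong (Z *_) (∑-+ (suc n) c (λ k → c (n ∸ k))) ⟨
      Z * ∑ (suc n) (λ k → c k + c (n ∸ k))              ≡⟨ ∑-*ˡ (suc n) Z (λ k → c k + c (n ∸ k)) ⟨
      ∑ (suc n) (λ k → Z * (c k + c (n ∸ k)))            ∎)
    ⟫ ∑-≈ (suc n) (λ k k<n → pointwise k (ℕP.≤-pred k<n))
    ⟫ ≡⇒≈ (begin
      ∑ (suc n) (λ k → Z * Z * f k + g k)                  ≡⟨ ∑-+ (suc n) (λ k → Z * Z * f k) g ⟩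
      ∑ (suc n) (λ k → Z * Z * f k) + ∑ (suc n) g          ≡⟨ cong₂ _+_ (∑-*ˡ (suc n) (Z * Z) f) (multiset-alternating n w) ⟩
      Z * Z * ∑ (suc n) f + multiset n w                   ≡⟨ cong (λ z → Z * Z * z + multiset n w) (bin-alternating n w) ⟩
      Z * Z * U + multiset n w                             ∎)
    where
    open ≡-Reasoning
    Z : ℤ
    Z = central n
    f g : ℕ → ℤ
    f k = sgn k * bin n k * bin n (n ∸ k)
    g k = sgn k * multiset n k * multiset n (n ∸ k)
    ident : ∀ Z D → Z * (+ 2 * D) ≡ Z * (D + D)
    ident = solve-∀

  unit-1+ : ∀ j → Unit (+ 1 + j * r)
  unit-1+ j = unit-≈ (lc1 (- j) r≈0 (ident j r)) unit-1
    where
    ident : ∀ j r → + 1 - (+ 1 + j * r) ≡ - j * (r - + 0)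
    ident = solve-∀

  D-value : D * (+ 2 + r) ≈ + 2 * U [ P² ]
  -- 1 + 5r is (1 + 2r)(1 + 3r) modulo r²: the first factor is `central n`, the second clears the
  -- denominator of `multiset n w`.
  D-value = cancel² (+ 2 * (+ 1 + + 5 * r)) (unit-* unit-2 (unit-1+ (+ 5)))
    (lc4 ((+ 1 + + 3 * r) * (+ 2 + r)) (- ((+ 1 + + 3 * r) * (+ 2 + r) * (+ 2 * D - (central n + t * t * (t * t)) * U))) (+ 2 + r)
      (U * (+ 45 + + 62 * r + + 48 * r * r + + 19 * r * r * r + + 3 * r * r * r * r) - D * (+ 2 + r) * (+ 14 + + 6 * r))
      D-sum t⁴ multiset-w r²≈0 (ident D U (multiset n w) (central n) t))
    where
    ident : ∀ D U X Z t → let r = t * t - + 1 in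
      + 2 * (+ 1 + + 5 * r) * (D * (+ 2 + r)) - + 2 * (+ 1 + + 5 * r) * (+ 2 * U)
      ≡ (+ 1 + + 3 * r) * (+ 2 + r) * (Z * (+ 2 * D) - (Z * Z * U + X))
        + - ((+ 1 + + 3 * r) * (+ 2 + r) * (+ 2 * D - (Z + t * t * (t * t)) * U)) * (Z - t * t * (t * t))
        + (+ 2 + r) * (X * (+ 1 + + 3 * r) - U * (+ 1 + + 2 * r))
        + (U * (+ 45 + + 62 * r + + 48 * r * r + + 19 * r * r * r + + 3 * r * r * r * r) - D * (+ 2 + r) * (+ 14 + + 6 * r)) * (r * r - + 0)
    ident = solve-∀

-- Jacobsthal sums as power sums of Teichmüller representatives

module Jacobsthal (w' : ℕ) (pr : Prime (suc (suc (w' ℕ.+ suc w') ℕ.+ suc (w' ℕ.+ suc w')))) where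

  open import Data.Integer using (_+_; _*_; _-_; -_; _^_)

  open QuarterHarmonic w' pr public

  q : ℕ
  q = n ℕ.+ n

  -- Euler's criterion serves as the definition, so that `φ` enters congruences directly through
  -- v^n.
  data IsLegendre (v : ℤ) : ℤ → Set where
    residue⁺  : v ^ n ≈ + 1 [ P ] → IsLegendre v (+ 1)
    residue⁻  : v ^ n ≈ - + 1 [ P ] → IsLegendre v (- + 1)
    residue⁰  : v ≈ + 0 [ P ] → IsLegendre v (+ 0)

  euler : ∀ {v} → Unit v → v ^ n ≈ + 1 [ P ] ⊎ v ^ n ≈ - + 1 [ P ]
  euler {v} u = square≈1 (≡⇒≈ (sym (ℤP.^-distribˡ-+-* v n n)) ⟫ fermat u)

  legendreSymbol : ∀ v → ∃ (IsLegendre v)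
  legendreSymbol v = decide (v ≈? + 0)
    where
    decide : Dec (v ≈ + 0 [ P ]) → ∃ (IsLegendre v)
    decide (yes z) = + 0 , residue⁰ z
    decide (no u)  = [ (λ h → + 1 , residue⁺ h) , (λ h → - + 1 , residue⁻ h) ]′ (euler u)

  φ : ℤ → ℤ
  φ v = proj₁ (legendreSymbol v)

  -- 3Y - Y³ has critical points at Y = ±1, so it turns v^n into ±1 modulo p².
  cubic : ℤ → ℤ
  cubic y = + 3 * y - y * (y * y)

  -- An error of order p in Y = v'^n enters `cubic` only quadratically, so `v'` may be any
  -- representative of the residue of `v`. In the zero case n = 2w with w > 0 makes Y a product of
  -- two multiples of p.
  legendre-cubic : ∀ {v e} v' → IsLegendre v e → v ≈ v' [ P ] → + 2 * e ≈ cubic (v' ^ n) [ P² ]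
  legendre-cubic {v} v' (residue⁺ h) vv = lc1 (Y + + 2) (≈0² {a = Y - + 1} {b = Y - + 1} z z) (ident Y)
    where
    Y : ℤ
    Y = v' ^ n
    z : Y - + 1 ≈ + 0 [ P ]
    z = difference≈0 (≈-^ n (≈-sym vv) ⟫ h)
    ident : ∀ Y → + 2 * + 1 - (+ 3 * Y - Y * (Y * Y)) ≡ (Y + + 2) * ((Y - + 1) * (Y - + 1) - + 0)
    ident = solve-∀
  legendre-cubic {v} v' (residue⁻ h) vv = lc1 (Y - + 2) (≈0² {a = Y + + 1} {b = Y + + 1} z z) (ident Y)
    where
    Y : ℤ
    Y = v' ^ n
    z : Y + + 1 ≈ + 0 [ P ]
    z = difference≈0 (≈-^ n (≈-sym vv) ⟫ h)
    ident : ∀ Y → + 2 * - + 1 - (+ 3 * Y - Y * (Y * Y)) ≡ (Y - + 2) * ((Y + + 1) * (Y + + 1) - + 0)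
    ident = solve-∀
  legendre-cubic {v} v' (residue⁰ h) vv = lc1 (- (+ 3 - Y * Y)) (≡⇒≈ (ℤP.^-distribˡ-+-* v' w w) ⟫ ≈0² z z) (ident Y)
    where
    Y : ℤ
    Y = v' ^ n
    z : v' ^ w ≈ + 0 [ P ]
    z = ≈-^ w (≈-sym vv ⟫ h)
    ident : ∀ Y → + 2 * + 0 - (+ 3 * Y - Y * (Y * Y)) ≡ - (+ 3 - Y * Y) * (Y - + 0)
    ident = solve-∀

  τ : ℕ → ℤ
  τ s = (+ s) ^ p

  -- Half of the Jacobsthal sum of s³ - ks: this cubic is odd in s and -1 is a square modulo p, so s
  -- and -s contribute equally.
  h : ℤ → ℤ
  h k = ∑ n (λ i → φ (+ suc i * (+ suc i * + suc i - k)))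

  base : ℤ → ℕ → ℤ
  base κ s = τ s * (τ s * τ s - κ)

  F : ℤ → ℕ → ℤ
  F κ s = cubic (base κ s ^ n)

  F-0 : ∀ κ → F κ 0 ≡ + 0
  F-0 κ = cong cubic (trans (cong (_^ n) base-0) (0^ n (s≤s z≤n)))
    where
    base-0 : base κ 0 ≡ + 0
    base-0 = trans (cong (λ z → z * (z * z - κ)) (0^ p (s≤s z≤n))) (ℤP.*-zeroˡ (+ 0 * + 0 - κ))

  even-power : ∀ a → (- a) ^ n ≡ a ^ n
  even-power a = trans (cong (_^ n) (ident a)) (trans (^-*-distrib (- + 1) a n) (trans (cong (_* a ^ n) sgn-n) (ℤP.*-identityˡ (a ^ n))))
    where
    ident : ∀ a → - a ≡ - + 1 * a
    ident = solve-∀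

  F-reflect : ∀ κ i → i < n → F κ (suc (n ℕ.+ i)) ≈ F κ (n ∸ i) [ P² ]
  F-reflect κ i i<n = ≈-cubic (≈-^ n (≈-* τ-reflect (≈-+ (≈-* τ-reflect τ-reflect) (≈-refl { - κ })) ⟫ ≡⇒≈ (ident (τ (n ∸ i)) κ))
      ⟫ ≡⇒≈ (even-power (base κ (n ∸ i))))
    where
    ≈-cubic : ∀ {a b} → a ≈ b [ P² ] → cubic a ≈ cubic b [ P² ]
    ≈-cubic h = ≈-+ (≈-*ˡ (+ 3) h) (≈-neg (≈-* h (≈-* h h)))
    τ-reflect : τ (suc (n ℕ.+ i)) ≈ - τ (n ∸ i) [ P² ]
    τ-reflect = lift {a = + suc (n ℕ.+ i)} {b = - + (n ∸ i)} (lc2 (+ 1) (+ 1) P≈0 (≡⇒≈ (cong +_ (ℕP.m+[n∸m]≡n (ℕP.<⇒≤ i<n)))) (ident' (+ n) (+ i) (+ (n ∸ i))))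
      ⟫ ≡⇒≈ (trans (cong (_^ p) (ident″ (+ (n ∸ i)))) (trans (^-*-distrib (- + 1) (+ (n ∸ i)) p)
          (trans (cong (λ z → - + 1 * z * τ (n ∸ i)) (sgn-+ n)) (ident‴ (τ (n ∸ i))))))
      where
      ident' : ∀ n i d → + 1 + (n + i) - - d ≡ + 1 * (+ 1 + (n + n) - + 0) + + 1 * (i + d - n)
      ident' = solve-∀
      ident″ : ∀ a → - a ≡ - + 1 * a
      ident″ = solve-∀
      ident‴ : ∀ a → - + 1 * + 1 * a ≡ - a
      ident‴ = solve-∀
    ident : ∀ t κ → - t * (- t * - t + - κ) ≡ - (t * (t * t - κ))
    ident = solve-∀

  -- One factor 2 comes from `cubic`, the other from the symmetry s ↦ p - s. Working with τ s
  -- instead of s makes the right side a combination of the power sums `ps`.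
  4h≈∑F : ∀ k κ → k ≈ κ [ P ] → + 4 * h k ≈ ∑ p (F κ) [ P² ]
  4h≈∑F k κ kκ = lc3 {a = + 2 * h k} {b = half} {a' = ∑ p (F κ)} {b' = F κ 0 + (half + other)} {a'' = other} {b'' = half} (+ 2) (- + 1) (- + 1)
     one (≡⇒≈ (trans (∑-first (n ℕ.+ n) (F κ)) (cong (λ z → F κ 0 + z) (∑-split n n (F κ ∘ suc)))))
     two
     (trans (cong (λ z → + 4 * h k - z) (sym (ℤP.+-identityʳ (∑ p (F κ)))))
       (trans (cong (λ z → + 4 * h k - (∑ p (F κ) + z)) (sym (F-0 κ))) (ident (h k) half other (∑ p (F κ)) (F κ 0) (F-0 κ))))
    where
    half other : ℤ
    half = ∑ n (λ i → F κ (suc i))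
    other = ∑ n (λ i → F κ (suc (n ℕ.+ i)))
    one : + 2 * h k ≈ half [ P² ]
    one = ≡⇒≈ (sym (∑-*ˡ n (+ 2) (λ i → φ (+ suc i * (+ suc i * + suc i - k)))))
      ⟫ ∑-≈ n (λ i _ → legendre-cubic (base κ (suc i)) (proj₂ (legendreSymbol (+ suc i * (+ suc i * + suc i - k)))) (reduce-base i))
      where
      reduce-base : ∀ i → + suc i * (+ suc i * + suc i - k) ≈ base κ (suc i) [ P ]
      reduce-base i = ≈-* f (≈-+ (≈-* f f) (≈-neg kκ))
        where
        f : + suc i ≈ τ (suc i) [ P ]
        f = ≈-sym (fermat-ℕ (suc i))
    two : other ≈ half [ P² ]
    two = ∑-≈ n (λ i i<n → F-reflect κ i i<n) ⟫ ≡⇒≈ (trans (∑-cong n (λ i i<n → cong (F κ) (ℕP.+-∸-assoc 1 (ℕP.≤-pred i<n)))) (sym (∑-rev m (λ i → F κ (suc i)))))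
      where
      m : ℕ
      m = w' ℕ.+ suc w'
    ident : ∀ H A B S z → z ≡ + 0 → + 4 * H - (S + z) ≡ + 2 * (+ 2 * H - A) + - + 1 * (S - (z + (A + B))) + - + 1 * (B - A)
    ident H A B S _ refl = ident' H A B S
      where
      ident' : ∀ H A B S → + 4 * H - (S + + 0) ≡ + 2 * (+ 2 * H - A) + - + 1 * (S - (+ 0 + (A + B))) + - + 1 * (B - A)
      ident' = solve-∀

  ps : ℕ → ℤ
  ps e = ∑ p (λ s → τ s ^ e)

  ∑-base^ : ∀ κ N → ∑ p (λ s → base κ s ^ N) ≡ ∑ (suc N) (λ j → bin N j * (- κ) ^ (N ∸ j) * ps (N ℕ.+ (j ℕ.+ j)))
  ∑-base^ κ N = begin
    ∑ p (λ s → base κ s ^ N)                                 ≡⟨ ∑-cong p (λ s _ → expand (τ s)) ⟩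
    ∑ p (λ s → ∑ (suc N) (λ j → a j * τ s ^ (N ℕ.+ (j ℕ.+ j)))) ≡⟨ ∑-swap p (suc N) (λ s j → a j * τ s ^ (N ℕ.+ (j ℕ.+ j))) ⟩
    ∑ (suc N) (λ j → ∑ p (λ s → a j * τ s ^ (N ℕ.+ (j ℕ.+ j)))) ≡⟨ ∑-cong (suc N) (λ j _ → ∑-*ˡ p (a j) (λ s → τ s ^ (N ℕ.+ (j ℕ.+ j)))) ⟩
    ∑ (suc N) (λ j → a j * ps (N ℕ.+ (j ℕ.+ j)))             ∎
    where
    open ≡-Reasoning
    a : ℕ → ℤ
    a j = bin N j * (- κ) ^ (N ∸ j)
    expand : ∀ x → (x * (x * x - κ)) ^ N ≡ ∑ (suc N) (λ j → a j * x ^ (N ℕ.+ (j ℕ.+ j)))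
    expand x = begin
      (x * (x * x - κ)) ^ N
        ≡⟨ ^-*-distrib x (x * x - κ) N ⟩
      x ^ N * (x * x - κ) ^ N
        ≡⟨ cong (x ^ N *_) (binomial (x * x) (- κ) N) ⟩
      x ^ N * ∑ (suc N) (λ j → bin N j * ((x * x) ^ j * (- κ) ^ (N ∸ j)))
        ≡⟨ ∑-*ˡ (suc N) (x ^ N) (λ j → bin N j * ((x * x) ^ j * (- κ) ^ (N ∸ j))) ⟨
      ∑ (suc N) (λ j → x ^ N * (bin N j * ((x * x) ^ j * (- κ) ^ (N ∸ j))))
        ≡⟨ ∑-cong (suc N) (λ j _ → trans (cong (λ z → x ^ N * (bin N j * (z * (- κ) ^ (N ∸ j)))) (trans (^-*-distrib x x j) (sym (ℤP.^-distribˡ-+-* x j j))))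
             (trans (ident (x ^ N) (bin N j) (x ^ (j ℕ.+ j)) ((- κ) ^ (N ∸ j))) (cong (a j *_) (sym (ℤP.^-distribˡ-+-* x N (j ℕ.+ j)))))) ⟩
      ∑ (suc N) (λ j → a j * x ^ (N ℕ.+ (j ℕ.+ j))) ∎
      where
      ident : ∀ X b Y K → X * (b * (Y * K)) ≡ b * K * (X * Y)
      ident = solve-∀

  -- Among the exponents n + 2i with 0 ≤ i < n only n + 2w = p - 1 is divisible by p - 1. For i > w
  -- one p - 1 is split off and counted in the multiple of q.
  ps-zero : ∀ i b → i < n → i ≢ w → ps (n ℕ.+ (i ℕ.+ i) ℕ.+ q ℕ.* b) ≈ + 0 [ P² ]
  ps-zero i b i<n i≢w with ℕP.<-cmp i w
  ... | tri< i<w _ _ = ∑-teichmüller≈0 (n ℕ.+ (i ℕ.+ i)) (s≤s z≤n) (ℕP.+-monoʳ-< n (ℕP.+-mono-< i<w i<w)) b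
  ... | tri≈ _ i≡w _ = ⊥-elim (i≢w i≡w)
  ... | tri> _ _ w<i = subst (λ z → ps z ≈ + 0 [ P² ]) exponent (∑-teichmüller≈0 (d ℕ.+ d) (ℕP.+-mono-< {0} {d} {0} {d} 0<d 0<d) (ℕP.<-≤-trans (ℕP.+-mono-< d<w d<w) (ℕP.m≤m+n n n)) (suc b))
    where
    d : ℕ
    d = i ∸ w
    w+d : w ℕ.+ d ≡ i
    w+d = ℕP.m+[n∸m]≡n (ℕP.<⇒≤ w<i)
    0<d : 0 < d
    0<d = ℕP.m<n⇒0<n∸m w<i
    d<w : d < w
    d<w = ℕP.+-cancelˡ-< w d w (subst (_< n) (sym w+d) i<n)
    exponent : d ℕ.+ d ℕ.+ q ℕ.* suc b ≡ n ℕ.+ (i ℕ.+ i) ℕ.+ q ℕ.* b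
    exponent = trans (ident w d b) (cong (λ z → n ℕ.+ (z ℕ.+ z) ℕ.+ q ℕ.* b) w+d)
      where
      ident : ∀ w d b → d ℕ.+ d ℕ.+ (w ℕ.+ w ℕ.+ (w ℕ.+ w)) ℕ.* suc b ≡ w ℕ.+ w ℕ.+ (w ℕ.+ d ℕ.+ (w ℕ.+ d)) ℕ.+ (w ℕ.+ w ℕ.+ (w ℕ.+ w)) ℕ.* b
      ident = ℕ-solve-∀

  block : ∀ (a : ℕ → ℤ) b → ∑ n (λ i → a i * ps (n ℕ.+ (i ℕ.+ i) ℕ.+ q ℕ.* b)) ≈ a w * + q [ P² ]
  block a b = ∑-single n w (ℕP.m<m+n w (s≤s z≤n)) (λ i i<n i≢w → ≈-*ˡ (a i) (ps-zero i b i<n i≢w) ⟫ ≡⇒≈ (ℤP.*-zeroʳ (a i)))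
    ⟫ ≈-*ˡ (a w) (≡⇒≈ (cong ps (sym (ℕP.*-suc q b))) ⟫ ∑-teichmüller-full b)

  end-block : ∀ a b → a * ps (n ℕ.+ q ℕ.* b) ≈ + 0 [ P² ]
  end-block a b = ≈-*ˡ a (≡⇒≈ (cong (λ z → ps (z ℕ.+ q ℕ.* b)) (sym (ℕP.+-identityʳ n))) ⟫ ps-zero 0 b (s≤s z≤n) (λ ())) ⟫ ≡⇒≈ (ℤP.*-zeroʳ a)

-- The binomials C(3n,j) and the half sums modulo p²

module JacobsthalValues (w' : ℕ) (pr : Prime (suc (suc (w' ℕ.+ suc w') ℕ.+ suc (w' ℕ.+ suc w')))) where

  open import Data.Integer using (_+_; _*_; _-_; -_; _^_)

  open Jacobsthal w' pr public

  N : ℕ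
  N = n ℕ.+ (n ℕ.+ n)

  b₁ B₁ B₃ : ℤ
  b₁ = central w
  B₁ = bin N w
  B₃ = bin N (n ℕ.+ w)

  S-n : ∀ κ → ∑ p (λ s → base κ s ^ n) ≈ b₁ * (- κ) ^ w * + q [ P² ]
  S-n κ = ≡⇒≈ (∑-base^ κ n)
    ⟫ ≈-+ (≡⇒≈ (∑-cong n (λ i _ → cong (λ z → a i * ps z) (trans (sym (ℕP.+-identityʳ (n ℕ.+ (i ℕ.+ i)))) (cong (n ℕ.+ (i ℕ.+ i) ℕ.+_) (sym (ℕP.*-zeroʳ q)))))) ⟫ block a 0)
          (≡⇒≈ (cong (λ z → a n * ps (n ℕ.+ z)) (sym (ℕP.*-identityʳ q))) ⟫ end-block (a n) 1)
    ⟫ ≡⇒≈ (trans (ℤP.+-identityʳ (a w * + q)) (cong (λ z → b₁ * (- κ) ^ z * + q) (ℕP.m+n∸m≡n w w)))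
    where
    a : ℕ → ℤ
    a j = bin n j * (- κ) ^ (n ∸ j)

  -- The 3n + 1 terms form three blocks, of which j = w, 3w, 5w survive, and one end term that
  -- vanishes. The coefficient B₁ appears twice because C(6w,5w) = C(6w,w).
  S-N : ∀ κ → let y = (- κ) ^ w ; k = (- κ) ^ n in
    ∑ p (λ s → base κ s ^ N) ≈ (B₁ * (y * (k * k)) + B₃ * (k * y) + B₁ * y) * + q [ P² ]
  S-N κ = ≡⇒≈ (trans (∑-base^ κ N) (cong (_+ g N) (trans (∑-split n (n ℕ.+ n) g) (cong (λ z → ∑ n g + z) (∑-split n n (λ i → g (n ℕ.+ i)))))))
    ⟫ ≈-+ (≈-+ (piece (λ i → i) 1 (λ i → ident₁ n i)) (≈-+ (piece (n ℕ.+_) 2 (λ i → ident₂ n i)) (piece (λ i → n ℕ.+ (n ℕ.+ i)) 3 (λ i → ident₃ n i))))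
        (≡⇒≈ (cong (λ z → a N * ps z) (ident₄ n)) ⟫ end-block (a N) 4)
    ⟫ ≡⇒≈ (trans (cong₂ (λ u v → u * + q + (v * + q + a (n ℕ.+ (n ℕ.+ w)) * + q) + + 0) a₁ a₃)
        (trans (cong (λ z → B₁ * (y * (k * k)) * + q + (B₃ * (k * y) * + q + z * + q) + + 0) a₅) (ident (B₁ * (y * (k * k))) (B₃ * (k * y)) (B₁ * y) (+ q))))
    where
    y k : ℤ
    y = (- κ) ^ w
    k = (- κ) ^ n
    a : ℕ → ℤ
    a j = bin N j * (- κ) ^ (N ∸ j)
    g : ℕ → ℤ
    g j = a j * ps (N ℕ.+ (j ℕ.+ j))
    piece : ∀ (f : ℕ → ℕ) b → (∀ i → N ℕ.+ (f i ℕ.+ f i) ≡ n ℕ.+ (i ℕ.+ i) ℕ.+ q ℕ.* b) → ∑ n (λ i → g (f i)) ≈ a (f w) * + q [ P² ]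
    piece f b e = ≡⇒≈ (∑-cong n (λ i _ → cong (λ z → a (f i) * ps z) (e i))) ⟫ block (a ∘ f) b
    ident₁ : ∀ n i → n ℕ.+ (n ℕ.+ n) ℕ.+ (i ℕ.+ i) ≡ n ℕ.+ (i ℕ.+ i) ℕ.+ (n ℕ.+ n) ℕ.* 1
    ident₁ = ℕ-solve-∀
    ident₂ : ∀ n i → n ℕ.+ (n ℕ.+ n) ℕ.+ (n ℕ.+ i ℕ.+ (n ℕ.+ i)) ≡ n ℕ.+ (i ℕ.+ i) ℕ.+ (n ℕ.+ n) ℕ.* 2
    ident₂ = ℕ-solve-∀
    ident₃ : ∀ n i → n ℕ.+ (n ℕ.+ n) ℕ.+ (n ℕ.+ (n ℕ.+ i) ℕ.+ (n ℕ.+ (n ℕ.+ i))) ≡ n ℕ.+ (i ℕ.+ i) ℕ.+ (n ℕ.+ n) ℕ.* 3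
    ident₃ = ℕ-solve-∀
    ident₄ : ∀ n → n ℕ.+ (n ℕ.+ n) ℕ.+ (n ℕ.+ (n ℕ.+ n) ℕ.+ (n ℕ.+ (n ℕ.+ n))) ≡ n ℕ.+ (n ℕ.+ n) ℕ.* 4
    ident₄ = ℕ-solve-∀
    exponent : ∀ j e → N ≡ j ℕ.+ e → N ∸ j ≡ e
    exponent j e eq = trans (cong (_∸ j) eq) (ℕP.m+n∸m≡n j e)
    a₁ : a w ≡ B₁ * (y * (k * k))
    a₁ = cong (B₁ *_) (trans (cong ((- κ) ^_) (exponent w (w ℕ.+ (n ℕ.+ n)) (ℕP.+-assoc w w (n ℕ.+ n))))
      (trans (ℤP.^-distribˡ-+-* (- κ) w (n ℕ.+ n)) (cong (y *_) (ℤP.^-distribˡ-+-* (- κ) n n))))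
    a₃ : a (n ℕ.+ w) ≡ B₃ * (k * y)
    a₃ = cong (B₃ *_) (trans (cong ((- κ) ^_) (exponent (n ℕ.+ w) (n ℕ.+ w) (e w))) (ℤP.^-distribˡ-+-* (- κ) n w))
      where
      e : ∀ w → w ℕ.+ w ℕ.+ (w ℕ.+ w ℕ.+ (w ℕ.+ w)) ≡ w ℕ.+ w ℕ.+ w ℕ.+ (w ℕ.+ w ℕ.+ w)
      e = ℕ-solve-∀
    a₅ : a (n ℕ.+ (n ℕ.+ w)) ≡ B₁ * y
    a₅ = cong₂ _*_ (trans (cong (λ z → bin z (n ℕ.+ (n ℕ.+ w))) (e' w)) (trans (sym (bin-sym w (n ℕ.+ (n ℕ.+ w)))) (cong (λ z → bin z w) (sym (e' w)))))
      (cong ((- κ) ^_) (exponent (n ℕ.+ (n ℕ.+ w)) w (e w)))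
      where
      e : ∀ w → w ℕ.+ w ℕ.+ (w ℕ.+ w ℕ.+ (w ℕ.+ w)) ≡ w ℕ.+ w ℕ.+ (w ℕ.+ w ℕ.+ w) ℕ.+ w
      e = ℕ-solve-∀
      e' : ∀ w → w ℕ.+ w ℕ.+ (w ℕ.+ w ℕ.+ (w ℕ.+ w)) ≡ w ℕ.+ (w ℕ.+ w ℕ.+ (w ℕ.+ w ℕ.+ w))
      e' = ℕ-solve-∀
    ident : ∀ a b c q → a * q + (b * q + c * q) + + 0 ≡ (a + b + c) * q
    ident = solve-∀

  4h-value : ∀ k₀ κ → k₀ ≈ κ [ P ] → let y = (- κ) ^ w ; k = (- κ) ^ n in
    + 4 * h k₀ ≈ (+ 3 * (b₁ * y) - (B₁ * (y * (k * k)) + B₃ * (k * y) + B₁ * y)) * + q [ P² ]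
  4h-value k₀ κ e = 4h≈∑F k₀ κ e
    ⟫ ≡⇒≈ (trans (∑-cong p (λ s _ → cong (λ z → + 3 * base κ s ^ n + z) (trans (ident (base κ s ^ n)) (cong (- + 1 *_) (sym (cube (base κ s)))))))
        (trans (∑-+ p (λ s → + 3 * base κ s ^ n) (λ s → - + 1 * base κ s ^ N))
          (cong₂ _+_ (∑-*ˡ p (+ 3) (λ s → base κ s ^ n)) (∑-*ˡ p (- + 1) (λ s → base κ s ^ N)))))
    ⟫ ≈-+ (≈-*ˡ (+ 3) (S-n κ)) (≈-*ˡ (- + 1) (S-N κ))
    ⟫ ≡⇒≈ (ident' (b₁ * (- κ) ^ w) (B₁ * ((- κ) ^ w * ((- κ) ^ n * (- κ) ^ n)) + B₃ * ((- κ) ^ n * (- κ) ^ w) + B₁ * (- κ) ^ w) (+ q))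
    where
    cube : ∀ x → x ^ N ≡ x ^ n * (x ^ n * x ^ n)
    cube x = trans (ℤP.^-distribˡ-+-* x n (n ℕ.+ n)) (cong (x ^ n *_) (ℤP.^-distribˡ-+-* x n n))
    ident : ∀ Y → - (Y * (Y * Y)) ≡ - + 1 * (Y * (Y * Y))
    ident = solve-∀
    ident' : ∀ a b q → + 3 * (a * q) + - + 1 * (b * q) ≡ (+ 3 * a - b) * q
    ident' = solve-∀

  private
    m : ℕ
    m = w' ℕ.+ suc w'

  -- 3n = m + p, so C(3n,j) arises from C(m,j) by adding p to every factor m - i of the numerator.
  bin-N : ∀ j → j ≤ m → bin N j ≈ bin m j + P * (bin m j * ∑ j (λ i → ι (+ (m ∸ i)))) [ P² ]
  bin-N zero    _   = ≡⇒≈ (ident P)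
    where
    ident : ∀ P → + 1 ≡ + 1 + P * (+ 1 * + 0)
    ident = solve-∀
  bin-N (suc j) j<m = cancel² (+ suc j) (unit-≤n (s≤s z≤n) (ℕP.m≤n⇒m≤1+n j<m))
    (lc4 (+ 1) (- (+ 1 + P * (σ + ι d))) (P + d) (- (P * bin m j)) (≡⇒≈ (trans (bin-upper N j) (cong (_* bin N j) d-eq))) (≡⇒≈ (trans (bin-upper m j) (cong (_* bin m j) d-eq'))) (bin-N j (ℕP.<⇒≤ j<m)) (ι-inverse u)
      (ident (bin N (suc j)) (bin N j) (bin m (suc j)) (bin m j) σ (ι d) d P (+ suc j))
     ⟫ lc1 (bin m j * σ) (modulus≈0 (+ 1)) (ident' (bin m j) σ (+ suc j * (bin m (suc j) + P * (bin m (suc j) * (σ + ι d)))) P))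
    where
    d σ : ℤ
    d = + (m ∸ j)
    σ = ∑ j (λ i → ι (+ (m ∸ i)))
    u : Unit d
    u = unit-≤n (ℕP.m<n⇒0<n∸m j<m) (ℕP.≤-trans (ℕP.m∸n≤m m j) (ℕP.n≤1+n m))
    d-eq' : + m - + j ≡ d
    d-eq' = elc1 (- + 1) (cong +_ (ℕP.m+[n∸m]≡n (ℕP.<⇒≤ j<m))) (e (+ m) (+ j) d)
      where
      e : ∀ m j d → m - j - d ≡ - + 1 * (j + d - m)
      e = solve-∀
    d-eq : + N - + j ≡ P + d
    d-eq = trans (e (+ m) (+ j)) (cong (λ z → P + z) d-eq')
      where
      e : ∀ m j → + 1 + m + (+ 1 + m + (+ 1 + m)) - j ≡ + 1 + (+ 1 + m + (+ 1 + m)) + (m - j)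
      e = solve-∀
    ident : ∀ X x Y y σ i d P k → k * X - (k * (Y + P * (Y * (σ + i))) + P * P * (y * σ))
      ≡ + 1 * (k * X - (P + d) * x) + - (+ 1 + P * (σ + i)) * (k * Y - d * y) + (P + d) * (x - (y + P * (y * σ))) + - (P * y) * (d * i - + 1)
    ident = solve-∀
    ident' : ∀ y σ e P → e + P * P * (y * σ) - e ≡ y * σ * (+ 1 * (P * P) - + 0)
    ident' = solve-∀

  ι-unique₁ : ∀ {a b} → Unit a → a * b ≈ + 1 [ P ] → ι a ≈ b [ P ]
  ι-unique₁ {a} u h = cancel a u (ι-inverse₁ u ⟫ ≈-sym h)

  w≤m : w ≤ m
  w≤m = ℕP.m≤n+m w w'

  -- C(m,w) is half of b₁. The reciprocals from w to n - 1 sum to H_n - H_w up to the end terms 1/w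
  -- ≡ -4 and 1/n ≡ -2; times p this is r - 2p.
  B₁-value : + 2 * B₁ ≈ b₁ * (+ 1 + r - + 2 * P) [ P² ]
  B₁-value = lc3 (+ 2) (+ 1 + P * (H n - H w + ι (+ w) - ι (+ n))) b₁
      (bin-N w w≤m ⟫ ≡⇒≈ (cong (λ z → bin m w + P * (bin m w * z)) Σ-value)) (≡⇒≈ half) PΣ
      (ident B₁ (bin m w) b₁ P (H n - H w + ι (+ w) - ι (+ n)) r)
    where
    half : + 2 * bin m w ≡ b₁
    half = cancel-suc w' (elc1 (- + 1) (bin-lower m w) (e (+ w) b₁ (bin m w)))
      where
      e : ∀ w b B → w * (+ 2 * B) - w * b ≡ - + 1 * ((w + w - w) * b - (w + w) * B)
      e = solve-∀
    Σ-value : ∑ w (λ i → ι (+ (m ∸ i))) ≡ H n - H w + ι (+ w) - ι (+ n)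
    Σ-value = trans (∑-rev w' (λ i → ι (+ (m ∸ i))))
      (trans (∑-cong w (λ i i<w → cong (ι ∘ +_) (index i (ℕP.≤-pred i<w))))
        (elc3 {a = ∑ w (λ i → ι (+ (w ℕ.+ i))) + ι (+ (w ℕ.+ w))} {b = ι (+ (w ℕ.+ 0)) + ∑ w (λ i → ι (+ (w ℕ.+ suc i)))}
           {a' = H n} {b' = H w + ∑ w (λ i → ι (+ suc (w ℕ.+ i)))} {a'' = ι (+ (w ℕ.+ 0)) + ∑ w (λ i → ι (+ (w ℕ.+ suc i)))} {b'' = ι (+ w) + ∑ w (λ i → ι (+ suc (w ℕ.+ i)))}
           (+ 1) (- + 1) (+ 1) (∑-first w (λ i → ι (+ (w ℕ.+ i)))) (∑-split w w (λ i → ι (+ suc i)))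
           (cong₂ (λ u v → ι (+ u) + v) (ℕP.+-identityʳ w) (∑-cong w (λ i _ → cong (ι ∘ +_) (ℕP.+-suc w i))))
           (e (∑ w (λ i → ι (+ (w ℕ.+ i)))) (ι (+ n)) (H n) (H w) (∑ w (λ i → ι (+ suc (w ℕ.+ i)))) (ι (+ (w ℕ.+ 0)) + ∑ w (λ i → ι (+ (w ℕ.+ suc i)))) (ι (+ w)))))
      where
      index : ∀ i → i ≤ w' → m ∸ (w' ∸ i) ≡ w ℕ.+ i
      index i i≤w' = trans (ℕP.+-∸-comm {w'} w {w' ∸ i} (ℕP.m∸n≤m w' i)) (trans (cong (ℕ._+ w) (ℕP.m∸[m∸n]≡n i≤w')) (ℕP.+-comm i w))
      e : ∀ s i hn hw σ x y → s - (hn - hw + y - i) ≡ + 1 * (s + i - x) + - + 1 * (hn - (hw + σ)) + + 1 * (x - (y + σ))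
      e = solve-∀
    ι-w : ι (+ w) ≈ - + 4 [ P ]
    ι-w = ι-unique₁ (unit-≤n (s≤s z≤n) w≤n) (lc1 (- + 1) P≈0 (e (+ w)))
      where
      e : ∀ w → w * - + 4 - + 1 ≡ - + 1 * (+ 1 + (w + w + (w + w)) - + 0)
      e = solve-∀
    ι-n : ι (+ n) ≈ - + 2 [ P ]
    ι-n = ι-unique₁ (unit-≤n (s≤s z≤n) ℕP.≤-refl) (lc1 (- + 1) P≈0 (e (+ n)))
      where
      e : ∀ w → w * - + 2 - + 1 ≡ - + 1 * (+ 1 + (w + w) - + 0)
      e = solve-∀
    PΣ : P * (H n - H w + ι (+ w) - ι (+ n)) ≈ r - + 2 * P [ P² ]
    PΣ = lc4 {a = P * (ι (+ w) + - ι (+ n))} {b = P * (- + 4 + - - + 2)} (+ 1) (- + 1) (+ 1) (- + 1)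
      (scale P (≈-+ ι-w (≈-neg ι-n)))
      (≈-sym (sgn*bin≈1-PH n n<p) ⟫ ≡⇒≈ (trans (cong (_* central n) sgn-n) (ℤP.*-identityˡ (central n))) ⟫ t⁴)
      (≈-sym (sgn*bin≈1-PH w (ℕP.≤-<-trans w≤n n<p)) ⟫ e-w) r²≈0 (e P (H n) (H w) (ι (+ w)) (ι (+ n)) t)
      where
      e : ∀ P hn hw x y t → let r = t * t - + 1 in P * (hn - hw + x - y) - (r - + 2 * P)
        ≡ + 1 * (P * (x + - y) - P * (- + 4 + - - + 2)) + - + 1 * (+ 1 - P * hn - t * t * (t * t)) + + 1 * (+ 1 - P * hw - (+ 1 + + 3 * r)) + - + 1 * (r * r - + 0)
      e = solve-∀
    ident : ∀ B b b₁ P σ r → + 2 * B - b₁ * (+ 1 + r - + 2 * P) ≡ + 2 * (B - (b + P * (b * σ))) + (+ 1 + P * σ) * (+ 2 * b - b₁) + b₁ * (P * σ - (r - + 2 * P))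
    ident = solve-∀

  unit-b₁ : Unit b₁
  unit-b₁ = unit-*ˡ (+ (w !) * + (w !)) (unit-≈ (≡⇒≈ (sym (bin-! w w))) (unit-! n n<p))

  unit-U : Unit U
  unit-U = unit-* (unit-sgn w) unit-b₁

  multiset≈U : multiset n w ≈ U [ P ]
  multiset≈U = lc2 (+ 1) (- (+ 3 * multiset n w) + + 2 * U) (weaken² multiset-w) r≈0 (e (multiset n w) U r)
    where
    e : ∀ X U r → X - U ≡ + 1 * (X * (+ 1 + + 3 * r) - U * (+ 1 + + 2 * r)) + (- (+ 3 * X) + + 2 * U) * (r - + 0)
    e = solve-∀

  bin-N-n≈0 : bin N n ≈ + 0 [ P ]
  bin-N-n≈0 = cancel (+ n) (unit-≤n (s≤s z≤n) ℕP.≤-refl) (lc2 (+ 1) (bin N m) (≡⇒≈ (bin-upper N m)) P≈0 (e (+ m) (bin N n) (bin N m)))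
    where
    e : ∀ m X Y → (+ 1 + m) * X - (+ 1 + m) * + 0 ≡ + 1 * ((+ 1 + m) * X - (+ 1 + m + (+ 1 + m + (+ 1 + m)) - m) * Y) + Y * (+ 1 + (+ 1 + m + (+ 1 + m)) - + 0)
    e = solve-∀

  -- In n C(N,n) = (N - m) C(N,m) the factor N - m equals p, so n ≡ -1/2 and C(N,m) ≡ 1 matter only
  -- modulo p.
  bin-N-n : bin N n ≈ - + 2 * P [ P² ]
  bin-N-n = lc3 (- + 2) (- + 2) (+ 1) (≡⇒≈ (bin-upper N m)) (scale P one) (scale P bin-N-n≈0) (e (+ m) (bin N n) (bin N m))
    where
    one : bin N m ≈ + 1 [ P ]
    one = lc2 {a' = bin m m} {b' = + 1} (+ 1) (+ 1) (weaken² (bin-N m ℕP.≤-refl) ⟫ lc1 (bin m m * ∑ m (λ i → ι (+ (m ∸ i)))) P≈0 (e₁ (bin m m) P (bin m m * ∑ m (λ i → ι (+ (m ∸ i))))))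
      (≡⇒≈ (bin-diag m)) (e₂ (bin N m) (bin m m))
      where
      e₁ : ∀ a P z → a + P * z - a ≡ z * (P - + 0)
      e₁ = solve-∀
      e₂ : ∀ a b → a - + 1 ≡ + 1 * (a - b) + + 1 * (b - + 1)
      e₂ = solve-∀
    e : ∀ m X Y → let P = + 1 + (+ 1 + m + (+ 1 + m)) in X - - + 2 * P
      ≡ - + 2 * ((+ 1 + m) * X - (+ 1 + m + (+ 1 + m + (+ 1 + m)) - m) * Y) + - + 2 * (P * Y - P * + 1) + + 1 * (P * X - P * + 0)
    e = solve-∀

  -- Both sides are (6w)! / (w! (2w)! (3w)!). This transfers the value of C(6w,2w) to C(6w,3w).
  B₃*multiset : B₃ * multiset n w ≡ bin N n * bin (n ℕ.+ n) w
  B₃*multiset = trans (cong (λ z → bin z (n ℕ.+ w) * bin (n ℕ.+ w) n) (e₁ w))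
    (trans (bin-swap (n ℕ.+ w) n w)
      (cong₂ _*_ (cong (λ z → bin z n) (sym (e₂ w))) (trans (cong (λ z → bin z (n ℕ.+ w)) (e₃ w)) (trans (sym (bin-sym w (n ℕ.+ w))) (cong (λ z → bin z w) (e₄ w))))))
    where
    e₁ : ∀ w → w ℕ.+ w ℕ.+ (w ℕ.+ w ℕ.+ (w ℕ.+ w)) ≡ w ℕ.+ w ℕ.+ w ℕ.+ (w ℕ.+ w ℕ.+ w)
    e₁ = ℕ-solve-∀
    e₂ : ∀ w → w ℕ.+ w ℕ.+ (w ℕ.+ w ℕ.+ (w ℕ.+ w)) ≡ w ℕ.+ w ℕ.+ (w ℕ.+ w ℕ.+ w ℕ.+ w)
    e₂ = ℕ-solve-∀
    e₃ : ∀ w → w ℕ.+ w ℕ.+ w ℕ.+ w ≡ w ℕ.+ (w ℕ.+ w ℕ.+ w)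
    e₃ = ℕ-solve-∀
    e₄ : ∀ w → w ℕ.+ (w ℕ.+ w ℕ.+ w) ≡ w ℕ.+ w ℕ.+ (w ℕ.+ w)
    e₄ = ℕ-solve-∀

  B₃≈0 : B₃ ≈ + 0 [ P ]
  B₃≈0 = cancel (multiset n w) (unit-≈ (≈-sym multiset≈U) unit-U)
    (lc2 (+ 1) (bin (n ℕ.+ n) w) (≡⇒≈ B₃*multiset) bin-N-n≈0 (e B₃ (multiset n w) (bin N n) (bin (n ℕ.+ n) w)))
    where
    e : ∀ B X b c → X * B - X * + 0 ≡ + 1 * (B * X - b * c) + c * (b - + 0)
    e = solve-∀

  B₃-value : B₃ * b₁ ≈ - + 2 * P [ P² ]
  B₃-value = cancel² (sgn w) (unit-sgn w)
    (lc4 (+ 1) (- + 1) (bin (n ℕ.+ n) w) (- + 2 * sgn w) (≡⇒≈ B₃*multiset) left bin-N-n right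
      (e B₃ b₁ (multiset n w) (bin N n) (bin (n ℕ.+ n) w) (sgn w) P)
     ⟫ lc1 (+ 2 * P * bin (n ℕ.+ n) w) (≡⇒≈ (sgn² w)) (e' P (bin (n ℕ.+ n) w) (sgn w)))
    where
    left : B₃ * (multiset n w - U) ≈ + 0 [ P² ]
    left = ≈0²-difference B₃≈0 multiset≈U
    right : P * (sgn w * bin (n ℕ.+ n) w) ≈ P * + 1 [ P² ]
    right = scale P (sgn*bin≈1 w (ℕP.≤-<-trans w≤n n<p))
    e : ∀ B b X β γ s P → s * (B * b) - (s * (- + 2 * P) + + 2 * P * γ * (s * s - + 1))
      ≡ + 1 * (B * X - β * γ) + - + 1 * (B * (X - s * b) - + 0) + γ * (β - - + 2 * P) + - + 2 * s * (P * (s * γ) - P * + 1)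
    e = solve-∀
    e' : ∀ P γ s → s * (- + 2 * P) + + 2 * P * γ * (s * s - + 1) - s * (- + 2 * P) ≡ + 2 * P * γ * (s * s - + 1)
    e' = solve-∀

-- p as the exact sum of two squared half sums

module SumOfSquares (w' : ℕ) (pr : Prime (suc (suc (w' ℕ.+ suc w') ℕ.+ suc (w' ℕ.+ suc w')))) where

  open import Data.Integer using (_+_; _*_; _-_; -_; _^_)

  open JacobsthalValues w' pr public

  2D-value : + 2 * D ≈ U * (+ 2 - r) [ P² ]
  2D-value = cancel² (+ 2) unit-2 (lc2 (+ 2 - r) D D-value r²≈0 (e D U r))
    where
    e : ∀ D U r → + 2 * (+ 2 * D) - + 2 * (U * (+ 2 - r)) ≡ (+ 2 - r) * (D * (+ 2 + r) - + 2 * U) + D * (r * r - + 0)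
    e = solve-∀

  D≈U : D ≈ U [ P ]
  D≈U = cancel (+ 2) unit-2 (lc2 (+ 1) (- U) (weaken² 2D-value) r≈0 (e D U r))
    where
    e : ∀ D U r → + 2 * D - + 2 * U ≡ + 1 * (+ 2 * D - U * (+ 2 - r)) + - U * (r - + 0)
    e = solve-∀

  unit-D : Unit D
  unit-D = unit-≈ (≈-sym D≈U) unit-U

  h₁ : ℤ
  h₁ = h (+ 1)

  4h₁ : + 4 * h₁ ≈ - (+ 2 * D) + sgn w * B₃ [ P² ]
  4h₁ = 4h-value (+ 1) (+ 1) ≈-refl
    ⟫ ≡⇒≈ (cong (λ k → (+ 3 * (b₁ * s) - (B₁ * (s * (k * k)) + B₃ * (k * s) + B₁ * s)) * + q) sgn-n)
    ⟫ lc4 (- (s * + q)) (- (b₁ * s)) (- s) (+ 1) B₁-value (scale P r≈0) (scale P B₃≈0) 2D-value (e b₁ B₁ B₃ s (+ q) r D)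
    ⟫ lc1 (+ 2 * b₁ * s) (modulus≈0 (+ 1)) (e' P b₁ s (- (+ 2 * D) + s * B₃))
    where
    s : ℤ
    s = sgn w
    e : ∀ b B B₃ s q r D → let P = + 1 + q in
      (+ 3 * (b * s) - (B * (s * (+ 1 * + 1)) + B₃ * (+ 1 * s) + B * s)) * q - (- (+ 2 * D) + s * B₃ + + 2 * b * s * P * P)
      ≡ - (s * q) * (+ 2 * B - b * (+ 1 + r - + 2 * P)) + - (b * s) * (P * r - P * + 0) + - s * (P * B₃ - P * + 0) + + 1 * (+ 2 * D - s * b * (+ 2 - r))
    e = solve-∀
    e' : ∀ P b s z → z + + 2 * b * s * P * P - z ≡ + 2 * b * s * (+ 1 * (P * P) - + 0)
    e' = solve-∀

  -- That is, 2h₁ ≡ -(D + p/D). As B₃ is divisible by p, b₁ in `B₃-value` may be replaced by (-1)^w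
  -- D, so that (-1)^w B₃ is -2p/D.
  h₁-value : D * (+ 2 * h₁ + D) ≈ - P [ P² ]
  h₁-value = cancel² (+ 2) unit-2 (lc4 D (+ 1) (sgn w * sgn w) (- + 2 * P) 4h₁ vanish B₃-value (≡⇒≈ (sgn² w)) (e D h₁ (sgn w) b₁ B₃ P))
    where
    vanish : sgn w * B₃ * (D - U) ≈ + 0 [ P² ]
    vanish = ≈0²-difference {sgn w * B₃} (≈-*ˡ (sgn w) B₃≈0 ⟫ ≡⇒≈ (ℤP.*-zeroʳ (sgn w))) D≈U
    e : ∀ D h s b B P → + 2 * (D * (+ 2 * h + D)) - + 2 * - P
      ≡ D * (+ 4 * h - (- (+ 2 * D) + s * B)) + + 1 * (s * B * (D - s * b) - + 0) + s * s * (B * b - - + 2 * P) + - + 2 * P * (s * s - + 1)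
    e = solve-∀

  unit-4 : Unit (+ 4)
  unit-4 = unit-* unit-2 unit-2

  nonresidue : ∃ λ g → Unit (+ g) × (+ g) ^ n ≈ - + 1 [ P ]
  nonresidue = choose (non-root n (s≤s z≤n) (ℕP.m<m+n n (s≤s z≤n)))
    where
    choose : (∃ λ g → Unit (+ g) × ¬ ((+ g) ^ n ≈ + 1 [ P ])) → ∃ λ g → Unit (+ g) × (+ g) ^ n ≈ - + 1 [ P ]
    choose (g , u , ne) = g , u , [ (λ one → ⊥-elim (ne one)) , (λ z → z) ]′ (euler u)

  -- With A = 3b₁ - 2B₁, the numbers 4h₁ and 4h_g are q(A - B₃) and q(A + B₃) times factors whose
  -- squares are 1 and -1. So 16 times the sum of squares is -4q²AB₃ ≡ -8b₁B₃ ≡ 16p, where A ≡ 2b₁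
  -- and q² ≡ 1 suffice modulo p.
  sum-of-squares-mod : ∃ λ k → h₁ * h₁ + h k * h k ≈ P [ P² ]
  sum-of-squares-mod = combine nonresidue
    where
    combine : (∃ λ g → Unit (+ g) × (+ g) ^ n ≈ - + 1 [ P ]) → ∃ λ k → h₁ * h₁ + h k * h k ≈ P [ P² ]
    combine (g , u , g^n) = + g , cancel² (+ 16) (unit-* unit-4 unit-4)
      (lc4 (+ 1) (+ 1) (- + 4) (- + 8) (≈-* first first) (≈-* second second ⟫ square) vanish B₃-value (e₀ h₁ (h (+ g)) b₁ B₁ B₃ (+ q) (sgn w))
       ⟫ lc1 ((+ q) * (+ q) * (A - B₃) * (A - B₃)) (≡⇒≈ (sgn² w)) (e₁ ((+ q) * (+ q) * (A - B₃) * (A - B₃)) (sgn w * sgn w) (+ 16 * P)))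
      where
      A κ y k : ℤ
      A = + 3 * b₁ - + 2 * B₁
      -- The lift makes (-κ)^n ≡ -1 hold modulo p² and not only modulo p.
      κ = τ g
      y = (- κ) ^ w
      k = (- κ) ^ n
      k≈-1 : k ≈ - + 1 [ P² ]
      k≈-1 = ≡⇒≈ (trans (even-power κ) (^-comm (+ g) p n)) ⟫ lift g^n ⟫ ≡⇒≈ (cong (- + 1 *_) (sgn-+ n))
      y²≈-1 : y * y ≈ - + 1 [ P² ]
      y²≈-1 = ≡⇒≈ (sym (ℤP.^-distribˡ-+-* (- κ) w w)) ⟫ k≈-1
      first : + 4 * h₁ ≈ (+ q) * (sgn w * (A - B₃)) [ P² ]
      first = 4h-value (+ 1) (+ 1) ≈-refl
        ⟫ ≡⇒≈ (trans (cong (λ k → (+ 3 * (b₁ * sgn w) - (B₁ * (sgn w * (k * k)) + B₃ * (k * sgn w) + B₁ * sgn w)) * + q) sgn-n) (e b₁ B₁ B₃ (+ q) (sgn w)))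
        where
        e : ∀ b B B₃ q s → (+ 3 * (b * s) - (B * (s * (+ 1 * + 1)) + B₃ * (+ 1 * s) + B * s)) * q ≡ q * (s * (+ 3 * b - + 2 * B - B₃))
        e = solve-∀
      second : + 4 * h (+ g) ≈ (+ q) * (y * (A + B₃)) [ P² ]
      second = 4h-value (+ g) κ (≈-sym (fermat-ℕ g))
        ⟫ lc1 (- (B₁ * y * (k - + 1) + B₃ * y) * + q) k≈-1 (e b₁ B₁ B₃ (+ q) y k)
        where
        e : ∀ b B B₃ q y k → (+ 3 * (b * y) - (B * (y * (k * k)) + B₃ * (k * y) + B * y)) * q - q * (y * (+ 3 * b - + 2 * B + B₃)) ≡ - (B * y * (k - + 1) + B₃ * y) * q * (k - - + 1)
        e = solve-∀
      square : (+ q) * (y * (A + B₃)) * ((+ q) * (y * (A + B₃))) ≈ - ((+ q) * (+ q) * (A + B₃) * (A + B₃)) [ P² ]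
      square = lc1 ((+ q) * (+ q) * (A + B₃) * (A + B₃)) y²≈-1 (e (+ q) y (A + B₃))
        where
        e : ∀ q y z → q * (y * z) * (q * (y * z)) - - (q * q * z * z) ≡ q * q * z * z * (y * y - - + 1)
        e = solve-∀
      vanish : B₃ * ((+ q) * (+ q) * A - + 2 * b₁) ≈ + 0 [ P² ]
      vanish = ≈0² {b = (+ q) * (+ q) * A - + 2 * b₁} B₃≈0
        (lc4 ((+ q - + 1) * A) (- + 1) (- b₁) (+ 2 * b₁) P≈0 (weaken² B₁-value) r≈0 P≈0 (e (+ q) b₁ B₁ r))
        where
        e : ∀ q b B r → let P = + 1 + q in q * q * (+ 3 * b - + 2 * B) - + 2 * b - + 0
          ≡ (q - + 1) * (+ 3 * b - + 2 * B) * (P - + 0) + - + 1 * (+ 2 * B - b * (+ 1 + r - + 2 * P)) + - b * (r - + 0) + + 2 * b * (P - + 0)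
        e = solve-∀
      e₀ : ∀ h₁ h₂ b B B₃ q s → let P = + 1 + q ; A = + 3 * b - + 2 * B in
        + 16 * (h₁ * h₁ + h₂ * h₂) - (+ 16 * P + q * q * (A - B₃) * (A - B₃) * (s * s - + 1))
        ≡ + 1 * (+ 4 * h₁ * (+ 4 * h₁) - q * (s * (A - B₃)) * (q * (s * (A - B₃)))) + + 1 * (+ 4 * h₂ * (+ 4 * h₂) - - (q * q * (A + B₃) * (A + B₃)))
          + - + 4 * (B₃ * (q * q * A - + 2 * b) - + 0) + - + 8 * (B₃ * b - - + 2 * P)
      e₀ = solve-∀
      e₁ : ∀ c z x → x + c * (z - + 1) - x ≡ c * (z - + 1)
      e₁ = solve-∀

  φ-bound : ∀ v → ℤ.∣ φ v ∣ ≤ 1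
  φ-bound v = bound (proj₂ (legendreSymbol v))
    where
    bound : ∀ {v e} → IsLegendre v e → ℤ.∣ e ∣ ≤ 1
    bound (residue⁺ _) = s≤s z≤n
    bound (residue⁻ _) = s≤s z≤n
    bound (residue⁰ _) = z≤n

  ∑-bound : ∀ N f → (∀ k → ℤ.∣ f k ∣ ≤ 1) → ℤ.∣ ∑ N f ∣ ≤ N
  ∑-bound zero    f b = z≤n
  ∑-bound (suc N) f b = ℕP.≤-trans (ℤP.∣i+j∣≤∣i∣+∣j∣ (∑ N f) (f N)) (subst (ℤ.∣ ∑ N f ∣ ℕ.+ ℤ.∣ f N ∣ ≤_) (ℕP.+-comm N 1) (ℕP.+-mono-≤ (∑-bound N f b) (b N)))

  h-bound : ∀ k → ℤ.∣ h k ∣ ≤ n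
  h-bound k = ∑-bound n (λ i → φ (+ suc i * (+ suc i * + suc i - k))) (λ i → φ-bound (+ suc i * (+ suc i * + suc i - k)))

  small-residue : ∀ x → x < p ℕ.* p → + x ≈ P [ P² ] → x ≡ p
  small-residue x x<p² (by (+ 0) e) = ℤP.+-injective (ℤP.i-j≡0⇒i≡j (+ x) P (trans e (ℤP.*-zeroˡ P²)))
  small-residue x x<p² (by (+ suc z) e) = ⊥-elim (ℕP.<⇒≱ x<p² (subst (p ℕ.* p ≤_) (sym x-value) (ℕP.≤-trans (ℕP.m≤m+n (p ℕ.* p) (z ℕ.* (p ℕ.* p))) (ℕP.m≤n+m (suc z ℕ.* (p ℕ.* p)) p))))
    where
    x-value : x ≡ p ℕ.+ suc z ℕ.* (p ℕ.* p)
    x-value = ℤP.+-injective (trans (elc1 {x = + x} {y = P + + suc z * P²} (+ 1) e (ident (+ x) P (+ suc z * P²)))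
      (cong (λ u → P + u) (trans (cong (+ suc z *_) (sym (ℤP.pos-* p p))) (sym (ℤP.pos-* (suc z) (p ℕ.* p))))))
      where
      ident : ∀ x P u → x - (P + u) ≡ + 1 * (x - P - u)
      ident = solve-∀
  small-residue x x<p² (by -[1+ z ] e) = ⊥-elim (ℕP.<⇒≱ (ℕP.m<m*n p p 1<p) (ℕP.≤-trans (ℕP.m≤m+n (p ℕ.* p) (z ℕ.* (p ℕ.* p)))
      (subst (suc z ℕ.* (p ℕ.* p) ≤_) p-value (ℕP.m≤n+m (suc z ℕ.* (p ℕ.* p)) x))))
    where
    p-value : x ℕ.+ suc z ℕ.* (p ℕ.* p) ≡ p
    p-value = ℤP.+-injective (trans (cong (λ u → + x + u) (trans (ℤP.pos-* (suc z) (p ℕ.* p)) (cong (+ suc z *_) (ℤP.pos-* p p))))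
      (elc1 {x = + x + + suc z * P²} {y = P} (+ 1) e (ident (+ x) P (+ suc z) P²)))
      where
      ident : ∀ x P u M → x + u * M - P ≡ + 1 * (x - P - - u * M)
      ident = solve-∀

  -- Each half sum has n terms of absolute value at most 1, so the squares add up to at most 2n² <
  -- p², and p is the only natural number below p² congruent to p modulo p².
  sum-of-squares : ∃ λ k → h₁ * h₁ + h k * h k ≡ P
  sum-of-squares = exact sum-of-squares-mod
    where
    exact : (∃ λ k → h₁ * h₁ + h k * h k ≈ P [ P² ]) → ∃ λ k → h₁ * h₁ + h k * h k ≡ P
    exact (k , e) = k , trans squares (cong +_ (small-residue X bound (≡⇒≈ (sym squares) ⟫ e)))
      where
      a b X : ℕ
      a = ℤ.∣ h₁ ∣
      b = ℤ.∣ h k ∣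
      X = a ℕ.* a ℕ.+ b ℕ.* b
      squares : h₁ * h₁ + h k * h k ≡ + X
      squares = cong₂ _+_ (square-abs h₁) (square-abs (h k))
      bound : X < p ℕ.* p
      bound = ℕP.≤-<-trans (ℕP.+-mono-≤ (ℕP.*-mono-≤ (h-bound (+ 1)) (h-bound (+ 1))) (ℕP.*-mono-≤ (h-bound k) (h-bound k)))
        (ℕP.≤-<-trans (ℕP.m≤m+n (n ℕ.* n ℕ.+ n ℕ.* n) (n ℕ.* n ℕ.+ n ℕ.* n))
          (subst (_< p ℕ.* p) (ident n) (ℕP.*-mono-< (ℕP.≤-refl {p}) (ℕP.≤-refl {p}))))
        where
        ident : ∀ n → (n ℕ.+ n) ℕ.* (n ℕ.+ n) ≡ n ℕ.* n ℕ.+ n ℕ.* n ℕ.+ (n ℕ.* n ℕ.+ n ℕ.* n)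
        ident = ℕ-solve-∀

-- Uniqueness of p = x² + y²

module TwoSquares (q : ℕ) (pr : Prime (suc q)) where

  open import Data.Integer using (_+_; _*_; _-_; -_; _^_)

  open PrimeModulus q pr

  unit-multiple : ∀ k u → k ≢ + 0 → k * P * (k * P) + u * u ≡ P * P → IsSign k × u ≡ + 0
  unit-multiple k u k≢0 e = k-sign , square≡0 u (elc2 (+ 1) (- (P * P)) e (sign² k-sign) (ident k u P))
    where
    ident : ∀ k u P → u * u - + 0 ≡ + 1 * (k * P * (k * P) + u * u - P * P) + - (P * P) * (k * k - + 1)
    ident = solve-∀
    κ υ : ℕ
    κ = ℤ.∣ k ∣
    υ = ℤ.∣ u ∣
    naturals : κ ℕ.* κ ℕ.* (p ℕ.* p) ℕ.+ υ ℕ.* υ ≡ p ℕ.* p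
    naturals = ℤP.+-injective (trans (cong₂ _+_ (trans (ℤP.pos-* (κ ℕ.* κ) (p ℕ.* p)) (cong₂ _*_ (sym (square-abs k)) (ℤP.pos-* p p))) (sym (square-abs u)))
      (trans (elc1 {x = k * k * (P * P) + u * u} {y = P * P} (+ 1) e (ident' k u P)) (sym (ℤP.pos-* p p))))
      where
      ident' : ∀ k u P → k * k * (P * P) + u * u - P * P ≡ + 1 * (k * P * (k * P) + u * u - P * P)
      ident' = solve-∀
    one : ∀ κ → κ ≢ 0 → κ ℕ.* κ ℕ.* (p ℕ.* p) ℕ.+ υ ℕ.* υ ≡ p ℕ.* p → κ ≡ 1
    one zero          κ≢0 _ = ⊥-elim (κ≢0 refl)
    one (suc zero)    _   _ = refl
    one (suc (suc j)) _   f = ⊥-elim (ℕP.<⇒≱ (ℕP.m<m*n (p ℕ.* p) 2 (s≤s (s≤s z≤n)))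
      (ℕP.≤-trans (subst (_≤ suc (suc j) ℕ.* suc (suc j) ℕ.* (p ℕ.* p)) (ℕP.*-comm 2 (p ℕ.* p))
          (ℕP.*-monoˡ-≤ (p ℕ.* p) (ℕP.≤-trans (s≤s (s≤s z≤n)) (ℕP.m≤m*n (suc (suc j)) (suc (suc j))))))
        (subst (suc (suc j) ℕ.* suc (suc j) ℕ.* (p ℕ.* p) ≤_) f (ℕP.m≤m+n (suc (suc j) ℕ.* suc (suc j) ℕ.* (p ℕ.* p)) (υ ℕ.* υ)))))
    abs-1 : ∀ k → ℤ.∣ k ∣ ≡ 1 → IsSign k
    abs-1 (+ suc zero) refl   = inj₁ refl
    abs-1 (-[1+ zero ]) refl  = inj₂ refl
    k-sign : IsSign k
    k-sign = abs-1 k (one κ (λ z → k≢0 (ℤP.∣i∣≡0⇒i≡0 z)) naturals)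

  -- The norm form of ℤ[i] is multiplicative, and p divides one of the two products below.
  unique : ∀ a b x y → a * a + b * b ≡ P → x * x + y * y ≡ P → a ≈ + 1 [ + 4 ] → x ≈ + 1 [ + 4 ] → y ≈ + 0 [ + 2 ] → a ≡ x
  unique a b x y ab xy a₄ x₄ y₂ = [ solve-with b ab , (λ z → solve-with (- b) (trans (cong (λ z → a * a + z) (ident₀ b)) ab) (lc1 (+ 1) z (ident₁ a b x y))) ]′
      (≈0-* (a * x - b * y) (a * x + b * y) (lc3 (a * a + x * x - P) (- (y * y)) (- (P - a * a)) P≈0 (≡⇒≈ ab) (≡⇒≈ xy) (ident₂ a b x y P)))
    where
    ident₀ : ∀ b → - b * - b ≡ b * b
    ident₀ = solve-∀
    ident₁ : ∀ a b x y → a * x - - b * y - + 0 ≡ + 1 * (a * x + b * y - + 0)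
    ident₁ = solve-∀
    ident₂ : ∀ a b x y P → (a * x - b * y) * (a * x + b * y) - + 0
      ≡ (a * a + x * x - P) * (P - + 0) + - (y * y) * (a * a + b * b - P) + - (P - a * a) * (x * x + y * y - P)
    ident₂ = solve-∀
    solve-with : ∀ b → a * a + b * b ≡ P → a * x - b * y ≈ + 0 [ P ] → a ≡ x
    solve-with b ab (by k e) = conclude (unit-multiple k (a * y + b * x) k≢0 norm)
      where
      norm : k * P * (k * P) + (a * y + b * x) * (a * y + b * x) ≡ P * P
      norm = trans (cong (λ z → z * z + (a * y + b * x) * (a * y + b * x)) (sym e)) (elc2 (x * x + y * y) P ab xy (ident a b x y P))
        where
        ident : ∀ a b x y P → (a * x - b * y - + 0) * (a * x - b * y - + 0) + (a * y + b * x) * (a * y + b * x) - P * P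
          ≡ (x * x + y * y) * (a * a + b * b - P) + P * (x * x + y * y - P)
        ident = solve-∀
      -- a x - b y is odd, because a and x are odd and y is even.
      k≢0 : k ≢ + 0
      k≢0 z = ≉0 {0} {2} (s≤s (s≤s z≤n)) (lc4 (- x) (- + 1) b (+ 1) (weaken (+ 2) a₄) (weaken (+ 2) x₄) y₂
          (≡⇒≈ (trans e (trans (cong (_* P) z) (ℤP.*-zeroˡ P)))) (ident a b x y))
        where
        ident : ∀ a b x y → + 1 - + 0 ≡ - x * (a - + 1) + - + 1 * (x - + 1) + b * (y - + 0) + + 1 * (a * x - b * y - + 0 - + 0)
        ident = solve-∀
      a≡xk : a * y + b * x ≡ + 0 → a ≡ x * k
      a≡xk u = cancel-suc q (elc3 (- a) x y xy e u (ident a b x y P k))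
        where
        ident : ∀ a b x y P k → P * a - P * (x * k) ≡ - a * (x * x + y * y - P) + x * (a * x - b * y - + 0 - k * P) + y * (a * y + b * x - + 0)
        ident = solve-∀
      conclude : IsSign k × a * y + b * x ≡ + 0 → a ≡ x
      conclude (inj₁ k=1 , u)  = trans (a≡xk u) (trans (cong (x *_) k=1) (ℤP.*-identityʳ x))
      -- This sign would give a = -x, impossible as both are 1 modulo 4.
      conclude (inj₂ k=-1 , u) = ⊥-elim (≉0 {1} {4} (s≤s (s≤s (s≤s z≤n)))
          (lc3 (- + 1) (- + 1) (+ 1) a₄ x₄ (≡⇒≈ (trans (a≡xk u) (cong (x *_) k=-1))) (ident a x)))
        where
        ident : ∀ a x → + 2 - + 0 ≡ - + 1 * (a - + 1) + - + 1 * (x - + 1) + + 1 * (a - x * - + 1)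
        ident = solve-∀

-- The sign of h₁

module JacobsthalSign (w' : ℕ) (pr : Prime (suc (suc (w' ℕ.+ suc w') ℕ.+ suc (w' ℕ.+ suc w')))) where

  open import Data.Integer using (_+_; _*_; _-_; -_; _^_)

  open SumOfSquares w' pr public

  private
    m : ℕ
    m = w' ℕ.+ suc w'

  ∏ : ℕ → (ℕ → ℤ) → ℤ
  ∏ zero    f = + 1
  ∏ (suc k) f = ∏ k f * f k

  -- A sum of signs is determined modulo 4 by their number and their product.
  ∑-φ-mod-4 : ∀ k v → (∀ i → i < k → Unit (v i)) →
    ∃ λ e → IsSign e × ∑ k (φ ∘ v) ≈ + k - + 1 + e [ + 4 ] × e ≈ ∏ k v ^ n [ P ]
  ∑-φ-mod-4 zero    v u = + 1 , inj₁ refl , ≡⇒≈ refl , ≡⇒≈ (sym (ℤP.^-zeroˡ n))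
  ∑-φ-mod-4 (suc k) v u = extend (∑-φ-mod-4 k v (λ i i<k → u i (ℕP.m≤n⇒m≤1+n i<k))) (proj₂ (legendreSymbol (v k)))
    where
    extend : ∀ {ε} → (∃ λ e → IsSign e × ∑ k (φ ∘ v) ≈ + k - + 1 + e [ + 4 ] × e ≈ ∏ k v ^ n [ P ]) → IsLegendre (v k) ε →
      ∃ λ e → IsSign e × ∑ k (φ ∘ v) + ε ≈ + suc k - + 1 + e [ + 4 ] × e ≈ (∏ k v * v k) ^ n [ P ]
    extend _ (residue⁰ z) = ⊥-elim (u k ℕP.≤-refl z)
    extend (e , se , s , pe) (residue⁺ h) = e , se , lc1 (+ 1) s (ident (∑ k (φ ∘ v)) (+ k) e)
      , ≡⇒≈ (sym (ℤP.*-identityʳ e)) ⟫ ≈-* pe (≈-sym h) ⟫ ≡⇒≈ (sym (^-*-distrib (∏ k v) (v k) n))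
      where
      ident : ∀ S k e → S + + 1 - (+ 1 + k - + 1 + e) ≡ + 1 * (S - (k - + 1 + e))
      ident = solve-∀
    extend (e , se , s , pe) (residue⁻ h) = e * - + 1 , sign-* se (inj₂ refl) , lc2 (+ 1) (+ 1) s (even se) (ident (∑ k (φ ∘ v)) (+ k) e)
      , ≈-* pe (≈-sym h) ⟫ ≡⇒≈ (sym (^-*-distrib (∏ k v) (v k) n))
      where
      ident : ∀ S k e → S + - + 1 - (+ 1 + k - + 1 + e * - + 1) ≡ + 1 * (S - (k - + 1 + e)) + + 1 * (+ 2 * e - + 2 - + 0)
      ident = solve-∀
      even : ∀ {e} → IsSign e → + 2 * e - + 2 ≈ + 0 [ + 4 ]
      even (inj₁ refl) = ≡⇒≈ refl
      even (inj₂ refl) = by (- + 1) refl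

  v : ℕ → ℤ
  v i = + suc i * (+ suc i * + suc i - + 1)

  -- The factors are (s-1)s(s+1) for s = 2, ..., k+1, that is, three runs of consecutive integers;
  -- the last run starts at 3, whence the 2 on the left.
  2∏v : ∀ k → + 2 * ∏ k (v ∘ suc) ≡ + (k !) * + (suc k !) * + (suc (suc k) !)
  2∏v zero    = refl
  2∏v (suc k) = trans (elc1 ((+ 2 + + k) * (+ 1 + + k) * (+ 3 + + k)) (2∏v k) (ident (∏ k (v ∘ suc)) (+ (k !)) (+ (suc k !)) (+ (suc (suc k) !)) (+ k)))
    (sym (cong₂ (λ a b → a * + (suc (suc k) !) * b) (ℤP.pos-* (suc k) (k !)) (trans (ℤP.pos-* (suc (suc (suc k))) (suc (suc k) !)) (cong (+ suc (suc (suc k)) *_) (ℤP.pos-* (suc (suc k)) (suc k !))))))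
    where
    ident : ∀ W a b c k → + 2 * (W * ((+ 2 + k) * ((+ 2 + k) * (+ 2 + k) - + 1))) - (+ 1 + k) * a * c * ((+ 3 + k) * ((+ 2 + k) * b))
      ≡ (+ 2 + k) * (+ 1 + k) * (+ 3 + k) * (+ 2 * W - a * b * c)
    ident = solve-∀

  f : ℤ
  f = + (n !)

  -- From (2n)! = C(2n,n) (n!)², Wilson's theorem and C(2n,n) ≡ t⁴ ≡ 1.
  f²≈-1 : f * f ≈ - + 1 [ P ]
  f²≈-1 = lc4 (+ 1) (- (f * f)) (- (f * f) * (t * t + + 1)) (+ 1) (≡⇒≈ (bin-! n n)) (weaken² t⁴) t²≈1 full (ident f (central n) t (+ ((n ℕ.+ n) !)))
    where
    full : + ((n ℕ.+ n) !) ≈ - + 1 [ P ]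
    full = ≡⇒≈ (trans (sym (ℤP.*-identityˡ (+ ((n ℕ.+ n) !)))) (cong (_* + ((n ℕ.+ n) !)) (sym (sgn-+ n)))) ⟫ wilson
    ident : ∀ f c t F → f * f - - + 1 ≡ + 1 * (c * (f * f) - F) + - (f * f) * (c - t * t * (t * t)) + - (f * f) * (t * t + + 1) * (t * t - + 1) + + 1 * (F - - + 1)
    ident = solve-∀

  f^n : f ^ n ≈ sgn w [ P ]
  f^n = ≡⇒≈ (trans (ℤP.^-distribˡ-+-* f w w) (sym (^-*-distrib f f w))) ⟫ ≈-^ w f²≈-1

  -- `2∏v` gives n · 2∏ = (n+1) (n!)³. On n-th powers, n ≡ -1/2 and n + 1 ≡ 1/2 both become inverse
  -- to t since n is even, and n! becomes (-1)^w.
  ∏v^n : t * ∏ m (v ∘ suc) ^ n ≈ sgn w [ P ]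
  ∏v^n = lc4 (- (t * W)) t (sgn w * sgn w * sgn w) (+ 1) n^n (≡⇒≈ power) n+1^n (≈-* (≈-refl {t * (+ suc n) ^ n}) (≈-* f^n (≈-* f^n f^n)))
      (ident t W ((+ n) ^ n) ((+ suc n) ^ n) (f ^ n) (sgn w))
    ⟫ ≡⇒≈ (trans (cong (_* sgn w) (sgn² w)) (ℤP.*-identityˡ (sgn w)))
    where
    W : ℤ
    W = ∏ m (v ∘ suc) ^ n
    double^n : ∀ a ε → a * + 2 ≈ ε [ P ] → ε ^ n ≡ + 1 → t * a ^ n ≈ + 1 [ P ]
    double^n a ε h e = ≡⇒≈ (trans (ℤP.*-comm t (a ^ n)) (sym (^-*-distrib a (+ 2) n))) ⟫ ≈-^ n h ⟫ ≡⇒≈ e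
    n^n : t * (+ n) ^ n ≈ + 1 [ P ]
    n^n = double^n (+ n) (- + 1) (lc1 (+ 1) P≈0 (e (+ n))) sgn-n
      where
      e : ∀ n → n * + 2 - - + 1 ≡ + 1 * (+ 1 + (n + n) - + 0)
      e = solve-∀
    n+1^n : t * (+ suc n) ^ n ≈ + 1 [ P ]
    n+1^n = double^n (+ suc n) (+ 1) (lc1 (+ 1) P≈0 (e (+ n))) (ℤP.^-zeroˡ n)
      where
      e : ∀ n → (+ 1 + n) * + 2 - + 1 ≡ + 1 * (+ 1 + (n + n) - + 0)
      e = solve-∀
    relation : + n * (+ 2 * ∏ m (v ∘ suc)) ≡ + suc n * (f * (f * f))
    relation = trans (cong (+ n *_) (2∏v m)) (trans (cong (λ z → + n * (+ (m !) * f * z)) (ℤP.pos-* (suc n) (n !)))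
      (trans (e (+ n) (+ (m !)) f (+ suc n)) (cong (λ z → + suc n * (z * (f * f))) (sym (ℤP.pos-* n (m !))))))
      where
      e : ∀ n a f k → n * (a * f * (k * f)) ≡ k * (n * a * (f * f))
      e = solve-∀
    power : (+ n) ^ n * (t * W) ≡ (+ suc n) ^ n * (f ^ n * (f ^ n * f ^ n))
    power = trans (cong ((+ n) ^ n *_) (sym (^-*-distrib (+ 2) (∏ m (v ∘ suc)) n))) (trans (sym (^-*-distrib (+ n) (+ 2 * ∏ m (v ∘ suc)) n))
      (trans (cong (_^ n) relation) (trans (^-*-distrib (+ suc n) (f * (f * f)) n)
        (cong ((+ suc n) ^ n *_) (trans (^-*-distrib f (f * f) n) (cong (f ^ n *_) (^-*-distrib f f n)))))))
    ident : ∀ t W a b g s → t * W - s * s * s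
      ≡ - (t * W) * (t * a - + 1) + t * (a * (t * W) - b * (g * (g * g))) + s * s * s * (t * b - + 1) + + 1 * (t * b * (g * (g * g)) - t * b * (s * (s * s)))
    ident = solve-∀

  module _ (L : ℤ) (L-sign : IsSign L) (L≈t : L ≈ t [ P ]) where

    2w-mod-4 : ∀ w → + w + + w ≈ + 1 - sgn w [ + 4 ]
    2w-mod-4 zero    = ≡⇒≈ refl
    2w-mod-4 (suc w) = lc2 (+ 1) (+ 1) (2w-mod-4 w) (even (sgn-sign w)) (ident (+ w) (sgn w))
      where
      even : ∀ {s} → IsSign s → + 2 - + 2 * s ≈ + 0 [ + 4 ]
      even (inj₁ refl) = ≡⇒≈ refl
      even (inj₂ refl) = by (+ 1) refl
      ident : ∀ w s → + 1 + w + (+ 1 + w) - (+ 1 - - + 1 * s) ≡ + 1 * (w + w - (+ 1 - s)) + + 1 * (+ 2 - + 2 * s - + 0)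
      ident = solve-∀

    -- The term s = 1 is φ(0) = 0 and the other m terms are signs with product e = L(-1)^w up to the
    -- parity rule of `∑-φ-mod-4`, so h₁ ≡ m - 1 + e. With 2w ≡ 1 - (-1)^w the claim becomes 4 | (L
    -- - 1)((-1)^w + 1), true for any two signs.
    h₁-mod-4 : h₁ ≈ - L [ + 4 ]
    h₁-mod-4 = ≡⇒≈ (trans (∑-first m (φ ∘ v)) (trans (cong (_+ ∑ m (φ ∘ v ∘ suc)) φ-0) (ℤP.+-identityˡ (∑ m (φ ∘ v ∘ suc)))))
      ⟫ finish (∑-φ-mod-4 m (v ∘ suc) units)
      where
      zero-symbol : ∀ {e} → IsLegendre (+ 0) e → e ≡ + 0
      zero-symbol (residue⁰ _) = refl
      zero-symbol (residue⁺ h) = ⊥-elim (unit-1 (≈-sym h ⟫ ≡⇒≈ (0^ n (s≤s z≤n))))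
      zero-symbol (residue⁻ h) = ⊥-elim (unit-neg unit-1 (≈-sym h ⟫ ≡⇒≈ (0^ n (s≤s z≤n))))
      φ-0 : φ (v 0) ≡ + 0
      φ-0 = zero-symbol (proj₂ (legendreSymbol (+ 0)))
      units : ∀ i → i < m → Unit (v (suc i))
      units i i<m = unit-≈ (≡⇒≈ (ident (+ i))) (unit-* (unit-≤n {suc (suc i)} (s≤s z≤n) (s≤s i<m))
          (unit-* (unit-≤n {suc i} (s≤s z≤n) (ℕP.m≤n⇒m≤1+n i<m)) (unit-pos {suc (suc (suc i))} (s≤s z≤n) (s≤s (ℕP.≤-trans (s≤s (s≤s i<m)) (ℕP.+-monoˡ-≤ n {1} (s≤s z≤n)))))))
        where
        ident : ∀ i → (+ 2 + i) * ((+ 1 + i) * (+ 3 + i)) ≡ (+ 2 + i) * ((+ 2 + i) * (+ 2 + i) - + 1)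
        ident = solve-∀
      parity : ∀ {L s} → IsSign L → IsSign s → (L - + 1) * (s + + 1) ≈ + 0 [ + 4 ]
      parity {s = s} (inj₁ refl) _ = ≡⇒≈ (ℤP.*-zeroˡ (s + + 1))
      parity (inj₂ refl) (inj₁ refl) = by (- + 1) refl
      parity (inj₂ refl) (inj₂ refl) = ≡⇒≈ refl
      finish : (∃ λ e → IsSign e × ∑ m (φ ∘ v ∘ suc) ≈ + m - + 1 + e [ + 4 ] × e ≈ ∏ m (v ∘ suc) ^ n [ P ]) → ∑ m (φ ∘ v ∘ suc) ≈ - L [ + 4 ]
      finish (e , se , s , pe) = s ⟫ lc3 (+ 1) (+ 1) (+ 1) (≡⇒≈ e-value) (2w-mod-4 w) (parity L-sign (sgn-sign w)) (ident (+ w') e L (sgn w))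
        where
        e-value : e ≡ L * sgn w
        e-value = sign-unique se (sign-* L-sign (sgn-sign w)) (lc4 (- e) L (L * e) L (≡⇒≈ (sign² L-sign)) (≈-*ˡ t pe) L≈t ∏v^n (ident' e L t (∏ m (v ∘ suc) ^ n) (sgn w)))
          where
          ident' : ∀ e L t W s → e - L * s ≡ - e * (L * L - + 1) + L * (t * e - t * W) + L * e * (L - t) + L * (t * W - s)
          ident' = solve-∀
        ident : ∀ w' e L s → w' + (+ 1 + w') - + 1 + e - - L ≡ + 1 * (e - L * s) + + 1 * (+ 1 + w' + (+ 1 + w') - (+ 1 - s)) + + 1 * ((L - + 1) * (s + + 1) - + 0)
        ident = solve-∀

    h₁≡-Lx : ∀ x y → P ≡ x * x + y * y → x ≈ + 1 [ + 4 ] → y ≈ + 0 [ + 2 ] → h₁ ≡ - (L * x)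
    h₁≡-Lx x y xy x₄ y₂ = use sum-of-squares
      where
      use : (∃ λ k → h₁ * h₁ + h k * h k ≡ P) → h₁ ≡ - (L * x)
      use (k , hk) = elc2 (- L) (- h₁) (TwoSquares.unique (n ℕ.+ n) pr (- (L * h₁)) (h k) x y
            (trans (elc1 (h₁ * h₁) (sign² L-sign) (e₀ L h₁ (h k))) hk) (sym xy)
            (lc2 (- L) (+ 1) h₁-mod-4 (≡⇒≈ (sign² L-sign)) (e₁ L h₁)) x₄ y₂)
          (sign² L-sign) (e₂ L h₁ x)
        where
        e₀ : ∀ L h g → - (L * h) * - (L * h) + g * g - (h * h + g * g) ≡ h * h * (L * L - + 1)
        e₀ = solve-∀
        e₁ : ∀ L h → - (L * h) - + 1 ≡ - L * (h - - L) + + 1 * (L * L - + 1)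
        e₁ = solve-∀
        e₂ : ∀ L h x → h - - (L * x) ≡ - L * (- (L * h) - x) + - h * (L * L - + 1)
        e₂ = solve-∀

-- V(1) through the series Ê, and V(-2) by reflection

module Kummer (m : ℕ) (pr : Prime (suc (suc m ℕ.+ suc m))) where

  open import Data.Integer using (_+_; _*_; _-_; -_; _^_)

  open Harmonic m pr public

  D : ℤ
  D = ∑ (suc n) c

  E : ℕ → ℤ
  E j = (+ 1 + (+ j + + j)) * c j * ι (+ suc j)

  Ê : ℤ
  Ê = ∑ (suc n) E

  Leg-at-1 : Leg n (+ 1) ≡ D
  Leg-at-1 = ∑-cong (suc n) (λ k _ → trans (cong (c k *_) (ℤP.^-zeroˡ k)) (ℤP.*-identityʳ (c k)))

  unit-n+1 : Unit (+ suc n)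
  unit-n+1 = unit-pos (s≤s z≤n) (s≤s (s≤s (ℕP.m≤n+m n m)))

  ι-n+1 : ι (+ suc n) ≈ + 2 [ P ]
  ι-n+1 = cancel (+ suc n) unit-n+1 (lc2 (+ 1) (- + 1) (ι-inverse₁ unit-n+1) P≈0 (ident (+ n) (ι (+ suc n))))
    where
    ident : ∀ n i → (+ 1 + n) * i - (+ 1 + n) * + 2 ≡ + 1 * ((+ 1 + n) * i - + 1) + - + 1 * (+ 1 + (n + n) - + 0)
    ident = solve-∀

  -- The left side is 4(k+1) c(k+1)/(2k+1), and (k+1)² c(k+1) ≡ -(2k+1)²/4 · c(k) modulo p².
  V-term : ∀ k → suc k ≤ n → + 2 * (c (suc k) * ι (+ suc k + + suc k - + 1) + c (suc k)) ≈ - E k [ P² ]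
  V-term k k<n = cancel² (+ suc k * + suc k) (unit-* u u) (cancel² d (unit-2k-1 (suc k) k<n)
    (lc4 (+ 2 * (+ suc k * + suc k * c (suc k))) (+ 4 * + suc k) (+ suc k * d * d * c k) (+ suc k * c k)
      (ι-inverse (unit-2k-1 (suc k) k<n)) (≡⇒≈ (coef-up n k)) (ι-inverse u) (modulus≈0 (+ 1))
      (ident (c (suc k)) (c k) (ι d) (ι (+ suc k)) (+ n) (+ k))))
    where
    d : ℤ
    d = + suc k + + suc k - + 1
    u : Unit (+ suc k)
    u = unit-≤n (s≤s z≤n) k<n
    ident : ∀ C' X i e n k → let K = + 1 + k ; d = K + K - + 1 ; P = + 1 + (n + n) in
      d * (K * K * (+ 2 * (C' * i + C'))) - d * (K * K * - ((+ 1 + (k + k)) * X * e))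
      ≡ + 2 * (K * K * C') * (d * i - + 1) + + 4 * K * (K * K * C' - (n - k) * (+ 1 + (n + k)) * X) + K * d * d * X * (K * e - + 1) + K * X * (+ 1 * (P * P) - + 0)
    ident = solve-∀

  -- The shifted sum produces E 0, ..., E m only. Completing it to Ê adds E n, whose weight 2n + 1
  -- is p; this is the term in c(n).
  V-at-1 : + 2 * (V (+ 1) + D) ≈ - Ê + + 2 * P * c n [ P² ]
  V-at-1 = ≡⇒≈ (trans (cong (λ z → + 2 * (z + D)) (∑-cong (suc n) (λ k _ → cong (_* ι (+ k + + k - + 1)) (trans (cong (c k *_) (ℤP.^-zeroˡ k)) (ℤP.*-identityʳ (c k))))))
      (trans (cong (+ 2 *_) (sym (∑-+ (suc n) g c))) (trans (sym (∑-*ˡ (suc n) (+ 2) (λ k → g k + c k))) (∑-first n (λ k → + 2 * (g k + c k))))))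
    ⟫ ≈-+ zeroth (∑-≈ n (λ k k<n → V-term k k<n))
    ⟫ ≡⇒≈ (trans (ℤP.+-identityˡ (∑ n (λ k → - E k))) (trans (∑-cong n (λ k _ → sym (ℤP.-1*i≡-i (E k)))) (∑-*ˡ n (- + 1) E)))
    ⟫ lc1 (c n) (scale P ι-n+1) (ident (∑ n E) P (c n) (ι (+ suc n)))
    where
    g : ℕ → ℤ
    g k = c k * ι (+ k + + k - + 1)
    zeroth : + 2 * (g 0 + c 0) ≈ + 0 [ P² ]
    zeroth = lc1 (+ 2) (ι-unique {b = - + 1} (unit-2k-1 0 z≤n) (≡⇒≈ refl)) (ident₀ (ι (- + 1)))
      where
      ident₀ : ∀ i → + 2 * (+ 1 * i + + 1) - + 0 ≡ + 2 * (i - - + 1)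
      ident₀ = solve-∀
    ident : ∀ S P c i → - + 1 * S - (- (S + P * c * i) + + 2 * P * c) ≡ c * (P * i - P * + 2)
    ident = solve-∀

  -- x ↦ -1 - x exchanges 1 and -2, so the parity of P_n and P_(n-1) carries `V-formula` from one
  -- point to the other, once its boundary terms are subtracted.
  V-reflect : sgn n * (V (- + 2) - P * c n * (- + 2) ^ suc n) ≈ - (V (+ 1) - P * c n) - D [ P² ]
  V-reflect = lc4 (sgn n) (+ 1) (sgn n * (+ 1 + + 3 * + n)) (sgn n * + n) (V-formula (- + 2)) (V-formula (+ 1) ⟫ lc1 (P * c n) (≡⇒≈ (ℤP.^-zeroˡ (suc n))) (ident₀ (- (+ 1 + + 1) * Leg n (+ 1) - + n * ((+ 1 + + 2 * + 1) * Leg n (+ 1) - Leg m (+ 1))) (P * c n) ((+ 1) ^ suc n)))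
      (≡⇒≈ (Leg-reflect n (+ 1))) (≡⇒≈ (Leg-reflect m (+ 1)))
      (trans (cong (λ z → sgn n * (V (- + 2) - P * c n * (- + 2) ^ suc n) - (- (V (+ 1) - P * c n) - z)) (sym Leg-at-1))
        (ident₁ (V (- + 2)) (V (+ 1)) (Leg n (- + 2)) (Leg m (- + 2)) (Leg n (+ 1)) (Leg m (+ 1)) (P * c n) ((- + 2) ^ suc n) (+ n) (sgn m) (sgn² m)))
    where
    ident₀ : ∀ x y z → x + y * z - (x + y) ≡ y * (z - + 1)
    ident₀ = solve-∀
    ident₁ : ∀ v₂ v₁ a₂ b₂ a b y z n s → s * s ≡ + 1 →
      - + 1 * s * (v₂ - y * z) - (- (v₁ - y) - a)
      ≡ - + 1 * s * (v₂ - (- (+ 1 + - + 2) * a₂ - n * ((+ 1 + + 2 * - + 2) * a₂ - b₂) + y * z))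
        + + 1 * (v₁ - (- (+ 1 + + 1) * a - n * ((+ 1 + + 2 * + 1) * a - b) + y))
        + - + 1 * s * (+ 1 + + 3 * n) * (a₂ - - + 1 * s * a) + - + 1 * s * n * (b₂ - s * b)
    ident₁ v₂ v₁ a₂ b₂ a b y z n s e = elc1 ((+ 1 + + 3 * n) * a - n * b) e (ident₂ v₂ v₁ a₂ b₂ a b y z n s)
      where
      ident₂ : ∀ v₂ v₁ a₂ b₂ a b y z n s →
        - + 1 * s * (v₂ - y * z) - (- (v₁ - y) - a)
        - (- + 1 * s * (v₂ - (- (+ 1 + - + 2) * a₂ - n * ((+ 1 + + 2 * - + 2) * a₂ - b₂) + y * z))
          + + 1 * (v₁ - (- (+ 1 + + 1) * a - n * ((+ 1 + + 2 * + 1) * a - b) + y))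
          + - + 1 * s * (+ 1 + + 3 * n) * (a₂ - - + 1 * s * a) + - + 1 * s * n * (b₂ - s * b))
        ≡ ((+ 1 + + 3 * n) * a - n * b) * (s * s - + 1)
      ident₂ = solve-∀

-- Averaging two conjugate Kummer series

module KummerSum (m : ℕ) (pr : Prime (suc (suc m ℕ.+ suc m))) where

  open import Data.Integer using (_+_; _*_; _-_; -_; _^_)

  open Kummer m pr public

  -- Conjugate deformations of j + 1: exchanging p and -p exchanges ĝ and ĥ.
  ĝ ĥ : ℕ → ℤ
  ĝ j = sgn j * bin (n ℕ.+ m) j
  ĥ j = bin (suc (suc (n ℕ.+ n)) ℕ.+ j) j

  ĝ-suc : ∀ j → + suc j * ĝ (suc j) ≡ (+ 2 + + j - P) * ĝ j
  ĝ-suc j = elc1 (- sgn j) (bin-upper (n ℕ.+ m) j) (ident (sgn j) (bin (n ℕ.+ m) (suc j)) (bin (n ℕ.+ m) j) (+ m) (+ j))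
    where
    ident : ∀ s B b m j → (+ 1 + j) * (- + 1 * s * B) - (+ 2 + j - (+ 1 + (+ 1 + m + (+ 1 + m)))) * (s * b)
      ≡ - s * ((+ 1 + j) * B - (+ 1 + m + m - j) * b)
    ident = solve-∀

  ĥ-suc : ∀ j → + suc j * ĥ (suc j) ≡ (+ 2 + + j + P) * ĥ j
  ĥ-suc j = trans (cong (λ z → + suc j * bin (suc (suc z)) (suc j)) (ℕP.+-suc (n ℕ.+ n) j))
    (trans (bin-absorb (suc (suc (n ℕ.+ n)) ℕ.+ j) j) (cong (_* ĥ j) (ident (+ (n ℕ.+ n)) (+ j))))
    where
    ident : ∀ q j → + 1 + (+ 2 + q + j) ≡ + 2 + j + (+ 1 + q)
    ident = solve-∀

  ĝ≈ : ∀ j → j ≤ n → ĝ j ≈ + suc j [ P ]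
  ĝ≈ zero    _   = ≡⇒≈ refl
  ĝ≈ (suc j) j<n = cancel (+ suc j) (unit-≤n (s≤s z≤n) j<n) (lc3 (+ 1) (- ĝ j) (+ 2 + + j) (≡⇒≈ (ĝ-suc j)) P≈0 (ĝ≈ j (ℕP.<⇒≤ j<n)) (ident (ĝ (suc j)) (ĝ j) (+ j) P))
    where
    ident : ∀ G g j P → (+ 1 + j) * G - (+ 1 + j) * (+ 2 + j) ≡ + 1 * ((+ 1 + j) * G - (+ 2 + j - P) * g) + - g * (P - + 0) + (+ 2 + j) * (g - (+ 1 + j))
    ident = solve-∀

  ĥ≈ : ∀ j → j ≤ n → ĥ j ≈ + suc j [ P ]
  ĥ≈ zero    _   = ≡⇒≈ refl
  ĥ≈ (suc j) j<n = cancel (+ suc j) (unit-≤n (s≤s z≤n) j<n) (lc3 (+ 1) (ĥ j) (+ 2 + + j) (≡⇒≈ (ĥ-suc j)) P≈0 (ĥ≈ j (ℕP.<⇒≤ j<n)) (ident (ĥ (suc j)) (ĥ j) (+ j) P))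
    where
    ident : ∀ G g j P → (+ 1 + j) * G - (+ 1 + j) * (+ 2 + j) ≡ + 1 * ((+ 1 + j) * G - (+ 2 + j + P) * g) + g * (P - + 0) + (+ 2 + j) * (g - (+ 1 + j))
    ident = solve-∀

  ĝĥ : ∀ j → j ≤ n → ĝ j * ĥ j ≈ + suc j * + suc j [ P² ]
  ĝĥ zero    _   = ≡⇒≈ refl
  ĝĥ (suc j) j<n = cancel² (+ suc j * + suc j) (unit-* u u)
    (lc4 (+ suc j * ĥ (suc j)) ((+ 2 + + j - P) * ĝ j) ((+ 2 + + j) * (+ 2 + + j)) (- (ĝ j * ĥ j)) (≡⇒≈ (ĝ-suc j)) (≡⇒≈ (ĥ-suc j)) (ĝĥ j (ℕP.<⇒≤ j<n)) (modulus≈0 (+ 1))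
      (ident (ĝ (suc j)) (ĥ (suc j)) (ĝ j) (ĥ j) (+ j) P))
    where
    u : Unit (+ suc j)
    u = unit-≤n (s≤s z≤n) j<n
    ident : ∀ G H g h j P → (+ 1 + j) * (+ 1 + j) * (G * H) - (+ 1 + j) * (+ 1 + j) * ((+ 2 + j) * (+ 2 + j))
      ≡ (+ 1 + j) * H * ((+ 1 + j) * G - (+ 2 + j - P) * g) + (+ 2 + j - P) * g * ((+ 1 + j) * H - (+ 2 + j + P) * h)
        + (+ 2 + j) * (+ 2 + j) * (g * h - (+ 1 + j) * (+ 1 + j)) + - (g * h) * (+ 1 * (P * P) - + 0)
    ident = solve-∀

  unit-suc : ∀ {j} → j ≤ n → Unit (+ suc j)
  unit-suc j≤n = unit-pos (s≤s z≤n) (s≤s (ℕP.≤-trans (s≤s j≤n) (ℕP.+-monoˡ-≤ n {1} (s≤s z≤n))))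

  unit-ĥ : ∀ j → j ≤ n → Unit (ĥ j)
  unit-ĥ j j≤n = unit-≈ (≈-sym (ĥ≈ j j≤n)) (unit-suc j≤n)

  unit-n : Unit (+ n)
  unit-n = unit-≤n (s≤s z≤n) ℕP.≤-refl

  G : ℤ
  G = bin (n ℕ.+ m) n

  2G : + 2 * G ≡ central n
  2G = cancel-suc m (elc1 (- + 1) (trans (cong (λ z → (+ suc (n ℕ.+ m) - + n) * bin z n) (ℕP.+-suc n m)) (bin-lower (n ℕ.+ m) n)) (ident (+ m) G (central n)))
    where
    ident : ∀ m g c → (+ 1 + m) * (+ 2 * g) - (+ 1 + m) * c ≡ - + 1 * ((+ 1 + (+ 1 + m + m) - (+ 1 + m)) * c - (+ 1 + (+ 1 + m + m)) * g)
    ident = solve-∀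

  unit-G : Unit G
  unit-G = unit-*ʳ (+ 2) (unit-≈ (≡⇒≈ (sym 2G)) unit-central-n)

  -- A j / G is c(j)(n - j)/(n ĝ(j)) and B j is c(j)(n + 1 + j)/((n + 1) ĥ(j)); under p ↦ -p, that
  -- is n ↦ -(n+1), they are exchanged. A is written with binomials so that its sum is an
  -- alternating convolution of degree m.
  A B : ℕ → ℤ
  A j = sgn j * multiset n j * multiset n (m ∸ j)
  B j = c j * (+ suc n + + j) * (ι (+ suc n) * ι (ĥ j))

  A-value : ∀ j → j ≤ m → A j * (+ n * bin (n ℕ.+ m) j) ≡ sgn j * G * ((+ n - + j) * c j)
  A-value j j≤m = trans (cong (λ z → sgn j * z * X * (+ n * b)) (bin-sym n j))
      (elc2 (sgn j * Y * + n) (- (sgn j * Y * G)) chain (bin-lower m j) (ident (sgn j) X Y b G (bin m j) (bin n j) (+ n) (+ j)))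
    where
    i : ℕ
    i = m ∸ j
    j+i : j ℕ.+ i ≡ m
    j+i = ℕP.m+[n∸m]≡n j≤m
    X Y b : ℤ
    X = multiset n i
    Y = bin (n ℕ.+ j) j
    b = bin (n ℕ.+ m) j
    chain : b * X ≡ G * bin m j
    chain = trans (cong (λ z → bin z j * X) (trans (cong (n ℕ.+_) (sym j+i)) (trans (sym (ℕP.+-assoc n j i)) (trans (cong (ℕ._+ i) (ℕP.+-comm n j)) (ℕP.+-assoc j n i)))))
      (trans (bin-swap j n i) (cong (λ z → bin (n ℕ.+ z) n * bin z j) j+i))
    ident : ∀ s X Y b G β B n j → s * Y * X * (n * b) - s * G * ((n - j) * (B * Y))
      ≡ s * Y * n * (b * X - G * β) + - (s * Y * G) * ((n - j) * B - n * β)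
    ident = solve-∀

  -- A j / G and B j both reduce to E j modulo p and are conjugate, so their first-order terms in p
  -- are opposite.
  2E≈A+B : ∀ j → j ≤ m → G * (+ 2 * E j) ≈ A j + G * B j [ P² ]
  2E≈A+B j j≤m = cancel² (s * (+ n * b) * (k * (h′ * + suc n))) (unit-* (unit-* (unit-sgn j) (unit-* unit-n unit-b)) (unit-* (unit-suc j≤n) (unit-* (unit-ĥ j j≤n) unit-n+1)))
      steps
    where
    j≤n : j ≤ n
    j≤n = ℕP.m≤n⇒m≤1+n j≤m
    s b k h′ : ℤ
    s = sgn j
    b = bin (n ℕ.+ m) j
    k = + suc j
    h′ = ĥ j
    unit-b : Unit b
    unit-b = unit-*ʳ s (unit-≈ (≈-sym (ĝ≈ j j≤n)) (unit-suc j≤n))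
    vanish : (ĝ j - k) * (ĥ j - k) ≈ + 0 [ P² ]
    vanish = ≈0²-difference {ĝ j - k} (difference≈0 (ĝ≈ j j≤n)) (ĥ≈ j j≤n)
    -- The claim with denominators cleared and G c(j) taken out; it depends on ĝ and ĥ only through
    -- their product modulo p² and their values modulo p.
    bracket : + 2 * (ĝ j * ĥ j) * (+ n * + suc n) * (+ 1 + (+ j + + j)) - k * (ĥ j * (+ suc n * (+ n - + j)) + ĝ j * (+ n * (+ suc n + + j))) ≈ + 0 [ P² ]
    bracket = cancel² (+ 2) unit-2 (lc4 (+ 4 * (+ n * + suc n) * (+ 1 + (+ j + + j)) - + 2 * (+ n * + suc n) + + j) (+ 2 * (+ n * + suc n) - + j) (+ j * k) (+ 2 * + j * k * k)
      (ĝĥ j j≤n) vanish (scale P (ĥ≈ j j≤n ⟫ ≈-sym (ĝ≈ j j≤n))) (modulus≈0 (+ 1)) (e (ĝ j) (ĥ j) (+ n) (+ j)))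
      where
      e : ∀ g h n j → let k = + 1 + j ; N = n * (+ 1 + n) ; P = + 1 + (n + n) in
        + 2 * (+ 2 * (g * h) * N * (+ 1 + (j + j)) - k * (h * ((+ 1 + n) * (n - j)) + g * (n * (+ 1 + n + j)))) - + 2 * + 0
        ≡ (+ 4 * N * (+ 1 + (j + j)) - + 2 * N + j) * (g * h - k * k) + (+ 2 * N - j) * ((g - k) * (h - k) - + 0)
          + j * k * (P * h - P * g) + + 2 * j * k * k * (+ 1 * (P * P) - + 0)
      e = solve-∀
    steps : s * (+ n * b) * (k * (h′ * + suc n)) * (G * (+ 2 * E j)) ≈ s * (+ n * b) * (k * (h′ * + suc n)) * (A j + G * B j) [ P² ]
    steps = lc4 (G * c j) x₁ (- x₂) (- x₃)
        bracket (ι-inverse (unit-suc j≤n)) (≡⇒≈ (A-value j j≤m)) inverses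
        (e s b (ĥ j) G (c j) (A j) (ι k) (ι (+ suc n) * ι (ĥ j)) (+ n) (+ j) (sgn² j))
      where
      x₁ x₂ x₃ : ℤ
      x₁ = + 2 * (ĝ j * ĥ j) * (+ n * + suc n) * (+ 1 + (+ j + + j)) * (G * c j)
      x₂ = s * k * ĥ j * + suc n
      x₃ = ĝ j * + n * k * G * c j * (+ suc n + + j)
      inverses : + suc n * ĥ j * (ι (+ suc n) * ι (ĥ j)) ≈ + 1 [ P² ]
      inverses = ≡⇒≈ (e₀ (+ suc n) (ĥ j) (ι (+ suc n)) (ι (ĥ j))) ⟫ ≈-* (ι-inverse unit-n+1) (ι-inverse (unit-ĥ j j≤n))
        where
        e₀ : ∀ a b c d → a * b * (c * d) ≡ a * c * (b * d)
        e₀ = solve-∀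
      e : ∀ s b h G c a i i' n j → s * s ≡ + 1 → let k = + 1 + j ; n₁ = + 1 + n ; g = s * b in
        s * (n * b) * (k * (h * n₁)) * (G * (+ 2 * ((+ 1 + (j + j)) * c * i))) - s * (n * b) * (k * (h * n₁)) * (a + G * (c * (n₁ + j) * i'))
        ≡ G * c * (+ 2 * (g * h) * (n * n₁) * (+ 1 + (j + j)) - k * (h * (n₁ * (n - j)) + g * (n * (n₁ + j))) - + 0)
          + + 2 * (g * h) * (n * n₁) * (+ 1 + (j + j)) * (G * c) * (k * i - + 1)
          + - (s * k * h * n₁) * (a * (n * b) - s * G * ((n - j) * c))
          + - (g * n * k * G * c * (n₁ + j)) * (n₁ * h * i' - + 1)
      e s b h G c a i i' n j ss = elc1 (- ((+ 1 + j) * h * (+ 1 + n) * G * (n - j) * c)) ss (e' s b h G c a i i' n j)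
        where
        e' : ∀ s b h G c a i i' n j → let k = + 1 + j ; n₁ = + 1 + n ; g = s * b in
          s * (n * b) * (k * (h * n₁)) * (G * (+ 2 * ((+ 1 + (j + j)) * c * i))) - s * (n * b) * (k * (h * n₁)) * (a + G * (c * (n₁ + j) * i'))
          - (G * c * (+ 2 * (g * h) * (n * n₁) * (+ 1 + (j + j)) - k * (h * (n₁ * (n - j)) + g * (n * (n₁ + j))) - + 0)
          + + 2 * (g * h) * (n * n₁) * (+ 1 + (j + j)) * (G * c) * (k * i - + 1)
          + - (s * k * h * n₁) * (a * (n * b) - s * G * ((n - j) * c))
          + - (g * n * k * G * c * (n₁ + j)) * (n₁ * h * i' - + 1))
          ≡ - (k * h * n₁ * G * (n - j) * c) * (s * s - + 1)
        e' = solve-∀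

  -- At j = n the term conjugate to B has the factor n - j = 0. Both E n and B n contain 2n + 1 = p,
  -- so the remaining factors are compared modulo p.
  2E≈B-n : + 2 * E n ≈ B n [ P² ]
  2E≈B-n = ≡⇒≈ (e₁ (c n) (ι (+ suc n)) (+ n)) ⟫ scale P (≈-*ˡ (c n * ι (+ suc n)) (≈-sym (ι-≈ (ĥ≈ n ℕP.≤-refl) ⟫ ι-n+1)))
    ⟫ ≡⇒≈ (e₂ (c n) (ι (+ suc n)) (ι (ĥ n)) (+ n))
    where
    e₁ : ∀ c i n → + 2 * ((+ 1 + (n + n)) * c * i) ≡ (+ 1 + (n + n)) * (c * i * + 2)
    e₁ = solve-∀
    e₂ : ∀ c i i' n → (+ 1 + (n + n)) * (c * i * i') ≡ c * (+ 1 + n + n) * (i * i')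
    e₂ = solve-∀

  2Ê : G * (+ 2 * Ê) ≈ ∑ n A + G * ∑ (suc n) B [ P² ]
  2Ê = ≡⇒≈ (trans (cong (λ z → G * z) (sym (∑-*ˡ (suc n) (+ 2) E))) (ℤP.*-distribˡ-+ G (∑ n (λ j → + 2 * E j)) (+ 2 * E n)))
    ⟫ ≈-+ (≡⇒≈ (sym (∑-*ˡ n G (λ j → + 2 * E j))) ⟫ ∑-≈ n (λ j j<n → 2E≈A+B j (ℕP.≤-pred j<n)) ⟫ ≡⇒≈ (trans (∑-+ n A (λ j → G * B j)) (cong (λ z → ∑ n A + z) (∑-*ˡ n G B)))) (≈-*ˡ G 2E≈B-n)
    ⟫ ≡⇒≈ (e (∑ n A) G (∑ n B) (B n))
    where
    e : ∀ a g x y → a + g * x + g * y ≡ a + g * (x + y)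
    e = solve-∀

-- Beta integrals times p, modulo p²

module KummerResidue (m : ℕ) (pr : Prime (suc (suc m ℕ.+ suc m))) where

  open import Data.Integer using (_+_; _*_; _-_; -_; _^_)

  open KummerSum m pr public

  -- p/x modulo p², with the value 1 at x = p.
  recip-dec : ∀ x → Dec (x ≡ p) → ℤ
  recip-dec x (yes _) = + 1
  recip-dec x (no _)  = P * ι (+ x)

  recip : ℕ → ℤ
  recip x = recip-dec x (x ℕ.≟ p)

  unit-2p : ∀ {x} → 0 < x → x < p ℕ.+ p → x ≢ p → Unit (+ x)
  unit-2p {x} 0<x x<2p x≢p = [ unit-pos 0<x , beyond ]′ (split (ℕP.<-cmp x p))
    where
    split : _ → (x < p) ⊎ (p < x)
    split (tri< l _ _) = inj₁ l
    split (tri≈ _ e _) = ⊥-elim (x≢p e)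
    split (tri> _ _ g) = inj₂ g
    beyond : p < x → Unit (+ x)
    beyond p<x = unit-≈ {a = + (x ∸ p)} (lc2 (- + 1) (+ 1) P≈0 (≡⇒≈ (cong +_ (ℕP.m+[n∸m]≡n (ℕP.<⇒≤ p<x)))) (ident (+ (x ∸ p)) (+ x) P))
      (unit-pos (ℕP.m<n⇒0<n∸m p<x) (ℕP.+-cancelˡ-< p (x ∸ p) p (subst (_< p ℕ.+ p) (sym (ℕP.m+[n∸m]≡n (ℕP.<⇒≤ p<x))) x<2p)))
      where
      ident : ∀ d x P → d - x ≡ - + 1 * (P - + 0) + + 1 * (P + d - x)
      ident = solve-∀

  recip-value : ∀ x → 0 < x → x < p ℕ.+ p → + x * recip x ≈ P [ P² ]
  recip-value x 0<x x<2p = by-cases (x ℕ.≟ p)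
    where
    by-cases : (d : Dec (x ≡ p)) → + x * recip-dec x d ≈ P [ P² ]
    by-cases (yes e) = ≡⇒≈ (trans (ℤP.*-identityʳ (+ x)) (cong +_ e))
    by-cases (no ne) = lc1 P (ι-inverse (unit-2p 0<x x<2p ne)) (ident (+ x) P (ι (+ x)))
      where
      ident : ∀ x P i → x * (P * i) - P ≡ P * (x * i - + 1)
      ident = solve-∀

  recip-p : recip p ≡ + 1
  recip-p = by-cases (p ℕ.≟ p)
    where
    by-cases : (d : Dec (p ≡ p)) → recip-dec p d ≡ + 1
    by-cases (yes _) = refl
    by-cases (no ne) = ⊥-elim (ne refl)

  recip≈0 : ∀ x → x ≢ p → recip x ≈ + 0 [ P ]
  recip≈0 x ne = by-cases (x ℕ.≟ p)
    where
    by-cases : (d : Dec (x ≡ p)) → recip-dec x d ≈ + 0 [ P ]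
    by-cases (yes e) = ⊥-elim (ne e)
    by-cases (no _)  = lc1 (ι (+ x)) P≈0 (ident P (ι (+ x)))
      where
      ident : ∀ P i → P * i - + 0 ≡ i * (P - + 0)
      ident = solve-∀

  -- p times the beta value B(x, k+1), taken modulo p². Arguments up to 2p are needed because the
  -- range from x to x + k may contain p.
  β : ℕ → ℕ → ℤ
  β = differences recip

  β-step : ∀ k x → 0 < x → suc (x ℕ.+ k) < p ℕ.+ p → β k (suc x) * (+ 1 + (+ x + + k)) ≈ β k x * + x [ P² ]
  β-step zero x 0<x x<2p = ≡⇒≈ (trans (cong (λ z → β 0 (suc x) * + suc z) (ℕP.+-identityʳ x)) (ℤP.*-comm (β 0 (suc x)) (+ suc x)))
    ⟫ recip-value (suc x) (s≤s z≤n) (subst (λ z → suc z < p ℕ.+ p) (ℕP.+-identityʳ x) x<2p)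
    ⟫ ≈-sym (recip-value x 0<x (ℕP.<-trans ℕP.≤-refl (subst (λ z → suc z < p ℕ.+ p) (ℕP.+-identityʳ x) x<2p)))
    ⟫ ≡⇒≈ (ℤP.*-comm (+ x) (β 0 x))
  β-step (suc k) x 0<x x<2p = lc2 (- + 1) (+ 1) (β-step k (suc x) (s≤s z≤n) bound) (β-step k x 0<x (ℕP.<-trans ℕP.≤-refl bound))
      (ident (β k x) (β k (suc x)) (β k (suc (suc x))) (+ x) (+ k))
    where
    bound : suc (suc (x ℕ.+ k)) < p ℕ.+ p
    bound = subst (λ z → suc z < p ℕ.+ p) (ℕP.+-suc x k) x<2p
    ident : ∀ a b c x k → (b - c) * (+ 1 + (x + (+ 1 + k))) - (a - b) * x
      ≡ - + 1 * (c * (+ 1 + (+ 1 + x + k)) - b * (+ 1 + x)) + + 1 * (b * (+ 1 + (x + k)) - a * x)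
    ident = solve-∀

  β-value : ∀ k y → 0 < y → y ℕ.+ k < p → β k y * (+ y * bin (y ℕ.+ k) k) ≈ P [ P² ]
  β-value zero y 0<y y<p = ≡⇒≈ (trans (cong (recip y *_) (ℤP.*-identityʳ (+ y))) (ℤP.*-comm (recip y) (+ y)))
    ⟫ recip-value y 0<y (ℕP.<-≤-trans (subst (_< p) (ℕP.+-identityʳ y) y<p) (ℕP.m≤m+n p p))
  β-value (suc k) y 0<y y<p = cancel² (+ suc k) (unit-pos (s≤s z≤n) (ℕP.≤-<-trans (ℕP.m≤n+m (suc k) y) y<p))
    (lc4 ((β k y - β k (suc y)) * + y) (+ 1 + (+ y + + k)) (- (+ y * bin (y ℕ.+ k) k)) (- + y)
      (≡⇒≈ (trans (cong (λ z → + suc k * bin z (suc k)) (ℕP.+-suc y k)) (bin-absorb (y ℕ.+ k) k)))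
      ih (β-step k y 0<y (ℕP.<-≤-trans bound (ℕP.m≤m+n p p))) ih
      (ident (β k y) (β k (suc y)) (bin (y ℕ.+ suc k) (suc k)) (bin (y ℕ.+ k) k) (+ y) (+ k) P))
    where
    bound : suc (y ℕ.+ k) < p
    bound = subst (_< p) (ℕP.+-suc y k) y<p
    ih : β k y * (+ y * bin (y ℕ.+ k) k) ≈ P [ P² ]
    ih = β-value k y 0<y (ℕP.<-trans ℕP.≤-refl bound)
    ident : ∀ u v B b y k P → (+ 1 + k) * ((u - v) * (y * B)) - (+ 1 + k) * P
      ≡ (u - v) * y * ((+ 1 + k) * B - (+ 1 + (y + k)) * b) + (+ 1 + (y + k)) * (u * (y * b) - P)
        + - (y * b) * (v * (+ 1 + (y + k)) - u * y) + - y * (u * (y * b) - P)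
    ident = solve-∀

  β≈0 : ∀ k x → p < x → β k x ≈ + 0 [ P ]
  β≈0 zero    x p<x = recip≈0 x (λ e → ℕP.<⇒≢ p<x (sym e))
  β≈0 (suc k) x p<x = lc2 (+ 1) (- + 1) (β≈0 k x p<x) (β≈0 k (suc x) (ℕP.m≤n⇒m≤1+n p<x)) (ident (β k x) (β k (suc x)))
    where
    ident : ∀ a b → a - b - + 0 ≡ + 1 * (a - + 0) + - + 1 * (b - + 0)
    ident = solve-∀

  -- Modulo p only `recip p` = 1 survives, and it has the coefficient (-1)^i C(k,i) in the k-th
  -- difference.
  β≈bin : ∀ k i x → x ℕ.+ i ≡ p → β k x ≈ sgn i * bin k i [ P ]
  β≈bin zero    zero    x e = ≡⇒≈ (trans (cong recip (trans (sym (ℕP.+-identityʳ x)) e)) recip-p)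
  β≈bin zero    (suc i) x e = recip≈0 x (λ x=p → ℕP.m+1+n≢m x (trans e (sym x=p))) ⟫ ≡⇒≈ (sym (ℤP.*-zeroʳ (sgn (suc i))))
  β≈bin (suc k) zero    x e = lc2 (+ 1) (- + 1) (β≈bin k zero x e) (β≈0 k (suc x) (s≤s (ℕP.≤-reflexive (trans (sym e) (ℕP.+-identityʳ x))))) (ident (β k x) (β k (suc x)))
    where
    ident : ∀ a b → a - b - + 1 * + 1 ≡ + 1 * (a - + 1 * + 1) + - + 1 * (b - + 0)
    ident = solve-∀
  β≈bin (suc k) (suc i) x e = lc2 (+ 1) (- + 1) (β≈bin k (suc i) x e) (β≈bin k i (suc x) (trans (sym (ℕP.+-suc x i)) e)) (ident (β k x) (β k (suc x)) (sgn i) (bin k i) (bin k (suc i)))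
    where
    ident : ∀ a b s x y → a - b - - + 1 * s * (x + y) ≡ + 1 * (a - - + 1 * s * y) + - + 1 * (b - s * x)
    ident = solve-∀

  -- The substitution u = t² in the integral of t^(2y-1) (1-t²)^k; both sides obey the same
  -- difference rule in k and y.
  2kummer : ∀ k y → 0 < y → y ℕ.+ k < p → + 2 * kummer recip k (y ℕ.+ y) ≈ β k y [ P² ]
  2kummer zero y 0<y y<p = cancel² (+ y) (unit-pos 0<y y<p')
    (lc3 (+ 1) (- + 1) (+ y + + y) (recip-value (y ℕ.+ y) (ℕP.<-≤-trans 0<y (ℕP.m≤m+n y y)) (ℕP.+-mono-< y<p' y<p')) (recip-value y 0<y (ℕP.<-≤-trans y<p' (ℕP.m≤m+n p p)))
      (≡⇒≈ (cong recip (ℕP.+-identityʳ (y ℕ.+ y)))) (ident (+ y) (recip (y ℕ.+ y)) (recip y) (recip (y ℕ.+ y ℕ.+ 0)) P))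
    where
    y<p' : y < p
    y<p' = subst (_< p) (ℕP.+-identityʳ y) y<p
    ident : ∀ y a b a' P → y * (+ 2 * (+ 0 + + 1 * a')) - y * b ≡ + 1 * ((y + y) * a - P) + - + 1 * (y * b - P) + (y + y) * (a' - a)
    ident = solve-∀
  2kummer (suc k) y 0<y y<p = ≡⇒≈ (cong (+ 2 *_) (trans (kummer-suc recip k (y ℕ.+ y)) (cong (λ z → kummer recip k (y ℕ.+ y) - kummer recip k (suc z)) (sym (ℕP.+-suc y y)))))
    ⟫ lc2 (+ 1) (- + 1) (2kummer k y 0<y (ℕP.<-trans ℕP.≤-refl bound)) (2kummer k (suc y) (s≤s z≤n) bound)
        (ident (kummer recip k (y ℕ.+ y)) (kummer recip k (suc y ℕ.+ suc y)) (β k y) (β k (suc y)))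
    where
    bound : suc (y ℕ.+ k) < p
    bound = subst (_< p) (ℕP.+-suc y k) y<p
    ident : ∀ a b c d → + 2 * (a - b) - (c - d) ≡ + 1 * (+ 2 * a - c) + - + 1 * (+ 2 * b - d)
    ident = solve-∀

  β₀ : ℤ
  β₀ = β n (suc (suc n))

  -- As functions of j both sides are hypergeometric terms with the same ratio. So B j is, up to the
  -- constant `β₀`, the j-th term of Kummer's sum at n + 2.
  β-ratio : ∀ j → j ≤ n → + suc n * ĥ j * (bin n j * β n (suc (suc n) ℕ.+ j)) ≈ c j * (+ suc n + + j) * β₀ [ P² ]
  β-ratio zero    _   = ≡⇒≈ (trans (cong (λ z → + suc n * + 1 * (+ 1 * β n z)) (ℕP.+-identityʳ (suc (suc n)))) (ident (+ suc n) β₀))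
    where
    ident : ∀ n b → n * + 1 * (+ 1 * b) ≡ + 1 * (n + + 0) * b
    ident = solve-∀
  β-ratio (suc j) j<n = cancel² (+ suc j * + suc j) (unit-* u u)
    (≡⇒≈ (cong (λ z → + suc j * + suc j * (+ suc n * ĥ (suc j) * (bin n (suc j) * β n z))) (ℕP.+-suc (suc (suc n)) j))
     ⟫ lc4 (+ suc n * (+ suc j * bin n (suc j) * β')) (+ suc n * ((+ 2 + + j + P) * ĥ j) * β') (+ suc n * ĥ j * (+ n - + j) * bin n j) (- ((+ 2 + + n + + j) * β₀))
        (≡⇒≈ (ĥ-suc j)) (≡⇒≈ (bin-upper n j)) (β-step n (suc (suc n) ℕ.+ j) (s≤s z≤n) bound) (≡⇒≈ (coef-up n j))
        (ident₁ (ĥ (suc j)) (ĥ j) (bin n (suc j)) (bin n j) β' (β n (suc (suc n) ℕ.+ j)) (c (suc j)) (c j) β₀ (+ n) (+ j))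
     ⟫ lc1 ((+ n - + j) * (+ 2 + + n + + j)) (β-ratio j (ℕP.<⇒≤ j<n))
        (ident₂ (ĥ j) (bin n j) (β n (suc (suc n) ℕ.+ j)) (c (suc j)) (c j) β₀ (+ n) (+ j)))
    where
    u : Unit (+ suc j)
    u = unit-≤n (s≤s z≤n) j<n
    β' : ℤ
    β' = β n (suc (suc (suc n) ℕ.+ j))
    bound : suc (suc (suc n) ℕ.+ j ℕ.+ n) < p ℕ.+ p
    bound = s≤s (ℕP.≤-trans (s≤s (s≤s (s≤s (ℕP.≤-trans (ℕP.+-monoˡ-≤ n (ℕP.+-monoʳ-≤ n (ℕP.≤-pred j<n))) (ℕP.≤-reflexive (e₁ n m))))))
        (ℕP.≤-trans (ℕP.m≤m+n (suc (suc (suc (n ℕ.+ n ℕ.+ m)))) m) (ℕP.≤-reflexive (e₂ m))))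
      where
      e₁ : ∀ n m → n ℕ.+ m ℕ.+ n ≡ n ℕ.+ n ℕ.+ m
      e₁ = ℕ-solve-∀
      e₂ : ∀ m → suc (suc (suc (suc m ℕ.+ suc m ℕ.+ m))) ℕ.+ m ≡ suc m ℕ.+ suc m ℕ.+ suc (suc m ℕ.+ suc m)
      e₂ = ℕ-solve-∀
    ident₁ : ∀ H h B b β' β C' c β₀ n j → let P = + 1 + (n + n) ; k = + 1 + j in
      k * k * ((+ 1 + n) * H * (B * β')) - (k * k * (C' * (+ 1 + n + k) * β₀) + ((+ 1 + n) * h * (n - j) * b * (β * (+ 2 + n + j)) - (+ 2 + n + j) * β₀ * ((n - j) * (+ 1 + (n + j)) * c)))
      ≡ (+ 1 + n) * (k * B * β') * (k * H - (+ 2 + j + P) * h) + (+ 1 + n) * ((+ 2 + j + P) * h) * β' * (k * B - (n - j) * b)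
        + (+ 1 + n) * h * (n - j) * b * (β' * (+ 1 + (+ 2 + n + j + n)) - β * (+ 2 + n + j))
        + - ((+ 2 + n + j) * β₀) * (k * k * C' - (n - j) * (+ 1 + (n + j)) * c)
    ident₁ = solve-∀
    ident₂ : ∀ h b β C' c β₀ n j → let k = + 1 + j in
      k * k * (C' * (+ 1 + n + k) * β₀) + ((+ 1 + n) * h * (n - j) * b * (β * (+ 2 + n + j)) - (+ 2 + n + j) * β₀ * ((n - j) * (+ 1 + (n + j)) * c)) - k * k * (C' * (+ 1 + n + k) * β₀)
      ≡ (n - j) * (+ 2 + n + j) * ((+ 1 + n) * h * (b * β) - c * (+ 1 + n + j) * β₀)
    ident₂ = solve-∀

  ∑B : β₀ * ∑ (suc n) B ≈ kummer recip n (suc (suc n)) [ P² ]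
  ∑B = ≡⇒≈ (sym (∑-*ˡ (suc n) β₀ B)) ⟫ ∑-≈ (suc n) (λ j j≤n → term j (ℕP.≤-pred j≤n))
    where
    term : ∀ j → j ≤ n → β₀ * B j ≈ bin n j * β n (suc (suc n) ℕ.+ j) [ P² ]
    term j j≤n = lc3 (- (ι (+ suc n) * ι (ĥ j))) (bin n j * β n (suc (suc n) ℕ.+ j)) (+ suc n * ι (+ suc n) * (bin n j * β n (suc (suc n) ℕ.+ j)))
      (β-ratio j j≤n) (ι-inverse unit-n+1) (ι-inverse (unit-ĥ j j≤n))
      (ident (ĥ j) (bin n j * β n (suc (suc n) ℕ.+ j)) (c j) (ι (+ suc n)) (ι (ĥ j)) β₀ (+ suc n) (+ j))
      where
      ident : ∀ h b c i i' β₀ k j → β₀ * (c * (k + j) * (i * i')) - b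
        ≡ - (i * i') * (k * h * b - c * (k + j) * β₀) + b * (k * i - + 1) + k * i * b * (h * i' - + 1)
      ident = solve-∀

-- The value of Ê for p = 4w + 1

module QuarterKummer (w' : ℕ) (pr : Prime (suc (suc (w' ℕ.+ suc w') ℕ.+ suc (w' ℕ.+ suc w')))) where

  open import Data.Integer using (_+_; _*_; _-_; -_; _^_)

  open JacobsthalSign w' pr public
  private
    m : ℕ
    m = w' ℕ.+ suc w'
  open KummerResidue m pr using (Ê; A; B; G; unit-G; 2Ê; ∑B; β; β₀; β≈bin; β-value; 2kummer; recip)

  -- The degree m = 2w - 1 is odd, so reversal changes the sign of every term.
  ∑A≡0 : ∑ n A ≡ + 0
  ∑A≡0 = ∑-antisymmetric m A (λ j j≤m → trans (cong₂ (λ s z → s * multiset n (m ∸ j) * multiset n z) (sgn-∸ j≤m) (ℕP.m∸[m∸n]≡n j≤m))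
      (elc1 (- (sgn j * multiset n j * multiset n (m ∸ j))) sgn-n (e (sgn m) (sgn j) (multiset n j) (multiset n (m ∸ j)))))
    where
    e : ∀ s s' x y → s * s' * y * x - - (s' * x * y) ≡ - (s' * x * y) * (- + 1 * s - + 1)
    e = solve-∀

  b : ℤ
  b = β n (suc w)

  w+1+n<p : suc w ℕ.+ n < p
  w+1+n<p = s≤s (ℕP.+-monoˡ-≤ n (s≤s (ℕP.m≤n+m (suc w') w')))

  -- n + 2 = 2(w + 1) is even, so `2kummer` evaluates the sum of B.
  4β₀Ê : + 4 * β₀ * Ê ≈ b [ P² ]
  4β₀Ê = cancel² G unit-G (lc3 (+ 2 * β₀) (+ 2 * G) G (2Ê ⟫ ≡⇒≈ (trans (cong (_+ G * ∑ (suc n) B) ∑A≡0) (ℤP.+-identityˡ (G * ∑ (suc n) B)))) ∑B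
    (≡⇒≈ (cong (λ z → + 2 * kummer recip n (suc z)) (sym (ℕP.+-suc w w))) ⟫ 2kummer n (suc w) (s≤s z≤n) w+1+n<p)
    (e G β₀ Ê (∑ (suc n) B) (kummer recip n (suc (suc n))) b))
    where
    e : ∀ G β E B K b → G * (+ 4 * β * E) - G * b ≡ + 2 * β * (G * (+ 2 * E) - G * B) + + 2 * G * (β * B - K) + G * (+ 2 * K - b)
    e = solve-∀

  2β₀≈1 : + 2 * β₀ ≈ + 1 [ P ]
  2β₀≈1 = lc3 (+ 2) (- + 2 * + suc m) (- + 1) (β≈bin n m (suc (suc n)) (cong suc (sym (ℕP.+-suc n m)))
      ⟫ ≡⇒≈ (cong (sgn m *_) bin-n-m)) (≡⇒≈ sgn-n) P≈0 (e β₀ (sgn m) (+ m))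
    where
    bin-n-m : bin n m ≡ + suc m
    bin-n-m = elc2 (+ 1) (+ suc m) (bin-lower m m) (bin-diag m) (e₀ (+ m) (bin n m) (bin m m))
      where
      e₀ : ∀ m a b → a - (+ 1 + m) ≡ + 1 * ((+ 1 + m - m) * a - (+ 1 + m) * b) + (+ 1 + m) * (b - + 1)
      e₀ = solve-∀
    e : ∀ β s m → + 2 * β - + 1 ≡ + 2 * (β - s * (+ 1 + m)) + - + 2 * (+ 1 + m) * (- + 1 * s - + 1) + - + 1 * (+ 1 + (+ 1 + m + (+ 1 + m)) - + 0)
    e = solve-∀

  -- The distance p - (w + 1) = 3w exceeds n, so p does not occur among the arguments of the
  -- difference.
  b≈0 : b ≈ + 0 [ P ]
  b≈0 = β≈bin n (w ℕ.+ n) (suc w) (cong suc (sym (ℕP.+-assoc w w n)))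
    ⟫ ≡⇒≈ (trans (cong (sgn (w ℕ.+ n) *_) (bin-zero n (w ℕ.+ n) (s≤s (ℕP.m≤n+m n w')))) (ℤP.*-zeroʳ (sgn (w ℕ.+ n))))

  Ê≈0 : Ê ≈ + 0 [ P ]
  Ê≈0 = cancel (+ 2) unit-2 (lc3 (+ 1) (+ 1) (- (+ 2 * Ê)) (weaken² 4β₀Ê) b≈0 2β₀≈1 (e β₀ Ê b))
    where
    e : ∀ β E b → + 2 * E - + 2 * + 0 ≡ + 1 * (+ 4 * β * E - b) + + 1 * (b - + 0) + - (+ 2 * E) * (+ 2 * β - + 1)
    e = solve-∀

  -- `β-value` pairs b with (w+1) C(3w+1,n) = (3w+1) C(3w,n), which is U/4 modulo p because 4(3w+1)
  -- ≡ 1.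
  bU : b * U ≈ + 4 * P [ P² ]
  bU = lc3 (- + 1) (+ 4) (+ 4 * b) vanish (β-value n (suc w) (s≤s z≤n) w+1+n<p) (≡⇒≈ (sym value)) (e b U (+ suc w * bin (suc w ℕ.+ n) n) (+ suc (w ℕ.+ n) * multiset n w) P)
    where
    value : + suc w * bin (suc w ℕ.+ n) n ≡ + suc (w ℕ.+ n) * multiset n w
    value = trans (cong (+ suc w *_) (sym (bin-sym (suc w) n))) (trans (bin-absorb (w ℕ.+ n) w)
      (cong (+ suc (w ℕ.+ n) *_) (trans (bin-sym w n) (cong (λ z → bin z n) (ℕP.+-comm w n)))))
    vanish : b * (+ 4 * (+ suc (w ℕ.+ n) * multiset n w) - U) ≈ + 0 [ P² ]
    vanish = ≈0² {b = + 4 * (+ suc (w ℕ.+ n) * multiset n w) - U} b≈0 (lc2 (+ 3 * multiset n w) (+ 1) P≈0 multiset≈U (e₀ (+ w) (multiset n w) U))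
      where
      e₀ : ∀ w X U → + 4 * ((+ 1 + (w + (w + w))) * X) - U - + 0 ≡ + 3 * X * (+ 1 + (w + w + (w + w)) - + 0) + + 1 * (X - U)
      e₀ = solve-∀
    e : ∀ b U v X P → b * U - + 4 * P ≡ - + 1 * (b * (+ 4 * X - U) - + 0) + + 4 * (b * v - P) + + 4 * b * (X - v)
    e = solve-∀

  -- Since Ê is divisible by p, 2β₀ ≡ 1 modulo p is enough to replace 4β₀Ê by 2Ê.
  ÊU : Ê * U ≈ + 2 * P [ P² ]
  ÊU = cancel² (+ 2) unit-2 (lc3 (- (+ 2 * U)) U (+ 1) vanish 4β₀Ê bU (e β₀ Ê U b P))
    where
    vanish : Ê * (+ 2 * β₀ - + 1) ≈ + 0 [ P² ]
    vanish = ≈0²-difference Ê≈0 2β₀≈1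
    e : ∀ β E U b P → + 2 * (E * U) - + 2 * (+ 2 * P) ≡ - (+ 2 * U) * (E * (+ 2 * β - + 1) - + 0) + U * (+ 4 * β * E - b) + + 1 * (b * U - + 4 * P)
    e = solve-∀

-- Central binomials modulo p

module SecondSupplement (m : ℕ) (pr : Prime (suc (suc m ℕ.+ suc m))) where

  open import Data.Integer using (_+_; _*_; _-_; -_; _^_)

  open Harmonic m pr public

  -- The coefficientwise form of (1 - 4X)^(-1/2) ≡ (1 - 4X)^n, as n ≡ -1/2.
  central≈bin : ∀ k → k ≤ n → central k ≈ (- + 4) ^ k * bin n k [ P ]
  central≈bin zero    _   = ≡⇒≈ refl
  central≈bin (suc k) k<n = cancel (+ suc k) (unit-≤n (s≤s z≤n) k<n)
    (lc4 (+ 1) (+ 2 * (+ 1 + (+ k + + k))) (+ 4 * (- + 4) ^ k) (+ 2 * ((- + 4) ^ k * bin n k)) (≡⇒≈ (central-suc k)) (central≈bin k (ℕP.<⇒≤ k<n)) (≡⇒≈ (bin-upper n k)) P≈0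
      (ident (central (suc k)) (central k) ((- + 4) ^ k) (bin n (suc k)) (bin n k) (+ n) (+ k)))
    where
    ident : ∀ Γ γ x B b n k → (+ 1 + k) * Γ - (+ 1 + k) * (- + 4 * x * B)
      ≡ + 1 * ((+ 1 + k) * Γ - + 2 * (+ 1 + (k + k)) * γ) + + 2 * (+ 1 + (k + k)) * (γ - x * b) + + 4 * x * ((+ 1 + k) * B - (n - k) * b)
        + + 2 * (x * b) * (+ 1 + (n + n) - + 0)
    ident = solve-∀

  [-4]^ : ∀ k → (- + 4) ^ k ≡ sgn k * (+ 2) ^ (k ℕ.+ k)
  [-4]^ k = trans (^-*-distrib (- + 1) (+ 4) k) (cong (sgn k *_) (trans (^-*-distrib (+ 2) (+ 2) k) (sym (ℤP.^-distribˡ-+-* (+ 2) k k))))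

-- V(1) and V(-2) modulo p for p = 4v + 3

module ThreeModFour (v : ℕ) (pr : Prime (suc (suc (v ℕ.+ v) ℕ.+ suc (v ℕ.+ v)))) where

  open import Data.Integer using (_+_; _*_; _-_; -_; _^_)

  private
    m : ℕ
    m = v ℕ.+ v

  open SecondSupplement m pr using (central≈bin; [-4]^)
  open KummerSum m pr public

  sgn-n : sgn n ≡ - + 1
  sgn-n = cong (- + 1 *_) (sgn-+ v)

  v≤n : v ≤ n
  v≤n = ℕP.m≤n⇒m≤1+n (ℕP.m≤m+n v v)

  bin-middle : bin n v ≡ bin n (suc v)
  bin-middle = subst (λ z → bin z v ≡ bin z (suc v)) (ℕP.+-suc v v) (bin-sym v (suc v))

  central-suc-v : central (suc v) ≡ + 2 * bin n v
  central-suc-v = trans (cong (λ z → bin (suc z) (suc v)) (ℕP.+-suc v v))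
    (trans (cong (λ z → bin n v + z) (sym bin-middle)) (e (bin n v)))
    where
    e : ∀ b → b + b ≡ + 2 * b
    e = solve-∀

  unit-bin-n-v : Unit (bin n v)
  unit-bin-n-v = unit-*ˡ (+ (v !) * + (suc v !)) (unit-≈ (≡⇒≈ (sym (trans (cong (λ z → bin z v * (+ (v !) * + (suc v !))) (sym (ℕP.+-suc v v))) (trans (bin-! v (suc v)) (cong (λ z → + (z !)) (ℕP.+-suc v v)))))) (unit-! n n<p))

  -- At k = v + 1 `central≈bin` compares C(2v+2,v+1) = 2C(n,v) with a power of -4 times C(n,v+1) =
  -- C(n,v), and (-4)^(v+1) = (-1)^(v+1) · 2t.
  t≈sgn : t ≈ sgn (suc v) [ P ]
  t≈sgn = cancel (+ 2 * bin n v) (unit-* unit-2 unit-bin-n-v)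
    (lc4 (- sgn (suc v)) (sgn (suc v)) (- (+ 2 * bin n v * t)) (- + 1) (central≈bin (suc v) (s≤s (ℕP.m≤m+n v v))) (≡⇒≈ central-suc-v) (≡⇒≈ (sgn² (suc v))) (≡⇒≈ right)
      (e (bin n v) t (sgn (suc v)) (central (suc v)) ((- + 4) ^ suc v * bin n (suc v))))
    where
    right : sgn (suc v) * ((- + 4) ^ suc v * bin n (suc v)) ≡ sgn (suc v) * (sgn (suc v) * (+ 2 * t) * bin n v)
    right = cong (sgn (suc v) *_) (cong₂ _*_ (trans ([-4]^ (suc v)) (cong (λ z → sgn (suc v) * (+ 2 * (+ 2) ^ z)) (ℕP.+-suc v v))) (sym bin-middle))
    e : ∀ b t s Γ X → + 2 * b * t - + 2 * b * s ≡ - s * (Γ - X) + s * (Γ - + 2 * b) + - (+ 2 * b * t) * (s * s - + 1) + - + 1 * (s * X - s * (s * (+ 2 * t) * b))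
    e = solve-∀

  central-n≈-1 : central n ≈ - + 1 [ P ]
  central-n≈-1 = weaken² central-n ⟫ ≡⇒≈ (cong (_* (t * t * (t * t))) sgn-n) ⟫ lc1 (- (t * t + + 1)) t²≈1 (e t)
    where
    e : ∀ t → - + 1 * (t * t * (t * t)) - - + 1 ≡ - (t * t + + 1) * (t * t - + 1)
    e = solve-∀

  -- Modulo p the sum becomes that of (-1)^k C(n,k)², where k and n - k cancel for odd n.
  D≈0 : D ≈ + 0 [ P ]
  D≈0 = ∑-≈ (suc n) (λ k k≤n → c≈bin² k (ℕP.≤-pred k≤n)) ⟫ ≡⇒≈ (∑-antisymmetric n (λ k → sgn k * bin n k * bin n k)
      (λ k k≤n → trans (cong₂ (λ s z → s * z * z) (sgn-∸ k≤n) (symmetric k k≤n)) (elc1 (sgn k * bin n k * bin n k) sgn-n (e (sgn n) (sgn k) (bin n k)))))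
    where
    symmetric : ∀ k → k ≤ n → bin n (n ∸ k) ≡ bin n k
    symmetric k k≤n = subst (λ z → bin z (n ∸ k) ≡ bin z k) (ℕP.m+[n∸m]≡n k≤n) (sym (bin-sym k (n ∸ k)))
    e : ∀ s s' x → s * s' * x * x - - (s' * x * x) ≡ s' * x * x * (s - - + 1)
    e = solve-∀

  B≈E : ∀ j → j ≤ n → B j ≈ E j [ P ]
  B≈E j j≤n = lc3 (c j * (+ suc n + + j) * ι (ĥ j)) (c j * ι (+ suc j)) (c j * (+ suc n + + j) * + 2) ι-n+1 P≈0 (ι-≈ (ĥ≈ j j≤n))
    (e (c j) (ι (+ suc n)) (ι (ĥ j)) (ι (+ suc j)) (+ n) (+ j))
    where
    e : ∀ c i i' i″ n j → c * (+ 1 + n + j) * (i * i') - (+ 1 + (j + j)) * c * i″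
      ≡ c * (+ 1 + n + j) * i' * (i - + 2) + c * i″ * (+ 1 + (n + n) - + 0) + c * (+ 1 + n + j) * + 2 * (i' - i″)
    e = solve-∀

  -- Modulo p the series B is E itself, so `2Ê` turns into an equation for Ê: G Ê ≡ ∑A with 2G ≡ -1.
  -- As m = 2v is even, the sum of A is an alternating convolution with a known value.
  Ê-value : Ê ≈ - (+ 2 * multiset n v) [ P ]
  Ê-value = lc3 (- + 2) (- (+ 2 * G)) Ê (weaken² 2Ê ⟫ ≈-+ (≡⇒≈ (multiset-alternating n v)) (≈-refl {G * ∑ (suc n) B})) (∑-≈ (suc n) (λ j j≤n → B≈E j (ℕP.≤-pred j≤n)))
      (≡⇒≈ 2G ⟫ central-n≈-1) (e G Ê (∑ (suc n) B) (multiset n v))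
    where
    e : ∀ G E B X → E - - (+ 2 * X) ≡ - + 2 * (G * (+ 2 * E) - (X + G * B)) + - (+ 2 * G) * (B - E) + E * (+ 2 * G - - + 1)
    e = solve-∀

  2multiset : + 2 * multiset n v ≈ sgn v * central (suc v) [ P ]
  2multiset = lc2 (+ 2) (- sgn v) (≡⇒≈ (bin-sym n v) ⟫ bin-n+k v v≤n) (≡⇒≈ central-suc-v) (e (multiset n v) (sgn v) (bin n v) (central (suc v)))
    where
    e : ∀ X s b Γ → + 2 * X - s * Γ ≡ + 2 * (X - s * b) + - s * (Γ - + 2 * b)
    e = solve-∀

  2V-at-1 : + 2 * V (+ 1) ≈ - (sgn (suc v) * central (suc v)) [ P ]
  2V-at-1 = lc4 (+ 1) (- + 1) (+ 2 * c n) (- + 2) (weaken² V-at-1) Ê-value P≈0 D≈0 (e (V (+ 1)) D Ê P (c n) (multiset n v))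
    ⟫ 2multiset ⟫ ≡⇒≈ (e' (sgn v) (central (suc v)))
    where
    e : ∀ V D E P c X → + 2 * V - + 2 * X ≡ + 1 * (+ 2 * (V + D) - (- E + + 2 * P * c)) + - + 1 * (E - - (+ 2 * X)) + + 2 * c * (P - + 0) + - + 2 * (D - + 0)
    e = solve-∀
    e' : ∀ s Γ → s * Γ ≡ - (- + 1 * s * Γ)
    e' = solve-∀

  V-at--2 : V (- + 2) ≈ V (+ 1) [ P ]
  V-at--2 = lc4 (- + 1) (V (- + 2) - P * c n * (- + 2) ^ suc n) (+ 1) (c n * ((- + 2) ^ suc n - + 1)) (weaken² V-reflect) (≡⇒≈ sgn-n) D≈0 P≈0
    (e (V (- + 2)) (V (+ 1)) D P (c n) ((- + 2) ^ suc n) (sgn n))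
    where
    e : ∀ V₂ V₁ D P c x s → V₂ - V₁ ≡ - + 1 * (s * (V₂ - P * c * x) - (- (V₁ - P * c) - D)) + (V₂ - P * c * x) * (s - - + 1) + + 1 * (D - + 0) + c * (x - + 1) * (P - + 0)
    e = solve-∀

-- The symbol (2/p) and 2^n

module LegendreOfTwo (m : ℕ) (pr : Prime (suc (suc m ℕ.+ suc m))) where

  open import Data.Integer using (_+_; _*_; _-_; -_; _^_)

  open OddPrime m pr

  -- That a square root of 2 forces 2^n ≡ 1 is Fermat's theorem; the converse requires an explicit
  -- root, whose shape depends on p modulo 4.
  module _ (root : t ≈ + 1 [ P ] → ∃ λ a → a * a ≈ + 2 [ P ]) where

    isRoot : ℕ → Bool
    isRoot s = ((s ℕ.* s) ℕ.% p) ℕ.≡ᵇ (2 ℕ.% p)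

    2<p : 2 < p
    2<p = s≤s (s≤s (ℕP.≤-trans (s≤s z≤n) (ℕP.m≤n+m n m)))

    %≈ : ∀ a → + (a ℕ.% p) ≈ + a [ P ]
    %≈ a = residue (+ a)

    root⇒t≈1 : ∀ {a} → a * a ≈ + 2 [ P ] → t ≈ + 1 [ P ]
    root⇒t≈1 {a} h = ≈-^ n (≈-sym h) ⟫ ≡⇒≈ (trans (^-*-distrib a a n) (sym (ℤP.^-distribˡ-+-* a n n))) ⟫ fermat unit-a
      where
      unit-a : Unit a
      unit-a = unit-*ˡ a (unit-≈ (≈-sym h) unit-2)

    isRoot⇒ : ∀ s → T (isRoot s) → + s * + s ≈ + 2 [ P ]
    isRoot⇒ s h = ≡⇒≈ (sym (ℤP.pos-* s s)) ⟫ ≈-sym (%≈ (s ℕ.* s)) ⟫ ≡⇒≈ (cong +_ (ℕP.≡ᵇ⇒≡ ((s ℕ.* s) ℕ.% p) (2 ℕ.% p) h)) ⟫ %≈ 2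

    ⇒isRoot : ∀ s → + s * + s ≈ + 2 [ P ] → T (isRoot s)
    ⇒isRoot s h = ℕP.≡⇒≡ᵇ ((s ℕ.* s) ℕ.% p) (2 ℕ.% p)
      (residue-unique (n%ℕd<d (+ (s ℕ.* s)) p) (n%ℕd<d (+ 2) p) (%≈ (s ℕ.* s) ⟫ ≡⇒≈ (ℤP.pos-* s s) ⟫ h ⟫ ≈-sym (%≈ 2)))

    -- The body of `legendre` with its two tests abstracted, so that cases are split on the outcome
    -- of the search.
    value : Bool → Bool → ℤ
    value b₁ b₂ = if b₁ then + 0 else if b₂ then + 1 else -[1+ 0 ]

    Correct : ℤ → Set
    Correct L = IsSign L × L ≈ t [ P ]

    not-zero : ∀ b → (T b → 2 ℕ.% p ≡ 0) → b ≡ false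
    not-zero false _ = refl
    not-zero true  h = ⊥-elim (zero≢2 (trans (sym (h tt)) (m<n⇒m%n≡m 2<p)))
      where
      zero≢2 : 0 ≡ 2 → ⊥
      zero≢2 ()

    decide : ∀ b → b ≡ any isRoot (upTo p) → Correct (value false b)
    decide true e = inj₁ refl , ≈-sym (found (find (any⁻ isRoot (upTo p) (subst T e tt))))
      where
      found : (∃ λ s → _ × T (isRoot s)) → t ≈ + 1 [ P ]
      found (s , _ , h) = root⇒t≈1 {+ s} (isRoot⇒ s h)
    decide false e = inj₂ refl , ≈-sym ([ (λ one → ⊥-elim (missing (root one))) , (λ z → z) ]′ (square≈1 t²≈1))
      where
      missing : (∃ λ a → a * a ≈ + 2 [ P ]) → ⊥
      missing (a , h) = subst T (sym e) (any⁺ isRoot (lose (∈-upTo⁺ (n%ℕd<d a p)) (⇒isRoot (a %ℕ p) (≈-* (residue a) (residue a) ⟫ h))))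

    legendre-correct : Correct (legendre 2 p)
    legendre-correct = subst (λ b → Correct (value b (any isRoot (upTo p)))) (sym (not-zero ((2 ℕ.% p) ℕ.≡ᵇ 0) (ℕP.≡ᵇ⇒≡ (2 ℕ.% p) 0)))
      (decide (any isRoot (upTo p)) refl)

module RootOdd (v : ℕ) (pr : Prime (suc (suc (v ℕ.+ v) ℕ.+ suc (v ℕ.+ v)))) where

  open import Data.Integer using (_+_; _*_; _-_; -_; _^_)

  open OddPrime (v ℕ.+ v) pr

  -- n = 2v + 1, so the square of 2^(v+1) is 2 · 2^n.
  root : t ≈ + 1 [ P ] → ∃ λ a → a * a ≈ + 2 [ P ]
  root h = (+ 2) ^ suc v , ≡⇒≈ (trans (sym (ℤP.^-distribˡ-+-* (+ 2) (suc v) (suc v))) (cong (λ z → (+ 2) ^ suc z) (ℕP.+-suc v v))) ⟫ ≈-*ˡ (+ 2) h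

module RootEven (w' : ℕ) (pr : Prime (suc (suc (w' ℕ.+ suc w') ℕ.+ suc (w' ℕ.+ suc w')))) where

  open import Data.Integer using (_+_; _*_; _-_; -_; _^_)

  open SumOfSquares w' pr
  open SecondSupplement (w' ℕ.+ suc w') pr using (central≈bin; [-4]^)

  -- For n = 2w, C(2w,w) stands on both sides of `central≈bin` at k = w, which leaves (-4)^w =
  -- (-1)^w t ≡ 1.
  t≈sgn : t ≈ sgn w [ P ]
  t≈sgn = cancel b₁ unit-b₁ (lc3 (- sgn w) (- sgn w) (- (b₁ * t)) (central≈bin w w≤n) (≡⇒≈ (cong (_* b₁) ([-4]^ w))) (≡⇒≈ (sgn² w)) (e b₁ t (sgn w) ((- + 4) ^ w * b₁)))
    where
    e : ∀ b t s X → b * t - b * s ≡ - s * (b - X) + - s * (X - s * t * b) + - (b * t) * (s * s - + 1)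
    e = solve-∀

  even-exponent : ∀ w → sgn w ≡ + 1 → ∃ λ z → w ≡ z ℕ.+ z
  even-exponent zero          _ = 0 , refl
  even-exponent (suc zero)    ()
  even-exponent (suc (suc w)) e = next (even-exponent w (trans (ident (sgn w)) e))
    where
    ident : ∀ s → s ≡ - + 1 * (- + 1 * s)
    ident = solve-∀
    next : (∃ λ z → w ≡ z ℕ.+ z) → ∃ λ z → suc (suc w) ≡ z ℕ.+ z
    next (z , f) = suc z , cong suc (trans (cong suc f) (sym (ℕP.+-suc z z)))

  sgn-w≡1 : t ≈ + 1 [ P ] → sgn w ≡ + 1
  sgn-w≡1 h = decide (sgn-sign w) (≈-sym t≈sgn ⟫ h)
    where
    decide : ∀ {s} → IsSign s → s ≈ + 1 [ P ] → s ≡ + 1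
    decide (inj₁ e)    _ = e
    decide (inj₂ refl) z = ⊥-elim (unit-2 (lc1 (- + 1) z refl))

  -- With g a nonresidue, ζ = g^(w/2) is a primitive 8th root of unity and 2 = (ζ + ζ⁻¹)².
  root : t ≈ + 1 [ P ] → ∃ λ a → a * a ≈ + 2 [ P ]
  root h = construct (even-exponent w (sgn-w≡1 h)) nonresidue
    where
    construct : (∃ λ z → w ≡ z ℕ.+ z) → (∃ λ g → Unit (+ g) × (+ g) ^ n ≈ - + 1 [ P ]) → ∃ λ a → a * a ≈ + 2 [ P ]
    construct (z , w≡) (g , _ , hg) = ζ - ζ * (ζ * ζ) , lc1 (ζ * ζ - + 2) ζ⁴ (ident ζ)
      where
      ζ : ℤ
      ζ = (+ g) ^ z
      ζ² : ζ * ζ ≡ (+ g) ^ w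
      ζ² = trans (sym (ℤP.^-distribˡ-+-* (+ g) z z)) (cong ((+ g) ^_) (sym w≡))
      ζ⁴ : ζ * ζ * (ζ * ζ) ≈ - + 1 [ P ]
      ζ⁴ = ≡⇒≈ (trans (cong₂ _*_ ζ² ζ²) (sym (ℤP.^-distribˡ-+-* (+ g) w w))) ⟫ hg
      ident : ∀ z → (z - z * (z * z)) * (z - z * (z * z)) - + 2 ≡ (z * z - + 2) * (z * z * (z * z) - - + 1)
      ident = solve-∀

-- p-integral rationals and their integer representatives

module Representatives (q : ℕ) (pr : Prime (suc q)) where

  open import Data.Integer using (_+_; _*_; _-_; -_; _^_)

  open PrimeModulus q pr

  -- The p-integral rational x is represented modulo p² by the integer z.
  record Rep (x : ℚ) (z : ℤ) : Set where
    constructor rep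
    field
      den num : ℤ
      unit-den : Unit den
      fraction : x ℚ.* ℤtoℚ den ≡ ℤtoℚ num
      residue-num : num ≈ z * den [ P² ]

  rep-ℤ : ∀ z → Rep (ℤtoℚ z) z
  rep-ℤ z = rep (+ 1) z unit-1 (ℚP.*-identityʳ (ℤtoℚ z)) (≡⇒≈ (sym (ℤP.*-identityʳ z)))

  rep-≈ : ∀ {x z z'} → Rep x z → z ≈ z' [ P² ] → Rep x z'
  rep-≈ (rep d e u f h) zz = rep d e u f (h ⟫ ≈-* zz ≈-refl)

  rep-+ : ∀ {x y z w} → Rep x z → Rep y w → Rep (x ℚ.+ y) (z + w)
  rep-+ {x} {y} {z} {w} (rep d e u f h) (rep d' e' u' f' h') = rep (d * d') (e * d' + e' * d) (unit-* u u')
    (begin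
      (x ℚ.+ y) ℚ.* ℤtoℚ (d * d')                                   ≡⟨ cong ((x ℚ.+ y) ℚ.*_) (ℤtoℚ-* d d') ⟩
      (x ℚ.+ y) ℚ.* (ℤtoℚ d ℚ.* ℤtoℚ d')                            ≡⟨ ident x y (ℤtoℚ d) (ℤtoℚ d') ⟩
      (x ℚ.* ℤtoℚ d) ℚ.* ℤtoℚ d' ℚ.+ (y ℚ.* ℤtoℚ d') ℚ.* ℤtoℚ d     ≡⟨ cong₂ (λ a b → a ℚ.* ℤtoℚ d' ℚ.+ b ℚ.* ℤtoℚ d) f f' ⟩
      ℤtoℚ e ℚ.* ℤtoℚ d' ℚ.+ ℤtoℚ e' ℚ.* ℤtoℚ d                     ≡⟨ cong₂ ℚ._+_ (ℤtoℚ-* e d') (ℤtoℚ-* e' d) ⟨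
      ℤtoℚ (e * d') ℚ.+ ℤtoℚ (e' * d)                               ≡⟨ ℤtoℚ-+ (e * d') (e' * d) ⟨
      ℤtoℚ (e * d' + e' * d)                                        ∎)
    (lc2 d' d h h' (ident' e e' d d' z w))
    where
    open ≡-Reasoning
    open +-*-Solver using (_:+_; _:*_; _:=_) renaming (solve to solveℚ)
    ident : ∀ x y d d' → (x ℚ.+ y) ℚ.* (d ℚ.* d') ≡ (x ℚ.* d) ℚ.* d' ℚ.+ (y ℚ.* d') ℚ.* d
    ident = solveℚ 4 (λ x y d d' → (x :+ y) :* (d :* d') := (x :* d) :* d' :+ (y :* d') :* d) refl
    ident' : ∀ e e' d d' z w → e * d' + e' * d - (z + w) * (d * d') ≡ d' * (e - z * d) + d * (e' - w * d')
    ident' = solve-∀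

  rep-* : ∀ {x y z w} → Rep x z → Rep y w → Rep (x ℚ.* y) (z * w)
  rep-* {x} {y} {z} {w} (rep d e u f h) (rep d' e' u' f' h') = rep (d * d') (e * e') (unit-* u u')
    (begin
      (x ℚ.* y) ℚ.* ℤtoℚ (d * d')                ≡⟨ cong ((x ℚ.* y) ℚ.*_) (ℤtoℚ-* d d') ⟩
      (x ℚ.* y) ℚ.* (ℤtoℚ d ℚ.* ℤtoℚ d')         ≡⟨ ident x y (ℤtoℚ d) (ℤtoℚ d') ⟩
      (x ℚ.* ℤtoℚ d) ℚ.* (y ℚ.* ℤtoℚ d')         ≡⟨ cong₂ ℚ._*_ f f' ⟩
      ℤtoℚ e ℚ.* ℤtoℚ e'                         ≡⟨ ℤtoℚ-* e e' ⟨
      ℤtoℚ (e * e')                              ∎)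
    (lc2 e' (z * d) h h' (ident' e e' d d' z w))
    where
    open ≡-Reasoning
    open +-*-Solver using (_:+_; _:*_; _:=_) renaming (solve to solveℚ)
    ident : ∀ x y d d' → (x ℚ.* y) ℚ.* (d ℚ.* d') ≡ (x ℚ.* d) ℚ.* (y ℚ.* d')
    ident = solveℚ 4 (λ x y d d' → (x :* y) :* (d :* d') := (x :* d) :* (y :* d')) refl
    ident' : ∀ e e' d d' z w → e * e' - z * w * (d * d') ≡ e' * (e - z * d) + z * d * (e' - w * d')
    ident' = solve-∀

  rep-neg : ∀ {x z} → Rep x z → Rep (ℚ.- x) (- z)
  rep-neg {x} {z} (rep d e u f h) = rep d (- e) u
    (trans (sym (ℚP.neg-distribˡ-* x (ℤtoℚ d))) (trans (cong ℚ.-_ f) (sym (ℤtoℚ-neg e))))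
    (lc1 (- + 1) h (ident e z d))
    where
    ident : ∀ e z d → - e - - z * d ≡ - + 1 * (e - z * d)
    ident = solve-∀

  rep-- : ∀ {x y z w} → Rep x z → Rep y w → Rep (x ℚ.- y) (z - w)
  rep-- r s = rep-+ r (rep-neg s)

  rep-^ : ∀ {x z} k → Rep x z → Rep (x ^ℚ k) (z ^ k)
  rep-^ zero    r = rep-ℤ (+ 1)
  rep-^ (suc k) r = rep-* r (rep-^ k r)

  rep-recip : ∀ {x y z} → x ℚ.* y ≡ 1ℚ → Rep y z → Unit z → Rep x (ι z)
  rep-recip {x} {y} {z} xy (rep d e u f h) uz = rep e d unit-e
    (begin
      x ℚ.* ℤtoℚ e               ≡⟨ cong (x ℚ.*_) f ⟨
      x ℚ.* (y ℚ.* ℤtoℚ d)       ≡⟨ ℚP.*-assoc x y (ℤtoℚ d) ⟨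
      (x ℚ.* y) ℚ.* ℤtoℚ d       ≡⟨ cong (ℚ._* ℤtoℚ d) xy ⟩
      1ℚ ℚ.* ℤtoℚ d              ≡⟨ ℚP.*-identityˡ (ℤtoℚ d) ⟩
      ℤtoℚ d                     ∎)
    (lc2 (- ι z) (- d) h (ι-inverse uz) (ident d e z (ι z)))
    where
    open ≡-Reasoning
    unit-e : Unit e
    unit-e = unit-≈ (≈-sym (weaken² h)) (unit-* uz u)
    ident : ∀ d e z i → d - i * e ≡ - i * (e - z * d) + - d * (z * i - + 1)
    ident = solve-∀

  rep-nonzero : ∀ {y z} → Rep y z → Unit z → y ≢ 0ℚ
  rep-nonzero {y} {z} (rep d e u f h) uz y≡0 = unit-* uz u (≈-sym (weaken² h) ⟫ ≡⇒≈ (ℤtoℚ-injective e (+ 0)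
    (trans (sym f) (trans (cong (ℚ._* ℤtoℚ d) y≡0) (ℚP.*-zeroˡ (ℤtoℚ d))))))

  rep-divℚ : ∀ {x y z w} → Rep x z → Rep y w → Unit w → Rep (divℚ x y) (z * ι w)
  rep-divℚ {x} {y} {z} {w} r s uw = from (divℚ-spec x (rep-nonzero s uw))
    where
    from : (∃ λ q → q ℚ.* y ≡ 1ℚ × divℚ x y ≡ x ℚ.* q) → Rep (divℚ x y) (z * ι w)
    from (q , qy , e) = subst (λ u → Rep u (z * ι w)) (sym e) (rep-* r (rep-recip qy s uw))

  rep-sum : ∀ N {f g} → (∀ k → k ≤ N → Rep (f k) (g k)) → Rep (sumTo N f) (∑ (suc N) g)
  rep-sum zero    {f} {g} h = rep-≈ (h 0 z≤n) (≡⇒≈ (sym (ℤP.+-identityˡ (g 0))))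
  rep-sum (suc N) h = rep-+ (rep-sum N (λ k k≤N → h k (ℕP.m≤n⇒m≤1+n k≤N))) (h (suc N) ℕP.≤-refl)

  rep-extend : ∀ N d {f z} → Rep (sumTo N f) z → (∀ k → k < d → Rep (f (suc (N ℕ.+ k))) (+ 0)) → Rep (sumTo (N ℕ.+ d) f) z
  rep-extend N zero    {f} {z} r h = subst (λ M → Rep (sumTo M f) z) (sym (ℕP.+-identityʳ N)) r
  rep-extend N (suc d) {f} {z} r h = subst (λ M → Rep (sumTo M f) z) (sym (ℕP.+-suc N d))
    (rep-≈ (rep-+ (rep-extend N d {f} {z} r (λ k k<d → h k (ℕP.m≤n⇒m≤1+n k<d))) (h d ℕP.≤-refl)) (≡⇒≈ (ℤP.+-identityʳ z)))

  rep-inv : ∀ k → Unit (+ k + + k - + 1) → Rep (inv2k-1 k) (ι (+ k + + k - + 1))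
  rep-inv zero    u = rep-recip {y = ℤtoℚ (- + 1)} refl (rep-ℤ (- + 1)) u
  rep-inv (suc k) u = rep-recip (trans (cong (λ z → (+ 1 ℚ./ suc (k ℕ.+ k)) ℚ.* ℤtoℚ z) (ident (+ k))) (recip-suc (k ℕ.+ k))) (rep-ℤ (+ suc k + + suc k - + 1)) u
    where
    ident : ∀ k → + 1 + k + (+ 1 + k) - + 1 ≡ + 1 + (k + k)
    ident = solve-∀

  private
    -- `CongQ` asks for a natural denominator; the sign of the common denominator is moved to the
    -- numerator.
    positive : ∀ d → Unit d → ∃ λ s → IsSign s × s * d ≡ + ℤ.∣ d ∣
    positive (+ k)      _ = + 1 , inj₁ refl , ℤP.*-identityˡ (+ k)
    positive (-[1+ k ]) _ = - + 1 , inj₂ refl , ℤP.-1*i≡-i -[1+ k ]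

  congQ : ∀ j {M} → + (p ℕ.^ j) ≡ M → ∀ {x y z w} → Rep x z → Rep y w → z ≈ w [ M ] → (∀ {a b} → a ≈ b [ P² ] → a ≈ b [ M ]) → CongQ p j x y
  congQ j {M} pj {x} {y} {z} {w} (rep d e u f h) (rep d' e' u' f' h') zw weak = from difference (positive (d * d') (unit-* u u'))
    where
    difference : e * d' - e' * d ≈ + 0 [ M ]
    difference = lc3 d' (- d) (d * d') (weak h) (weak h') zw (ident e e' d d' z w)
      where
      ident : ∀ e e' d d' z w → e * d' - e' * d - + 0 ≡ d' * (e - z * d) + - d * (e' - w * d') + d * d' * (z - w)
      ident = solve-∀
    from : e * d' - e' * d ≈ + 0 [ M ] → (∃ λ s → IsSign s × s * (d * d') ≡ + ℤ.∣ d * d' ∣) → CongQ p j x y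
    from (by k eq) (s , _ , sd) = s * k , ℤ.∣ d * d' ∣ , (λ div → unit-* u u' (∣⇒≈0 div)) , (begin
      (x ℚ.- y) ℚ.* ℤtoℚ (+ ℤ.∣ d * d' ∣)
        ≡⟨ cong (λ v → (x ℚ.- y) ℚ.* ℤtoℚ v) sd ⟨
      (x ℚ.- y) ℚ.* ℤtoℚ (s * (d * d'))
        ≡⟨ cong ((x ℚ.- y) ℚ.*_) (trans (ℤtoℚ-* s (d * d')) (cong (ℤtoℚ s ℚ.*_) (ℤtoℚ-* d d'))) ⟩
      (x ℚ.- y) ℚ.* (ℤtoℚ s ℚ.* (ℤtoℚ d ℚ.* ℤtoℚ d'))
        ≡⟨ ident x y (ℤtoℚ s) (ℤtoℚ d) (ℤtoℚ d') ⟩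
      ℤtoℚ s ℚ.* ((x ℚ.* ℤtoℚ d) ℚ.* ℤtoℚ d' ℚ.- (y ℚ.* ℤtoℚ d') ℚ.* ℤtoℚ d)
        ≡⟨ cong₂ (λ a b → ℤtoℚ s ℚ.* (a ℚ.* ℤtoℚ d' ℚ.- b ℚ.* ℤtoℚ d)) f f' ⟩
      ℤtoℚ s ℚ.* (ℤtoℚ e ℚ.* ℤtoℚ d' ℚ.- ℤtoℚ e' ℚ.* ℤtoℚ d)
        ≡⟨ cong₂ (λ a b → ℤtoℚ s ℚ.* (a ℚ.+ b)) (sym (ℤtoℚ-* e d')) (trans (cong ℚ.-_ (sym (ℤtoℚ-* e' d))) (sym (ℤtoℚ-neg (e' * d)))) ⟩
      ℤtoℚ s ℚ.* (ℤtoℚ (e * d') ℚ.+ ℤtoℚ (- (e' * d)))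
        ≡⟨ trans (cong (ℤtoℚ s ℚ.*_) (sym (ℤtoℚ-+ (e * d') (- (e' * d))))) (sym (ℤtoℚ-* s (e * d' - e' * d))) ⟩
      ℤtoℚ (s * (e * d' - e' * d))
        ≡⟨ cong ℤtoℚ (trans (cong (s *_) (trans (sym (ℤP.+-identityʳ (e * d' - e' * d))) eq)) (ident' s k M)) ⟩
      ℤtoℚ (M * (s * k))
        ≡⟨ ℤtoℚ-* M (s * k) ⟩
      ℤtoℚ M ℚ.* ℤtoℚ (s * k)
        ≡⟨ cong (λ v → ℤtoℚ v ℚ.* ℤtoℚ (s * k)) pj ⟨
      ℕtoℚ (p ℕ.^ j) ℚ.* ℤtoℚ (s * k) ∎)
      where
      open ≡-Reasoning
      open +-*-Solver using (_:+_; _:*_; _:-_; _:=_) renaming (solve to solveℚ)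
      ident : ∀ x y s d d' → (x ℚ.- y) ℚ.* (s ℚ.* (d ℚ.* d')) ≡ s ℚ.* ((x ℚ.* d) ℚ.* d' ℚ.- (y ℚ.* d') ℚ.* d)
      ident = solveℚ 5 (λ x y s d d' → (x :- y) :* (s :* (d :* d')) := s :* ((x :* d) :* d' :- (y :* d') :* d)) refl
      ident' : ∀ s k M → s * (k * M) ≡ M * (s * k)
      ident' = solve-∀

  congQ₂ : ∀ {x y z w} → Rep x z → Rep y w → z ≈ w [ P² ] → CongQ p 2 x y
  congQ₂ r s h = congQ 2 (trans (cong +_ (cong (p ℕ.*_) (ℕP.*-identityʳ p))) (ℤP.pos-* p p)) r s h (λ z → z)

  congQ₁ : ∀ {x y z w} → Rep x z → Rep y w → z ≈ w [ P ] → CongQ p 1 x y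
  congQ₁ r s h = congQ 1 (cong +_ (ℕP.*-identityʳ p)) r s h weaken²

-- R and S modulo p²

module SumRepresentatives (m : ℕ) (pr : Prime (suc (suc m ℕ.+ suc m))) where

  open import Data.Integer using (_+_; _*_; _-_; -_; _^_)

  open OddPrime m pr
  open Representatives (n ℕ.+ n) pr

  R-rep : ∀ {x z} → Rep x z → Rep (R n x) (V z)
  R-rep {x} {z} r = rep-sum n term
    where
    term : ∀ k → k ≤ n → Rep (ℕtoℚ ((n C k) ℕ.* ((n ℕ.+ k) C k)) ℚ.* (x ^ℚ k) ℚ.* inv2k-1 k) (c k * z ^ k * ι (+ k + + k - + 1))
    term k k≤n = rep-* (rep-* (rep-≈ (rep-ℤ (+ ((n C k) ℕ.* ((n ℕ.+ k) C k)))) (≡⇒≈ (trans (ℤP.pos-* (n C k) ((n ℕ.+ k) C k)) (cong₂ _*_ (sym (bin≡C n k)) (sym (bin≡C (n ℕ.+ k) k))))))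
      (rep-^ k r)) (rep-inv k (unit-2k-1 k k≤n))

  p!≈0 : + (p !) ≈ + 0 [ P ]
  p!≈0 = by (+ ((n ℕ.+ n) !)) (trans (ℤP.+-identityʳ (+ (p !))) (trans (ℤP.pos-* p ((n ℕ.+ n) !)) (ℤP.*-comm P (+ ((n ℕ.+ n) !)))))

  -- p! divides (2k)!, while k! is a unit.
  central≈0 : ∀ k → p ≤ k ℕ.+ k → k < p → central k ≈ + 0 [ P ]
  central≈0 k p≤2k k<p = cancel (+ (k !) * + (k !)) (unit-* (unit-! k k<p) (unit-! k k<p))
    (lc3 {a = central k * (+ (k !) * + (k !))} {b = + ((k ℕ.+ k) !)} {a' = bin (p ℕ.+ d) p * (+ (p !) * + (d !))} {b' = + ((k ℕ.+ k) !)}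
      (+ 1) (- + 1) (bin (p ℕ.+ d) p * + (d !)) (≡⇒≈ (bin-! k k)) (≡⇒≈ (trans (bin-! p d) (cong (λ z → + (z !)) (ℕP.m+[n∸m]≡n p≤2k)))) p!≈0
      (ident (central k) (+ (k !)) (+ ((k ℕ.+ k) !)) (bin (p ℕ.+ d) p) (+ (p !)) (+ (d !))))
    where
    d : ℕ
    d = k ℕ.+ k ∸ p
    ident : ∀ γ f F b g e → f * f * γ - f * f * + 0 ≡ + 1 * (γ * (f * f) - F) + - + 1 * (b * (g * e) - F) + b * e * (g - + 0)
    ident = solve-∀

  central-cast : ∀ k → + (((2 ℕ.* k) C k) ℕ.* ((2 ℕ.* k) C k)) ≡ central k * central k
  central-cast k = trans (ℤP.pos-* ((2 ℕ.* k) C k) ((2 ℕ.* k) C k)) (cong (λ z → z * z) (trans (sym (bin≡C (2 ℕ.* k) k)) (cong (λ z → bin (k ℕ.+ z) k) (ℕP.+-identityʳ k))))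

  central≈0-n+1 : central (suc n) ≈ + 0 [ P ]
  central≈0-n+1 = central≈0 (suc n) (s≤s (ℕP.+-monoʳ-≤ n (ℕP.n≤1+n n))) (s≤s (s≤s (ℕP.m≤n+m n m)))

  -- With γ x ≡ -16, `central²` turns C(2k,k)²/γ^k into c(k) x^k; the three cases of the theorem are
  -- γ = -16, 8, 32 with x = 1, -2, -1/2.
  module _ {γ : ℚ} {γ' x' : ℤ} (rγ : Rep γ γ') (uγ : Unit γ') (γx : γ' * x' ≈ - + 16 [ P² ]) where

    summand : ℕ → ℚ
    summand k = divℚ (ℕtoℚ (((2 ℕ.* k) C k) ℕ.* ((2 ℕ.* k) C k)) ℚ.* inv2k-1 k) (γ ^ℚ k)

    general : ∀ k → Unit (+ k + + k - + 1) → Rep (summand k) (central k * central k * ι (+ k + + k - + 1) * ι (γ' ^ k))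
    general k u = rep-divℚ (rep-* (rep-≈ (rep-ℤ (+ (((2 ℕ.* k) C k) ℕ.* ((2 ℕ.* k) C k)))) (≡⇒≈ (central-cast k))) (rep-inv k u)) (rep-^ k rγ) (unit-^ k uγ)

    low : ∀ k → k ≤ n → Rep (summand k) (c k * x' ^ k * ι (+ k + + k - + 1))
    low k k≤n = rep-≈ (general k (unit-2k-1 k k≤n)) (lc3 (ι (+ k + + k - + 1) * ι (γ' ^ k)) (- (c k * ι (+ k + + k - + 1) * ι (γ' ^ k))) (c k * x' ^ k * ι (+ k + + k - + 1))
      (central² k k≤n) (≡⇒≈ (sym (^-*-distrib γ' x' k)) ⟫ ≈-^ k γx) (ι-inverse (unit-^ k uγ))
      (ident (central k) (ι (+ k + + k - + 1)) (ι (γ' ^ k)) (c k) (x' ^ k) ((- + 16) ^ k) (γ' ^ k)))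
      where
      ident : ∀ Z i J c X Y K → Z * Z * i * J - c * X * i ≡ i * J * (Z * Z - c * Y) + - (c * i * J) * (K * X - Y) + c * X * i * (K * J - + 1)
      ident = solve-∀

    -- For k = n + 1 the denominator 2k - 1 equals p, which cancels against the square of the binomial.
    middle : Rep (summand (suc n)) (+ 16 * P * ι (γ' ^ suc n))
    middle = from central≈0-n+1
      where
      from : central (suc n) ≈ + 0 [ P ] → Rep (summand (suc n)) (+ 16 * P * ι (γ' ^ suc n))
      from (by M e) = rep-≈ (rep-divℚ (subst (λ u → Rep u (P * (M * M))) (sym value) (rep-ℤ (P * (M * M)))) (rep-^ (suc n) rγ) (unit-^ (suc n) uγ))
          (lc1 (ι (γ' ^ suc n)) (scale P M²) (ident₁ P (M * M) (ι (γ' ^ suc n))))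
        where
        MP : central (suc n) ≡ M * P
        MP = trans (sym (ℤP.+-identityʳ (central (suc n)))) e
        ident₁ : ∀ P M i → P * M * i - + 16 * P * i ≡ i * (P * M - P * + 16)
        ident₁ = solve-∀
        reduced : + suc n * M ≡ + 2 * central n
        reduced = cancel-suc (n ℕ.+ n) (elc2 (- + suc n) (+ 1) MP (central-suc n) (ident (+ n) M (central (suc n)) (central n)))
          where
          ident : ∀ n M Γ γ → let P = + 1 + (n + n) in P * ((+ 1 + n) * M) - P * (+ 2 * γ) ≡ - (+ 1 + n) * (Γ - M * P) + + 1 * ((+ 1 + n) * Γ - + 2 * P * γ)
          ident = solve-∀
        M≈ : M ≈ + 4 * central n [ P ]
        M≈ = lc2 (+ 2) (- M) (≡⇒≈ reduced) P≈0 (ident (+ n) M (central n))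
          where
          ident : ∀ n M γ → M - + 4 * γ ≡ + 2 * ((+ 1 + n) * M - + 2 * γ) + - M * (+ 1 + (n + n) - + 0)
          ident = solve-∀
        -- M ≡ 4C(2n,n), and C(2n,n) ≡ (-1)^n t⁴ is a sign modulo p. This is the source of the
        -- constant 16.
        M² : M * M ≈ + 16 [ P ]
        M² = ≈-* M≈ M≈ ⟫ lc3 (+ 16 * (central n + sgn n * (t * t * (t * t)))) (+ 16 * (t * t * (t * t) * (t * t * (t * t)))) (+ 16 * (t * t * (t * t) + + 1) * (t * t + + 1))
            (weaken² central-n) (≡⇒≈ (sgn² n)) t²≈1 (ident (central n) (sgn n) t)
          where
          ident : ∀ γ s t → let T = t * t * (t * t) in + 4 * γ * (+ 4 * γ) - + 16
            ≡ + 16 * (γ + s * T) * (γ - s * T) + + 16 * (T * T) * (s * s - + 1) + + 16 * (T + + 1) * (t * t + + 1) * (t * t - + 1)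
          ident = solve-∀
        value : ℕtoℚ (((2 ℕ.* suc n) C suc n) ℕ.* ((2 ℕ.* suc n) C suc n)) ℚ.* inv2k-1 (suc n) ≡ ℤtoℚ (P * (M * M))
        value = trans (cong (λ z → ℤtoℚ z ℚ.* i) (trans (central-cast (suc n)) (trans (cong (λ z → z * z) MP) (ident M P))))
          (trans (cong (ℚ._* i) (ℤtoℚ-* (P * (M * M)) P)) (trans (ℚP.*-assoc (ℤtoℚ (P * (M * M))) (ℤtoℚ P) i)
            (trans (cong (ℤtoℚ (P * (M * M)) ℚ.*_) (trans (ℚP.*-comm (ℤtoℚ P) i) (recip-suc (n ℕ.+ n)))) (ℚP.*-identityʳ (ℤtoℚ (P * (M * M)))))))
          where
          i : ℚ
          i = inv2k-1 (suc n)
          ident : ∀ M P → M * P * (M * P) ≡ P * (M * M) * P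
          ident = solve-∀

    -- Here 2κ - 1 = p + 2(k+1) lies strictly between p and 2p, so the denominator is a unit, while
    -- the squared binomial is divisible by p².
    high : ∀ k → k < m → Rep (summand (suc (suc n ℕ.+ k))) (+ 0)
    high k k<m = rep-≈ (general κ unit-odd) (lc1 (ι (+ κ + + κ - + 1) * ι (γ' ^ κ)) (≈0² z z) (ident (central κ * central κ) (ι (+ κ + + κ - + 1)) (ι (γ' ^ κ))))
      where
      κ : ℕ
      κ = suc (suc n ℕ.+ k)
      z : central κ ≈ + 0 [ P ]
      z = central≈0 κ (s≤s (ℕP.+-mono-≤ {n} {suc (n ℕ.+ k)} {n} {κ} (ℕP.m≤n⇒m≤1+n (ℕP.m≤m+n n k)) (ℕP.m≤n⇒m≤1+n (ℕP.m≤n⇒m≤1+n (ℕP.m≤m+n n k)))))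
        (s≤s (subst (_≤ n ℕ.+ n) (cong suc (ℕP.+-suc n k)) (ℕP.+-monoʳ-< n (s≤s k<m))))
      unit-odd : Unit (+ κ + + κ - + 1)
      unit-odd = unit-≈ (lc1 (- + 1) P≈0 (e (+ n) (+ k))) (unit-* unit-2 (unit-≤n {suc k} (s≤s z≤n) (ℕP.m≤n⇒m≤1+n k<m)))
        where
        e : ∀ n k → + 2 * (+ 1 + k) - (+ 2 + n + k + (+ 2 + n + k) - + 1) ≡ - + 1 * (+ 1 + (n + n) - + 0)
        e = solve-∀
      ident : ∀ a i j → a * i * j - + 0 ≡ i * j * (a - + 0)
      ident = solve-∀

    S-rep : Rep (S p γ) (V x' + + 16 * P * ι (γ' ^ suc n))
    S-rep = subst (λ N → Rep (sumTo N summand) (V x' + + 16 * P * ι (γ' ^ suc n))) (sym (ℕP.+-suc n m))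
      (rep-extend (suc n) m {summand} (rep-+ (rep-sum n low) middle) high)

  -- The factor p in front means that γ^n, a sign up to the power of 2 involved, is needed modulo p
  -- only.
  16P*ι : ∀ γ w {z} → Unit (γ * w) → γ ^ n ≈ w [ P ] → + 16 ≈ γ * w * z [ P ] → + 16 * P * ι (γ ^ suc n) ≈ P * z [ P² ]
  16P*ι γ w {z} u h g = ≡⇒≈ (ident P (ι (γ ^ suc n))) ⟫ scale P (lc3 (ι y) (- (z * ι y)) z g h' (weaken² (ι-inverse unit-y)) (ident' (ι y) γ w z y))
    where
    y : ℤ
    y = γ ^ suc n
    h' : y ≈ γ * w [ P ]
    h' = ≈-*ˡ γ h
    unit-y : Unit y
    unit-y = unit-≈ (≈-sym h') u
    ident : ∀ P i → + 16 * P * i ≡ P * (+ 16 * i)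
    ident = solve-∀
    ident' : ∀ i γ w z y → + 16 * i - z ≡ i * (+ 16 - γ * w * z) + - (z * i) * (y - γ * w) + z * (y * i - + 1)
    ident' = solve-∀

-- Representatives of both sides at the three arguments

module Sides (m : ℕ) (pr : Prime (suc (suc m ℕ.+ suc m))) (L : ℤ)
  (L-sign : IsSign L) (L≈t : L ≈ (+ 2) ℤ.^ suc m [ + suc (suc m ℕ.+ suc m) ]) where

  open import Data.Integer using (_+_; _*_; _-_; -_; _^_)

  open OddPrime m pr public
  open Representatives (n ℕ.+ n) pr public
  open SumRepresentatives m pr public

  half : ℤ
  half = - ι (+ 2)

  rep-half : Rep (-[1+ 0 ] ℚ./ 2) half
  rep-half = rep (+ 2) (- + 1) unit-2 refl (lc1 (- + 1) (≈-sym (ι-inverse unit-2)) (e (ι (+ 2))))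
    where
    e : ∀ i → - + 1 - - i * + 2 ≡ - + 1 * (+ 1 - + 2 * i)
    e = solve-∀

  unit-8 : Unit (+ 8)
  unit-8 = unit-* unit-2 (unit-* unit-2 unit-2)

  unit-16 : Unit (+ 16)
  unit-16 = unit-* unit-2 unit-8

  unit-32 : Unit (+ 32)
  unit-32 = unit-* unit-2 unit-16

  unit-L : Unit L
  unit-L = unit-≈ (≈-sym L≈t) unit-t

  S₋₁₆ : Rep (S p (-[1+ 15 ] ℚ./ 1)) (V (+ 1) + P * - sgn n)
  S₋₁₆ = rep-≈ (S-rep (rep-ℤ (- + 16)) (unit-neg unit-16) (≡⇒≈ refl))
    (≈-+ (≈-refl {V (+ 1)}) (16P*ι (- + 16) (sgn n) {z = - sgn n} (unit-* (unit-neg unit-16) (unit-sgn n))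
      (≡⇒≈ ([-16]^ n) ⟫ lc1 (sgn n * (t * t + + 1)) t²≈1 (e (sgn n) t)) (≡⇒≈ (elc1 (- + 16) (sgn² n) (e' (sgn n))))))
    where
    e : ∀ s t → s * (t * t * (t * t)) - s ≡ s * (t * t + + 1) * (t * t - + 1)
    e = solve-∀
    e' : ∀ s → + 16 - - + 16 * s * - s ≡ - + 16 * (s * s - + 1)
    e' = solve-∀

  S₈ : Rep (S p (+ 8 ℚ./ 1)) (V (- + 2) + P * (+ 2 * L))
  S₈ = rep-≈ (S-rep (rep-ℤ (+ 8)) unit-8 (≡⇒≈ refl))
    (≈-+ (≈-refl {V (- + 2)}) (16P*ι (+ 8) L {+ 2 * L} (unit-* unit-8 unit-L)
      (≡⇒≈ (trans (^-*-distrib (+ 2) (+ 4) n) (cong (t *_) (^-*-distrib (+ 2) (+ 2) n))) ⟫ lc2 t (- + 1) t²≈1 L≈t (e t L))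
      (≡⇒≈ (elc1 (- + 16) (sign² L-sign) (e' L)))))
    where
    e : ∀ t L → t * (t * t) - L ≡ t * (t * t - + 1) + - + 1 * (L - t)
    e = solve-∀
    e' : ∀ s → + 16 - + 8 * s * (+ 2 * s) ≡ - + 16 * (s * s - + 1)
    e' = solve-∀

  S₃₂ : Rep (S p (+ 32 ℚ./ 1)) (V half + P * (ι (+ 2) * L))
  S₃₂ = rep-≈ (S-rep (rep-ℤ (+ 32)) unit-32 (lc1 (- + 16) (ι-inverse unit-2) (e₀ (ι (+ 2)))))
    (≈-+ (≈-refl {V half}) (16P*ι (+ 32) L {ι (+ 2) * L} (unit-* unit-32 unit-L)
      (≡⇒≈ (trans (^-*-distrib (+ 2) (+ 16) n) (cong (t *_) (trans (^-*-distrib (+ 4) (+ 4) n) (cong (λ z → z * z) (^-*-distrib (+ 2) (+ 2) n)))))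
        ⟫ lc2 (t * (t * t + + 1)) (- + 1) t²≈1 L≈t (e t L))
      (lc2 (- + 16) (- (+ 16 * L * L)) (≡⇒≈ (sign² L-sign)) (weaken² (ι-inverse unit-2)) (e' L (ι (+ 2))))))
    where
    e₀ : ∀ i → + 32 * - i - - + 16 ≡ - + 16 * (+ 2 * i - + 1)
    e₀ = solve-∀
    e : ∀ t L → t * (t * t * (t * t)) - L ≡ t * (t * t + + 1) * (t * t - + 1) + - + 1 * (L - t)
    e = solve-∀
    e' : ∀ s i → + 16 - + 32 * s * (i * s) ≡ - + 16 * (s * s - + 1) + - (+ 16 * s * s) * (+ 2 * i - + 1)
    e' = solve-∀

  [p-1]/2 : (p ∸ 1) ℕ./ 2 ≡ n
  [p-1]/2 = trans (cong (ℕ._/ 2) (e n)) (m*n/n≡m n 2)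
    where
    e : ∀ n → n ℕ.+ n ≡ n ℕ.* 2
    e = ℕ-solve-∀

  R-half-rep : ∀ {x z} → Rep x z → Rep (R ((p ∸ 1) ℕ./ 2) x) (V z)
  R-half-rep {x} {z} r = subst (λ k → Rep (R k x) (V z)) (sym [p-1]/2) (R-rep r)

  R₁ : Rep (R ((p ∸ 1) ℕ./ 2) 1ℚ) (V (+ 1))
  R₁ = R-half-rep (rep-ℤ (+ 1))

  R₂ : Rep (R ((p ∸ 1) ℕ./ 2) (-[1+ 1 ] ℚ./ 1)) (V (- + 2))
  R₂ = R-half-rep (rep-ℤ (- + 2))

  R₃ : Rep (R ((p ∸ 1) ℕ./ 2) (-[1+ 0 ] ℚ./ 2) ℚ.+ divℚ (ℕtoℚ p) (ℕtoℚ 2) ℚ.* ℤtoℚ L) (V half + P * ι (+ 2) * L)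
  R₃ = rep-+ (R-half-rep rep-half) (rep-* (rep-divℚ (rep-ℤ P) (rep-ℤ (+ 2)) unit-2) (rep-ℤ L))

  third : CongQ p 2 (R ((p ∸ 1) ℕ./ 2) (-[1+ 0 ] ℚ./ 2) ℚ.+ divℚ (ℕtoℚ p) (ℕtoℚ 2) ℚ.* ℤtoℚ L) (S p (+ 32 ℚ./ 1))
  third = congQ₂ R₃ S₃₂ (≡⇒≈ (cong (λ z → V half + z) (ℤP.*-assoc P (ι (+ 2)) L)))

  1+2half≈0 : + 1 + + 2 * half ≈ + 0 [ P² ]
  1+2half≈0 = lc1 (- + 1) (ι-inverse unit-2) (e (ι (+ 2)))
    where
    e : ∀ i → + 1 + + 2 * - i - + 0 ≡ - + 1 * (+ 2 * i - + 1)
    e = solve-∀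

  half^n : half ^ n ≈ sgn n * L [ P ]
  half^n = lc3 (- (half ^ n)) t (- sgn n) t²≈1 product L≈t (e t (half ^ n) (sgn n) L)
    where
    product : t * half ^ n ≈ sgn n [ P ]
    product = ≡⇒≈ (sym (^-*-distrib (+ 2) half n)) ⟫ ≈-^ n (lc1 {x = + 2 * half} {y = - + 1} (+ 1) (weaken² 1+2half≈0) (e₀ half))
      where
      e₀ : ∀ h → + 2 * h - - + 1 ≡ + 1 * (+ 1 + + 2 * h - + 0)
      e₀ = solve-∀
    e : ∀ t h s L → h - s * L ≡ - h * (t * t - + 1) + t * (t * h - s) + - s * (L - t)
    e = solve-∀

  -- The boundary term p c(n) x^(n+1) of `V-formula` at x = -1/2 is -pL/2 and cancels the term that
  -- S contributes at k = n + 1; the factor 1 + 2x vanishes.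
  V-half : V half + P * (ι (+ 2) * L) ≈ - (+ 1 + half) * Leg n half + + n * Leg m half [ P² ]
  V-half = lc3 (+ 1) (- (+ n * Leg n half)) (+ 1) (V-formula half) 1+2half≈0 (scale P tail) (e (V half) half (Leg n half) (Leg m half) P (c n) (half ^ n) (+ n) (ι (+ 2) * L))
    where
    tail : c n * half ^ suc n ≈ - (ι (+ 2) * L) [ P ]
    tail = lc4 {a' = central n} {b' = sgn n * (t * t * (t * t))} (half * (c n)) (half * sgn n * L) (half * L * (t * t + + 1)) (half * L) half^n (weaken² central-n) t²≈1 (≡⇒≈ (sgn² n))
      (e₁ (c n) (central n) (half ^ n) (sgn n) (ι (+ 2)) L t c-n (sgn² n))
      where
      e₁ : ∀ c γ h s i L t → c ≡ γ → s * s ≡ + 1 → c * (- i * h) - - (i * L)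
        ≡ - i * c * (h - s * L) + - i * s * L * (γ - s * (t * t * (t * t))) + - i * L * (t * t + + 1) * (t * t - + 1) + - i * L * (s * s - + 1)
      e₁ c .c h s i L t refl ss = elc1 (- i * L * (t * t * (t * t) - + 1)) ss (e₂ c h s i L t)
        where
        e₂ : ∀ c h s i L t → c * (- i * h) - - (i * L)
          - (- i * c * (h - s * L) + - i * s * L * (c - s * (t * t * (t * t))) + - i * L * (t * t + + 1) * (t * t - + 1) + - i * L * (s * s - + 1))
          ≡ - i * L * (t * t * (t * t) - + 1) * (s * s - + 1)
        e₂ = solve-∀
    e : ∀ v x ℓ ℓ' P c h n z → v + P * z - (- (+ 1 + x) * ℓ + n * ℓ')
      ≡ + 1 * (v - (- (+ 1 + x) * ℓ - n * ((+ 1 + + 2 * x) * ℓ - ℓ') + P * c * (x * h))) + - (n * ℓ) * (+ 1 + + 2 * x - + 0) + + 1 * (P * (c * (x * h)) - P * - z)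
    e = solve-∀

Claim₁ : ℕ → ℤ → Set
Claim₁ p x = (CongQ p 2 (R ((p ∸ 1) ℕ./ 2) 1ℚ ℚ.- ℕtoℚ p) (S p (-[1+ 15 ] ℚ./ 1))
    × CongQ p 2 (S p (-[1+ 15 ] ℚ./ 1)) (ℚ.- (ℕtoℚ 2 ℚ.* ℤtoℚ (legendre 2 p) ℚ.* ℤtoℚ x)))
  × (CongQ p 2 (R ((p ∸ 1) ℕ./ 2) (-[1+ 1 ] ℚ./ 1) ℚ.+ ℕtoℚ 2 ℚ.* ℕtoℚ p ℚ.* ℤtoℚ (legendre 2 p)) (S p (+ 8 ℚ./ 1))
    × CongQ p 2 (S p (+ 8 ℚ./ 1)) (ℤtoℚ (legendre 2 p) ℚ.* divℚ (ℕtoℚ p) (ℕtoℚ 2 ℚ.* ℤtoℚ x)))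
  × (CongQ p 2 (R ((p ∸ 1) ℕ./ 2) (-[1+ 0 ] ℚ./ 2) ℚ.+ divℚ (ℕtoℚ p) (ℕtoℚ 2) ℚ.* ℤtoℚ (legendre 2 p)) (S p (+ 32 ℚ./ 1))
    × CongQ p 2 (S p (+ 32 ℚ./ 1)) (divℚ (ℕtoℚ p) (ℕtoℚ 4 ℚ.* ℤtoℚ x) ℚ.- ℤtoℚ x))

-- The three congruences for p = 4w + 1

module PartOne (w' : ℕ) (pr : Prime (suc (suc (w' ℕ.+ suc w') ℕ.+ suc (w' ℕ.+ suc w')))) where

  open import Data.Integer using (_+_; _*_; _-_; -_; _^_)

  private
    m : ℕ
    m = w' ℕ.+ suc w'

  open QuarterKummer w' pr
  open Kummer m pr using (Ê; V-at-1; V-reflect)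

  L : ℤ
  L = legendre 2 p

  L-sign : IsSign L
  L-sign = proj₁ (LegendreOfTwo.legendre-correct m pr (RootEven.root w' pr))

  L≈t : L ≈ t [ P ]
  L≈t = proj₂ (LegendreOfTwo.legendre-correct m pr (RootEven.root w' pr))

  open Sides m pr L L-sign L≈t using (unit-L; half; 1+2half≈0; V-half; S₋₁₆; S₈; S₃₂; R₁; R₂; R₃; third; rep-ℤ; rep-*; rep-neg; rep--; rep-+; rep-divℚ; congQ₂; Rep)

  ÊD : Ê * D ≈ + 2 * P [ P² ]
  ÊD = lc2 (+ 1) (+ 1) ÊU vanish (e Ê D U P)
    where
    vanish : Ê * (D - U) ≈ + 0 [ P² ]
    vanish = ≈0²-difference Ê≈0 D≈U
    e : ∀ E D U P → E * D - + 2 * P ≡ + 1 * (E * U - + 2 * P) + + 1 * (E * (D - U) - + 0)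
    e = solve-∀

  c-n≈1 : c n ≈ + 1 [ P ]
  c-n≈1 = ≡⇒≈ c-n ⟫ weaken² t⁴ ⟫ lc1 (t * t + + 1) t²≈1 (e t)
    where
    e : ∀ t → t * t * (t * t) - + 1 ≡ (t * t + + 1) * (t * t - + 1)
    e = solve-∀

  -- With Ê ≡ 2p/D, `V-at-1` reads V(1) - p ≡ -(D + p/D), the same expression as for 2h₁ in
  -- `h₁-value`.
  V-at-1-value : V (+ 1) - P ≈ + 2 * h₁ [ P² ]
  V-at-1-value = cancel² (+ 2 * D) (unit-* unit-2 unit-D)
    (lc4 D (- + 2) (- + 1) (+ 2 * D) V-at-1 h₁-value ÊD (scale P c-n≈1) (e D (V (+ 1)) h₁ Ê P (c n)))
    where
    e : ∀ D V h E P c → + 2 * D * (V - P) - + 2 * D * (+ 2 * h)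
      ≡ D * (+ 2 * (V + D) - (- E + + 2 * P * c)) + - + 2 * (D * (+ 2 * h + D) - - P) + - + 1 * (E * D - + 2 * P) + + 2 * D * (P * c - P * + 1)
    e = solve-∀

  -- `V-reflect` expresses V(-2) through -(V(1) + D), whose double is Ê up to the term in c(n),
  -- which cancels. The boundary term p c(n) (-2)^(n+1) that remains is -2pL.
  V-at--2-value : + 2 * (V (- + 2) + + 2 * P * L) ≈ Ê [ P² ]
  V-at--2-value = lc4 (+ 2) (- + 1) (+ 2) (- + 4) reflected V-at-1 (scale P power) (scale P (≈-sym L≈t))
    (e (V (- + 2)) (V (+ 1)) D Ê P (c n) ((- + 2) ^ suc n) t L)
    where
    reflected : V (- + 2) - P * c n * (- + 2) ^ suc n ≈ - (V (+ 1) - P * c n) - D [ P² ]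
    reflected = ≡⇒≈ (trans (sym (ℤP.*-identityˡ (V (- + 2) - P * c n * (- + 2) ^ suc n))) (cong (_* (V (- + 2) - P * c n * (- + 2) ^ suc n)) (sym sgn-n))) ⟫ V-reflect
    power : c n * (- + 2) ^ suc n ≈ - + 2 * t [ P ]
    power = ≈-* c-n≈1 (≡⇒≈ (cong (- + 2 *_) (even-power (+ 2)))) ⟫ ≡⇒≈ (ℤP.*-identityˡ (- + 2 * t))
    e : ∀ V₂ V₁ D E P c x t L → + 2 * (V₂ + + 2 * P * L) - E
      ≡ + 2 * (V₂ - P * c * x - (- (V₁ - P * c) - D)) + - + 1 * (+ 2 * (V₁ + D) - (- E + + 2 * P * c)) + + 2 * (P * (c * x) - P * (- + 2 * t)) + - + 4 * (P * t - P * L)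
    e = solve-∀

  ℓ : ℤ
  ℓ = Leg n half

  -- tℓ ≡ U and D(1 + t²) ≡ 2U, while 1 + t² ≡ 2tL; dividing by 2t leaves ℓ ≡ LD, free of the Fermat
  -- quotient.
  ℓ≈LD : ℓ ≈ L * D [ P² ]
  ℓ≈LD = cancel² (+ 2 * t) (unit-* unit-2 unit-t)
    (lc4 (+ 2) (- + 1) D (- D) tℓ D-value (t-square L≈t) (≡⇒≈ (sign² L-sign)) (e t ℓ L D U))
    where
    tℓ : t * ℓ ≈ U [ P² ]
    tℓ = proj₁ (Leg-half half 1+2half≈0 w ℕP.≤-refl)
    e : ∀ t ℓ L D U → + 2 * t * ℓ - + 2 * t * (L * D) ≡ + 2 * (t * ℓ - U) + - + 1 * (D * (+ 2 + (t * t - + 1)) - + 2 * U) + D * ((t - L) * (t - L) - + 0) + - D * (L * L - + 1)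
    e = solve-∀

  2V-half : + 2 * (V half + P * (ι (+ 2) * L)) ≈ - ℓ [ P² ]
  2V-half = lc3 (+ 2) (- ℓ) (+ 2 * + n) V-half 1+2half≈0 odd (e (V half + P * (ι (+ 2) * L)) half ℓ (Leg m half) (+ n))
    where
    odd : Leg m half ≈ + 0 [ P² ]
    odd = subst (λ k → Leg k half ≈ + 0 [ P² ]) (sym (ℕP.+-suc w' w')) ([ (λ z → z) , (λ e → ⊥-elim (w'+w'≢n e)) ]′ (proj₂ (Leg-half half 1+2half≈0 w' (ℕP.≤-trans (ℕP.+-monoʳ-≤ w' (ℕP.n≤1+n w')) (ℕP.n≤1+n m)))))
      where
      w'+w'≢n : n ≡ w' ℕ.+ w' → ⊥
      w'+w'≢n e = ℕP.<⇒≢ (s≤s (ℕP.+-monoʳ-≤ w' (ℕP.n≤1+n w'))) (sym e)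
    e : ∀ v x ℓ ℓ' n → + 2 * v - - ℓ ≡ + 2 * (v - (- (+ 1 + x) * ℓ + n * ℓ')) + - ℓ * (+ 1 + + 2 * x - + 0) + + 2 * n * (ℓ' - + 0)
    e = solve-∀

  module _ (x y : ℤ) (xy : P ≡ x * x + y * y) (x₄ : x ≈ + 1 [ + 4 ]) (y₂ : y ≈ + 0 [ + 2 ]) where

    h₁-x : h₁ ≡ - (L * x)
    h₁-x = h₁≡-Lx L L-sign L≈t x y xy x₄ y₂

    D≈2Lx : D ≈ + 2 * (L * x) [ P ]
    D≈2Lx = cancel D unit-D (lc3 (+ 1) (- (+ 2 * D)) (- + 1) (weaken² h₁-value) (≡⇒≈ h₁-x) P≈0 (e D h₁ (L * x) P))
      where
      e : ∀ D h z P → D * D - D * (+ 2 * z) ≡ + 1 * (D * (+ 2 * h + D) - - P) + - (+ 2 * D) * (h - - z) + - + 1 * (P - + 0)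
      e = solve-∀

    unit-x : Unit x
    unit-x = unit-*ʳ L (unit-*ʳ (+ 2) (unit-≈ D≈2Lx unit-D))

    first-value : CongQ p 2 (S p (-[1+ 15 ] ℚ./ 1)) (ℚ.- (ℕtoℚ 2 ℚ.* ℤtoℚ L ℚ.* ℤtoℚ x))
    first-value = congQ₂ S₋₁₆ (rep-neg (rep-* (rep-* (rep-ℤ (+ 2)) (rep-ℤ L)) (rep-ℤ x)))
      (lc3 (+ 1) (+ 2) (- P) V-at-1-value (≡⇒≈ h₁-x) (≡⇒≈ sgn-n) (e (V (+ 1)) P h₁ L x (sgn n)))
      where
      e : ∀ V P h L x s → V + P * - s - - (+ 2 * L * x) ≡ + 1 * (V - P - + 2 * h) + + 2 * (h - - (L * x)) + - P * (s - + 1)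
      e = solve-∀

    second-value : CongQ p 2 (S p (+ 8 ℚ./ 1)) (ℤtoℚ L ℚ.* divℚ (ℕtoℚ p) (ℕtoℚ 2 ℚ.* ℤtoℚ x))
    second-value = congQ₂ S₈ (rep-* (rep-ℤ L) (rep-divℚ (rep-ℤ P) (rep-* (rep-ℤ (+ 2)) (rep-ℤ x)) unit-2x))
      (cancel² (+ 2 * D) (unit-* unit-2 unit-D) (lc4 D (+ 1) (- + 2) (- + 2 * P) V-at--2-value ÊD (scale P reduce-D) (≡⇒≈ (sign² L-sign))
        (e (V (- + 2)) D L Ê P (ι (+ 2 * x)))))
      where
      unit-2x : Unit (+ 2 * x)
      unit-2x = unit-* unit-2 unit-x
      reduce-D : L * ι (+ 2 * x) * D ≈ L * L [ P ]
      reduce-D = lc2 (L * ι (+ 2 * x)) (L * L) D≈2Lx (weaken² (ι-inverse unit-2x)) (e₀ L x D (ι (+ 2 * x)))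
        where
        e₀ : ∀ L x D i → L * i * D - L * L ≡ L * i * (D - + 2 * (L * x)) + L * L * (+ 2 * x * i - + 1)
        e₀ = solve-∀
      e : ∀ V D L E P i → + 2 * D * (V + P * (+ 2 * L)) - + 2 * D * (L * (P * i))
        ≡ D * (+ 2 * (V + + 2 * P * L) - E) + + 1 * (E * D - + 2 * P) + - + 2 * (P * (L * i * D) - P * (L * L)) + - + 2 * P * (L * L - + 1)
      e = solve-∀

    third-value : CongQ p 2 (S p (+ 32 ℚ./ 1)) (divℚ (ℕtoℚ p) (ℕtoℚ 4 ℚ.* ℤtoℚ x) ℚ.- ℤtoℚ x)
    third-value = congQ₂ S₃₂ (rep-- (rep-divℚ (rep-ℤ P) (rep-* (rep-ℤ (+ 4)) (rep-ℤ x)) unit-4x) (rep-ℤ x))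
      (cancel² (+ 2 * D) (unit-* unit-2 unit-D)
        (lc4 D (- D) (- L) (- + 1) 2V-half ℓ≈LD h₁-value (scale P reduce-D) (e (V half + P * (ι (+ 2) * L)) D L ℓ x P (ι (+ 4 * x)) h₁ h₁-x (sign² L-sign))))
      where
      unit-4x : Unit (+ 4 * x)
      unit-4x = unit-* unit-4 unit-x
      reduce-D : + 2 * ι (+ 4 * x) * D ≈ L [ P ]
      reduce-D = lc2 (+ 2 * ι (+ 4 * x)) L D≈2Lx (weaken² (ι-inverse unit-4x)) (e₀ L x D (ι (+ 4 * x)))
        where
        e₀ : ∀ L x D i → + 2 * i * D - L ≡ + 2 * i * (D - + 2 * (L * x)) + L * (+ 4 * x * i - + 1)
        e₀ = solve-∀
      e : ∀ v D L ℓ x P i h → h ≡ - (L * x) → L * L ≡ + 1 → + 2 * D * v - + 2 * D * (P * i - x)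
        ≡ D * (+ 2 * v - - ℓ) + - D * (ℓ - L * D) + - L * (D * (+ 2 * h + D) - - P) + - + 1 * (P * (+ 2 * i * D) - P * L)
      e v D L ℓ x P i h refl LL = elc1 (- (+ 2 * x * D)) LL (e₁ v D L ℓ x P i)
        where
        e₁ : ∀ v D L ℓ x P i → + 2 * D * v - + 2 * D * (P * i - x)
          - (D * (+ 2 * v - - ℓ) + - D * (ℓ - L * D) + - L * (D * (+ 2 * - (L * x) + D) - - P) + - + 1 * (P * (+ 2 * i * D) - P * L))
          ≡ - (+ 2 * x * D) * (L * L - + 1)
        e₁ = solve-∀

    part-one : Claim₁ p x
    part-one = (congQ₂ (rep-- R₁ (rep-ℤ P)) S₋₁₆ (≡⇒≈ (cong (λ z → V (+ 1) + z) (trans (e₁ P) (cong (λ s → P * - s) (sym sgn-n))))) , first-value)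
      , (congQ₂ (rep-+ R₂ (rep-* (rep-* (rep-ℤ (+ 2)) (rep-ℤ P)) (rep-ℤ L))) S₈ (≡⇒≈ (cong (λ z → V (- + 2) + z) (e₂ P L))) , second-value)
      , (third , third-value)
      where
      e₁ : ∀ P → - P ≡ P * - + 1
      e₁ = solve-∀
      e₂ : ∀ P L → + 2 * P * L ≡ P * (+ 2 * L)
      e₂ = solve-∀

Claim₂ : ℕ → Set
Claim₂ p = (CongQ p 1 (R ((p ∸ 1) ℕ./ 2) 1ℚ) (S p (-[1+ 15 ] ℚ./ 1))
    × CongQ p 1 (S p (-[1+ 15 ] ℚ./ 1)) (ℚ.- (divℚ 1ℚ (ℕtoℚ 2) ℚ.* ℤtoℚ (legendre 2 p) ℚ.* ℕtoℚ (((p ℕ.+ 1) ℕ./ 2) C ((p ℕ.+ 1) ℕ./ 4)))))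
  × (CongQ p 1 (R ((p ∸ 1) ℕ./ 2) (-[1+ 1 ] ℚ./ 1)) (S p (+ 8 ℚ./ 1))
    × CongQ p 1 (S p (+ 8 ℚ./ 1)) (ℚ.- (divℚ 1ℚ (ℕtoℚ 2) ℚ.* ℤtoℚ (legendre 2 p) ℚ.* ℕtoℚ (((p ℕ.+ 1) ℕ./ 2) C ((p ℕ.+ 1) ℕ./ 4)))))
  × (CongQ p 2 (R ((p ∸ 1) ℕ./ 2) (-[1+ 0 ] ℚ./ 2) ℚ.+ divℚ (ℕtoℚ p) (ℕtoℚ 2) ℚ.* ℤtoℚ (legendre 2 p)) (S p (+ 32 ℚ./ 1))
    × CongQ p 2 (S p (+ 32 ℚ./ 1)) (ℚ.- (divℚ (ℕtoℚ (p ℕ.+ 1)) (ℕtoℚ (2 ℕ.^ p ℕ.+ 2)) ℚ.* ℕtoℚ (((p ℕ.+ 1) ℕ./ 2) C ((p ℕ.+ 1) ℕ./ 4)))))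

-- The three congruences for p = 4v + 3

module PartTwo (v : ℕ) (pr : Prime (suc (suc (v ℕ.+ v) ℕ.+ suc (v ℕ.+ v)))) where

  open import Data.Integer using (_+_; _*_; _-_; -_; _^_)

  private
    m : ℕ
    m = v ℕ.+ v

  open ThreeModFour v pr

  L : ℤ
  L = legendre 2 p

  L-sign : IsSign L
  L-sign = proj₁ (LegendreOfTwo.legendre-correct m pr (RootOdd.root v pr))

  L≈t : L ≈ t [ P ]
  L≈t = proj₂ (LegendreOfTwo.legendre-correct m pr (RootOdd.root v pr))

  open Sides m pr L L-sign L≈t using (half; 1+2half≈0; V-half; S₋₁₆; S₈; S₃₂; R₁; R₂; R₃; third; rep-ℤ; rep-*; rep-neg; rep-≈; rep-divℚ; congQ₁; congQ₂; Rep)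

  L≡sgn : L ≡ - + 1 * sgn v
  L≡sgn = sign-unique L-sign (sgn-sign (suc v)) (L≈t ⟫ t≈sgn)

  Γ : ℤ
  Γ = central (suc v)

  [p+1]/2 : (p ℕ.+ 1) ℕ./ 2 ≡ suc v ℕ.+ suc v
  [p+1]/2 = trans (cong (ℕ._/ 2) (e v)) (m*n/n≡m (suc v ℕ.+ suc v) 2)
    where
    e : ∀ v → suc (suc (v ℕ.+ v) ℕ.+ suc (v ℕ.+ v)) ℕ.+ 1 ≡ (suc v ℕ.+ suc v) ℕ.* 2
    e = ℕ-solve-∀

  [p+1]/4 : (p ℕ.+ 1) ℕ./ 4 ≡ suc v
  [p+1]/4 = trans (cong (ℕ._/ 4) (e v)) (m*n/n≡m (suc v) 4)
    where
    e : ∀ v → suc (suc (v ℕ.+ v) ℕ.+ suc (v ℕ.+ v)) ℕ.+ 1 ≡ suc v ℕ.* 4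
    e = ℕ-solve-∀

  rep-Γ : Rep (ℕtoℚ (((p ℕ.+ 1) ℕ./ 2) C ((p ℕ.+ 1) ℕ./ 4))) Γ
  rep-Γ = subst₂ (λ a b → Rep (ℕtoℚ (a C b)) Γ) (sym [p+1]/2) (sym [p+1]/4)
    (rep-≈ (rep-ℤ (+ ((suc v ℕ.+ suc v) C suc v))) (≡⇒≈ (sym (bin≡C (suc v ℕ.+ suc v) (suc v)))))

  rep-target : Rep (ℚ.- (divℚ 1ℚ (ℕtoℚ 2) ℚ.* ℤtoℚ L ℚ.* ℕtoℚ (((p ℕ.+ 1) ℕ./ 2) C ((p ℕ.+ 1) ℕ./ 4)))) (- (+ 1 * ι (+ 2) * L * Γ))
  rep-target = rep-neg (rep-* (rep-* (rep-divℚ (rep-ℤ (+ 1)) (rep-ℤ (+ 2)) unit-2) (rep-ℤ L)) rep-Γ)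

  V-value : V (+ 1) ≈ - (+ 1 * ι (+ 2) * L * Γ) [ P ]
  V-value = cancel (+ 2) unit-2 (lc3 (+ 1) (+ 2 * ι (+ 2) * Γ) (sgn v * Γ) 2V-at-1 (≡⇒≈ L≡sgn) (≈-sym (weaken² (ι-inverse unit-2))) (e (V (+ 1)) (ι (+ 2)) L (sgn v) Γ))
    where
    e : ∀ V i L s Γ → + 2 * V - + 2 * - (+ 1 * i * L * Γ) ≡ + 1 * (+ 2 * V - - (- + 1 * s * Γ)) + + 2 * i * Γ * (L - - + 1 * s) + s * Γ * (+ 1 - + 2 * i)
    e = solve-∀

  drop-P : ∀ a b → a + P * b ≈ a [ P ]
  drop-P a b = lc1 b P≈0 (e a b P)
    where
    e : ∀ a b P → a + P * b - a ≡ b * (P - + 0)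
    e = solve-∀

  -- Modulo p² this is 4tL, by (t - L)² ≡ 0 and L² = 1; in the statement it stands for the power 2^n
  -- that divides P_(n-1)(0).
  W : ℤ
  W = + (2 ℕ.^ p ℕ.+ 2)

  W-value : W ≡ + 2 * (t * t) + + 2
  W-value = cong (_+ + 2) (trans (pos-^ p) (cong (+ 2 *_) (ℤP.^-distribˡ-+-* (+ 2) n n)))
    where
    pos-^ : ∀ k → + (2 ℕ.^ k) ≡ (+ 2) ^ k
    pos-^ zero    = refl
    pos-^ (suc k) = trans (ℤP.pos-* 2 (2 ℕ.^ k)) (cong (+ 2 *_) (pos-^ k))

  unit-W : Unit W
  unit-W = unit-≈ (≈-sym (≡⇒≈ W-value ⟫ lc1 (+ 2) t²≈1 (e t))) (unit-* unit-2 unit-2)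
    where
    e : ∀ t → + 2 * (t * t) + + 2 - + 4 ≡ + 2 * (t * t - + 1)
    e = solve-∀

  -- n is odd, so P_n(0) drops out and t P_(n-1)(0) ≡ 2(-1)^v C(2v,v). Multiplication by W ≡ 4tL,
  -- with (v+1)Γ = 2n C(2v,v), L = -(-1)^v and 4(v+1) = p + 1, gives -(p+1)Γ.
  V-half-value : V half + P * (ι (+ 2) * L) ≈ - ((P + + 1) * ι W * Γ) [ P² ]
  V-half-value = cancel² W unit-W (≡⇒≈ (cong (_* VH) W-value)
    ⟫ lc4 (+ 2 * (t * t) + + 2) (+ 2 * + n * ℓ) (+ 4 * L * + n) (+ 4) VH≈ (t-square L≈t) tℓ (≡⇒≈ (central-suc v)) (e t VH ℓ L (sgn v) (central v) Γ (+ v) L≡sgn (sgn² v))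
    ⟫ lc1 ((P + + 1) * Γ) (ι-inverse unit-W) (e' P Γ W (ι W)))
    where
    VH ℓ : ℤ
    VH = V half + P * (ι (+ 2) * L)
    ℓ = Leg m half
    legs : ((+ 2) ^ (v ℕ.+ v) * Leg (v ℕ.+ v) half ≈ sgn v * central v [ P² ]) × (Leg (suc (v ℕ.+ v)) half ≈ + 0 [ P² ] ⊎ n ≡ v ℕ.+ v)
    legs = Leg-half half 1+2half≈0 v (ℕP.n≤1+n (v ℕ.+ v))
    VH≈ : VH ≈ + n * ℓ [ P² ]
    VH≈ = lc2 (+ 1) (- (+ 1 + half)) V-half ([ (λ z → z) , (λ f → ⊥-elim (ℕP.1+n≢n f)) ]′ (proj₂ legs)) (e₀ VH half (Leg n half) (+ n * ℓ))
      where
      e₀ : ∀ V x z y → V - y ≡ + 1 * (V - (- (+ 1 + x) * z + y)) + - (+ 1 + x) * (z - + 0)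
      e₀ = solve-∀
    tℓ : t * ℓ ≈ + 2 * (sgn v * central v) [ P² ]
    tℓ = ≡⇒≈ (ℤP.*-assoc (+ 2) ((+ 2) ^ m) ℓ) ⟫ ≈-*ˡ (+ 2) (proj₁ legs)
    e : ∀ t VH ℓ L s γ Γ v → L ≡ - + 1 * s → s * s ≡ + 1 → let n = + 1 + (v + v) ; P = + 1 + (n + n) in
      (+ 2 * (t * t) + + 2) * VH - - ((P + + 1) * Γ)
      ≡ (+ 2 * (t * t) + + 2) * (VH - n * ℓ) + + 2 * n * ℓ * ((t - L) * (t - L) - + 0) + + 4 * L * n * (t * ℓ - + 2 * (s * γ)) + + 4 * ((+ 1 + v) * Γ - + 2 * n * γ)
    e t VH ℓ L s γ Γ v refl ss = elc1 (- ((+ 1 + (v + v)) * (+ 8 * γ + + 2 * ℓ))) ss (e₁ t VH ℓ s γ Γ v)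
      where
      e₁ : ∀ t VH ℓ s γ Γ v → let n = + 1 + (v + v) ; P = + 1 + (n + n) ; L = - + 1 * s in
        (+ 2 * (t * t) + + 2) * VH - - ((P + + 1) * Γ)
        - ((+ 2 * (t * t) + + 2) * (VH - n * ℓ) + + 2 * n * ℓ * ((t - L) * (t - L) - + 0) + + 4 * L * n * (t * ℓ - + 2 * (s * γ)) + + 4 * ((+ 1 + v) * Γ - + 2 * n * γ))
        ≡ - (n * (+ 8 * γ + + 2 * ℓ)) * (s * s - + 1)
      e₁ = solve-∀
    e' : ∀ P Γ W i → - ((P + + 1) * Γ) - W * - ((P + + 1) * i * Γ) ≡ (P + + 1) * Γ * (W * i - + 1)
    e' = solve-∀

  part-two : Claim₂ p
  part-two = (congQ₁ R₁ S₋₁₆ (≈-sym (drop-P (V (+ 1)) (- sgn n))) , congQ₁ S₋₁₆ rep-target (drop-P (V (+ 1)) (- sgn n) ⟫ V-value))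
    , (congQ₁ R₂ S₈ (≈-sym (drop-P (V (- + 2)) (+ 2 * L))) , congQ₁ S₈ rep-target (drop-P (V (- + 2)) (+ 2 * L) ⟫ V-at--2 ⟫ V-value))
    , (third , congQ₂ S₃₂ (rep-neg (rep-* (rep-divℚ (rep-ℤ (P + + 1)) (rep-ℤ W) unit-W) rep-Γ)) V-half-value)

-- Assembly by the residue of p modulo 4

quarter : ∀ p {r} → p ℕ.% 4 ≡ r → p ≡ r ℕ.+ p ℕ./ 4 ℕ.* 4
quarter p e = trans (m≡m%n+[m/n]*n p 4) (cong (ℕ._+ p ℕ./ 4 ℕ.* 4) e)

claim₁ : ∀ p → Prime p → p ℕ.% 4 ≡ 1 → ∀ x y → + p ≡ x ℤ.* x ℤ.+ y ℤ.* y → + 4 ℤD.∣ (x ℤ.- + 1) → + 2 ℤD.∣ y → Claim₁ p x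
claim₁ p pr e x y = from (p ℕ./ 4) (quarter p e) pr
  where
  from : ∀ {p} w → p ≡ 1 ℕ.+ w ℕ.* 4 → Prime p → + p ≡ x ℤ.* x ℤ.+ y ℤ.* y → + 4 ℤD.∣ (x ℤ.- + 1) → + 2 ℤD.∣ y → Claim₁ p x
  -- w = 0 would mean p = 1; excluding it provides the w > 0 on which the case p = 4w + 1 is built.
  from zero     refl pr = ⊥-elim (ℕP.<-irrefl refl (ℕ.nonTrivial⇒n>1 1 {{prime⇒nonTrivial pr}}))
  from {p} (suc w') p≡ = at p (trans p≡ (shape w'))
    where
    shape : ∀ w' → 1 ℕ.+ suc w' ℕ.* 4 ≡ suc (suc (w' ℕ.+ suc w') ℕ.+ suc (w' ℕ.+ suc w'))
    shape = ℕ-solve-∀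
    at : ∀ p → p ≡ suc (suc (w' ℕ.+ suc w') ℕ.+ suc (w' ℕ.+ suc w')) → Prime p → + p ≡ x ℤ.* x ℤ.+ y ℤ.* y → + 4 ℤD.∣ (x ℤ.- + 1) → + 2 ℤD.∣ y → Claim₁ p x
    at _ refl pr xy x₄ y₂ = PartOne.part-one w' pr x y xy (lc1 (+ 1) (∣ₘ⇒≈0 {x ℤ.- + 1} x₄) (ident x)) (∣ₘ⇒≈0 y₂)
      where
      ident : ∀ x → x ℤ.- + 1 ≡ + 1 ℤ.* (x ℤ.- + 1 ℤ.- + 0)
      ident = solve-∀

claim₂ : ∀ p → Prime p → p ℕ.% 4 ≡ 3 → Claim₂ p
claim₂ p pr e = at (p ℕ./ 4) p (trans (quarter p e) (shape (p ℕ./ 4))) pr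
  where
  shape : ∀ v → 3 ℕ.+ v ℕ.* 4 ≡ suc (suc (v ℕ.+ v) ℕ.+ suc (v ℕ.+ v))
  shape = ℕ-solve-∀
  at : ∀ v p → p ≡ suc (suc (v ℕ.+ v) ℕ.+ suc (v ℕ.+ v)) → Prime p → Claim₂ p
  at v _ refl pr = PartTwo.part-two v pr

open import Data.Nat.DivMod using (_%_; _/_)
open import Data.Integer.Divisibility as ℤD using ()
open import Data.Rational as ℚ using (_+_; _*_; _-_; -_)

theorem1p1 : ((p : ℕ) → Prime p → p % 4 ≡ 1 →
    (x y : ℤ) → + p ≡ x ℤ.* x ℤ.+ y ℤ.* y →
    (+ 4) ℤD.∣ (x ℤ.- + 1) → (+ 2) ℤD.∣ y →
    (CongQ p 2 (R ((p ℕ.∸ 1) / 2) 1ℚ - ℕtoℚ p) (S p (-[1+ 15 ] ℚ./ 1))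
    × CongQ p 2 (S p (-[1+ 15 ] ℚ./ 1))
    (- (ℕtoℚ 2 * ℤtoℚ (legendre 2 p) * ℤtoℚ x)))
    × (CongQ p 2 (R ((p ℕ.∸ 1) / 2) (-[1+ 1 ] ℚ./ 1) + ℕtoℚ 2 * ℕtoℚ p * ℤtoℚ (legendre 2 p))
    (S p (+ 8 ℚ./ 1))
    × CongQ p 2 (S p (+ 8 ℚ./ 1))
    (ℤtoℚ (legendre 2 p) * divℚ (ℕtoℚ p) (ℕtoℚ 2 * ℤtoℚ x)))
    × (CongQ p 2 (R ((p ℕ.∸ 1) / 2) (-[1+ 0 ] ℚ./ 2) + divℚ (ℕtoℚ p) (ℕtoℚ 2) * ℤtoℚ (legendre 2 p))
    (S p (+ 32 ℚ./ 1))
    × CongQ p 2 (S p (+ 32 ℚ./ 1))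
    (divℚ (ℕtoℚ p) (ℕtoℚ 4 * ℤtoℚ x) - ℤtoℚ x)))
    × ((p : ℕ) → Prime p → p % 4 ≡ 3 →
    (CongQ p 1 (R ((p ℕ.∸ 1) / 2) 1ℚ) (S p (-[1+ 15 ] ℚ./ 1))
    × CongQ p 1 (S p (-[1+ 15 ] ℚ./ 1))
    (- (divℚ 1ℚ (ℕtoℚ 2) * ℤtoℚ (legendre 2 p) * ℕtoℚ (((p ℕ.+ 1) / 2) C ((p ℕ.+ 1) / 4)))))
    × (CongQ p 1 (R ((p ℕ.∸ 1) / 2) (-[1+ 1 ] ℚ./ 1)) (S p (+ 8 ℚ./ 1))
    × CongQ p 1 (S p (+ 8 ℚ./ 1))
    (- (divℚ 1ℚ (ℕtoℚ 2) * ℤtoℚ (legendre 2 p) * ℕtoℚ (((p ℕ.+ 1) / 2) C ((p ℕ.+ 1) / 4)))))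
    × (CongQ p 2 (R ((p ℕ.∸ 1) / 2) (-[1+ 0 ] ℚ./ 2) + divℚ (ℕtoℚ p) (ℕtoℚ 2) * ℤtoℚ (legendre 2 p))
    (S p (+ 32 ℚ./ 1))
    × CongQ p 2 (S p (+ 32 ℚ./ 1))
    (- (divℚ (ℕtoℚ (p ℕ.+ 1)) (ℕtoℚ (2 ℕ.^ p ℕ.+ 2)) * ℕtoℚ (((p ℕ.+ 1) / 2) C ((p ℕ.+ 1) / 4))))))
theorem1p1 = claim₁ , claim₂
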